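{- For each $k=1,2,\ldots$ let $n(k),m(k)$ be integers with $1\le n(k)\le m(k)$, let $q(k)\in(0,1)$, and put $\ell(k)=m(k)-n(k)+1$. Assume that $$\ell(k)\,\log\bigl(q(k)^{ -1}\bigr)-\log m(k)\to\infty\qquad\text{as }k\to\infty.$$ Then the total variation distance between the stationary distribution of the bounded geometric juggler's exclusion process and that of its unbounded variant satisfies $$\bigl\|\pi_{m(k),n(k),q(k)}-\pi_{\infty,n(k),q(k)}\bigr\|_{\rm TV}\to0\qquad\text{as }k\to\infty.$$
   Context: $\mathbb{Z}_+=\{0,1,2,\ldots\}$ and $\mathbb{Z}_+^{(n)}=\{A\subset\mathbb{Z}_+:|A|=n\}$. For a finite set $A\subset\mathbb{Z}_+$, $\theta_A$ denotes the order-preserving bijection from $\mathbb{Z}_+$ onto $\mathbb{Z}_+\setminus A$. For a set $X$ of integers, $X-1=\{x-1:x\in X\}$. The bounded geometric juggler's exclusion process (JEP) with $n$ particles, $m\ge n$ admissible heights and parameter $q\in(0,1)$ is the Markov chain $(X_t)_{t\ge0}$ on the $n$-element subsets of $\{0,\ldots,m-1\}$ with the following dynamics. If $0\notin X_t$, then $X_{t+1}=X_t-1$. If $0\in X_t$, put $X_t^*=(X_t\setminus\{0\})-1$; then $X_{t+1}=X_t^*\cup\{\theta_{X_t^*}(\xi_t)\}$, where the $\xi_t$ are independent random integers (independent of $X_0$) with the truncated geometric distribution $\mathrm{P}(\xi_t=x)=\frac{1-q}{1-q^{\ell}}q^x$ for $x\in\{0,\ldots,\ell-1\}$, with $\ell=m-n+1$.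 It is known to have a unique stationary distribution $\pi_{m,n,q}$, which is viewed as a probability distribution on $\mathbb{Z}_+^{(n)}$ whose mass is concentrated on the $n$-element subsets of $\{0,\ldots,m-1\}$. The unbounded geometric JEP with $n$ particles and parameter $q$ is the Markov chain on $\mathbb{Z}_+^{(n)}$ with the same dynamics, except that the $\xi_t$ have the geometric distribution $\mathrm{P}(\xi_t=x)=(1-q)q^x$, $x\in\mathbb{Z}_+$. Its stationary distribution is known to be $$\pi_{\infty,n,q}(B)=\frac{(q;q)_n}{q^{\binom n2}}\prod_{x\in B}q^x,\qquad B\in\mathbb{Z}_+^{(n)},$$ where $(q;q)_n=\prod_{i=1}^n(1-q^i)$. The total variation distance between probability distributions $\mu,\nu$ on a countable set $S$ is $\|\mu-\nu\|_{\rm TV}=\frac12\sum_{A\in S}|\mu(A)-\nu(A)|$. -}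

module Defs where

open import Data.Bool.Base using (if_then_else_)
open import Data.Empty using (⊥-elim)
open import Data.Integer.Base as ℤ using (+_)
open import Data.List.Base as List using (List; []; _∷_; _++_; upTo)
open import Data.Nat.Base as ℕ using (ℕ; zero; suc; _!; z≤n; s≤s)
open import Data.Nat.Combinatorics using (_C_)
import Data.Nat.Properties as ℕₚ
open import Data.Product.Base using (_×_; _,_; ∃-syntax; Σ-syntax; proj₁; proj₂)
open import Data.Rational.Base as ℚ using (ℚ; 0ℚ; 1ℚ; ½)
import Data.Rational.Properties as ℚₚ
open import Data.Rational.Solver using (module +-*-Solver)
open import Data.Sum.Base using (_⊎_; inj₁; inj₂)
open import Data.Vec.Base as Vec using (Vec; []; _∷_)
open import Data.Vec.Membership.Propositional using (_∉_)
open import Data.Vec.Properties using (≡-dec)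
open import Data.Vec.Relation.Unary.All as All using (All; []; _∷_)
open import Data.Vec.Relation.Unary.Any using (here; there)
open import Data.Vec.Relation.Unary.Linked as Linked using (Linked; []; [-]; _∷_)
open import Data.Vec.Relation.Unary.Linked.Properties using (map⁺; Linked⇒All)
open import Function.Base using (_∘_; case_of_)
open import Relation.Binary.Definitions using (tri<; tri≈; tri>)
open import Relation.Binary.PropositionalEquality
  using (_≡_; refl; sym; trans; cong; cong₂; subst; subst₂)
open import Relation.Nullary using (¬_; yes; no; does)

-- Real numbers are Cauchy sequences of rationals, with the setoid equality
-- _≈_.  The modulus of convergence is part of the data, as in Bishop's
-- constructive analysis.

Eventually : (ℕ → Set) → Set
Eventually P = ∃[ N ] (∀ n → N ℕ.≤ n → P n)

IsCauchy : (ℕ → ℚ) → Set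
IsCauchy x = ∀ ε → 0ℚ ℚ.< ε →
  ∃[ N ] (∀ i j → N ℕ.≤ i → N ℕ.≤ j → ℚ.∣ x i ℚ.- x j ∣ ℚ.< ε)

record ℝ : Set where
  constructor mkℝ
  field
    seq    : ℕ → ℚ
    cauchy : IsCauchy seq

open ℝ public

infix 4 _≈_ _<_ _≤_

record _≈_ (x y : ℝ) : Set where
  constructor mk≈
  field
    close : ∀ ε → 0ℚ ℚ.< ε → Eventually λ n → ℚ.∣ seq x n ℚ.- seq y n ∣ ℚ.< ε

record _<_ (x y : ℝ) : Set where
  constructor mk<
  field
    gap       : ℚ
    gap-pos   : 0ℚ ℚ.< gap
    separated : Eventually λ n → seq x n ℚ.+ gap ℚ.≤ seq y n

record _≤_ (x y : ℝ) : Set where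
  constructor mk≤
  field
    almost : ∀ ε → 0ℚ ℚ.< ε → Eventually λ n → seq x n ℚ.≤ seq y n ℚ.+ ε

open +-*-Solver using (solve; _:=_; _:+_; _:*_; _:-_; :-_; con)

infixl 1 _∩ₑ_
_∩ₑ_ : ∀ {P Q : ℕ → Set} → Eventually P → Eventually Q →
       Eventually (λ n → P n × Q n)
(M , p) ∩ₑ (N , q) = M ℕ.⊔ N , λ n le →
  p n (ℕₚ.≤-trans (ℕₚ.m≤m⊔n M N) le) , q n (ℕₚ.≤-trans (ℕₚ.m≤n⊔m M N) le)

mapₑ : ∀ {P Q : ℕ → Set} → (∀ {n} → P n → Q n) → Eventually P → Eventually Q
mapₑ f (N , p) = N , λ n le → f (p n le)

*-pos : ∀ {p q} → 0ℚ ℚ.< p → 0ℚ ℚ.< q → 0ℚ ℚ.< p ℚ.* q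
*-pos {p} {q} 0<p 0<q = ℚₚ.positive⁻¹ (p ℚ.* q)
  where instance _ = ℚₚ.pos*pos⇒pos p {{ℚ.positive 0<p}} q {{ℚ.positive 0<q}}

*-mono-≤ : ∀ {p q r s} → 0ℚ ℚ.≤ q → 0ℚ ℚ.≤ r → p ℚ.≤ q → r ℚ.≤ s →
           p ℚ.* r ℚ.≤ q ℚ.* s
*-mono-≤ {p} {q} {r} {s} 0≤q 0≤r p≤q r≤s = ℚₚ.≤-trans
  (ℚₚ.*-monoʳ-≤-nonNeg r {{ℚ.nonNegative 0≤r}} p≤q)
  (ℚₚ.*-monoˡ-≤-nonNeg q {{ℚ.nonNegative 0≤q}} r≤s)

half-pos : ∀ {ε} → 0ℚ ℚ.< ε → 0ℚ ℚ.< ε ℚ.* ½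
half-pos 0<ε = *-pos 0<ε (ℚₚ.positive⁻¹ ½)

halves : ∀ ε → ε ℚ.* ½ ℚ.+ ε ℚ.* ½ ≡ ε
halves ε = trans (sym (ℚₚ.*-distribˡ-+ ε ½ ½)) (ℚₚ.*-identityʳ ε)

-- Reciprocal on ℚ with the junk value 0 at 0.
recip : ℚ → ℚ
recip p with p ℚₚ.≟ 0ℚ
... | yes _  = 0ℚ
... | no p≢0 = ℚ.1/_ p {{ℚ.≢-nonZero p≢0}}

recip-inverse : ∀ {p} → 0ℚ ℚ.< p → p ℚ.* recip p ≡ 1ℚ
recip-inverse {p} 0<p with p ℚₚ.≟ 0ℚ
... | yes p≡0 = ⊥-elim (ℚₚ.<-irrefl (sym p≡0) 0<p)
... | no p≢0  = ℚₚ.*-inverseʳ p {{ℚ.≢-nonZero p≢0}}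

recip-pos : ∀ {p} → 0ℚ ℚ.< p → 0ℚ ℚ.< recip p
recip-pos {p} 0<p = ℚₚ.*-cancelˡ-<-nonNeg p {{ℚ.nonNegative (ℚₚ.<⇒≤ 0<p)}}
  (subst₂ ℚ._<_ (sym (ℚₚ.*-zeroʳ p)) (sym (recip-inverse 0<p)) (ℚₚ.positive⁻¹ 1ℚ))

recip-anti : ∀ {p q} → 0ℚ ℚ.< p → p ℚ.≤ q → recip q ℚ.≤ recip p
recip-anti {p} {q} 0<p p≤q = ℚₚ.*-cancelˡ-≤-pos p {{ℚ.positive 0<p}}
  (subst (p ℚ.* recip q ℚ.≤_) (trans (recip-inverse 0<q) (sym (recip-inverse 0<p)))
    (ℚₚ.*-monoʳ-≤-nonNeg (recip q) {{ℚ.nonNegative (ℚₚ.<⇒≤ (recip-pos 0<q))}} p≤q))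
  where 0<q = ℚₚ.<-≤-trans 0<p p≤q

recip-diff : ∀ p q → 0ℚ ℚ.< p → 0ℚ ℚ.< q →
             recip p ℚ.- recip q ≡ (q ℚ.- p) ℚ.* (recip p ℚ.* recip q)
recip-diff p q 0<p 0<q =
  identity p q (recip p) (recip q) (recip-inverse 0<p) (recip-inverse 0<q)
  where
  regroup : ∀ p q a b →
            (q ℚ.- p) ℚ.* (a ℚ.* b) ≡ (q ℚ.* b) ℚ.* a ℚ.- (p ℚ.* a) ℚ.* b
  regroup = solve 4 (λ p q a b →
    (q :- p) :* (a :* b) := (q :* b) :* a :- (p :* a) :* b) refl

  identity : ∀ p q a b → p ℚ.* a ≡ 1ℚ → q ℚ.* b ≡ 1ℚ →
             a ℚ.- b ≡ (q ℚ.- p) ℚ.* (a ℚ.* b)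
  identity p q a b pa≡1 qb≡1 = sym (trans (regroup p q a b)
    (cong₂ ℚ._-_
      (trans (cong (ℚ._* a) qb≡1) (ℚₚ.*-identityˡ a))
      (trans (cong (ℚ._* b) pa≡1) (ℚₚ.*-identityˡ b))))

≤+ : ∀ p q → 0ℚ ℚ.≤ q → p ℚ.≤ p ℚ.+ q
≤+ p q 0≤q = subst (ℚ._≤ p ℚ.+ q) (ℚₚ.+-identityʳ p) (ℚₚ.+-monoʳ-≤ p 0≤q)

split : ∀ {B ε} → 0ℚ ℚ.< B → 0ℚ ℚ.< ε → Σ[ δ ∈ ℚ ] 0ℚ ℚ.< δ × B ℚ.* δ ≡ ε
split {B} {ε} 0<B 0<ε = recip B ℚ.* ε , *-pos (recip-pos 0<B) 0<ε ,
  trans (sym (ℚₚ.*-assoc B (recip B) ε))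
    (trans (cong (ℚ._* ε) (recip-inverse 0<B)) (ℚₚ.*-identityˡ ε))

-‿+-cancel : ∀ a b → (a ℚ.- b) ℚ.+ b ≡ a
-‿+-cancel = solve 2 (λ a b → (a :- b) :+ b := a) refl

∣a∣≤∣a-b∣+∣b∣ : ∀ a b → ℚ.∣ a ∣ ℚ.≤ ℚ.∣ a ℚ.- b ∣ ℚ.+ ℚ.∣ b ∣
∣a∣≤∣a-b∣+∣b∣ a b = subst (λ c → ℚ.∣ c ∣ ℚ.≤ ℚ.∣ a ℚ.- b ∣ ℚ.+ ℚ.∣ b ∣)
  (-‿+-cancel a b) (ℚₚ.∣p+q∣≤∣p∣+∣q∣ (a ℚ.- b) b)

neg-sub : ∀ a b → ℚ.- (a ℚ.- b) ≡ b ℚ.- a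
neg-sub = solve 2 (λ a b → :- (a :- b) := b :- a) refl

∣a-b∣≡∣b-a∣ : ∀ a b → ℚ.∣ a ℚ.- b ∣ ≡ ℚ.∣ b ℚ.- a ∣
∣a-b∣≡∣b-a∣ a b = trans (sym (ℚₚ.∣-p∣≡∣p∣ (a ℚ.- b)))
  (cong ℚ.∣_∣ (neg-sub a b))

∣a∣-∣b∣≤∣a-b∣ : ∀ a b → ℚ.∣ a ∣ ℚ.- ℚ.∣ b ∣ ℚ.≤ ℚ.∣ a ℚ.- b ∣
∣a∣-∣b∣≤∣a-b∣ a b = subst (ℚ.∣ a ∣ ℚ.- ℚ.∣ b ∣ ℚ.≤_)
  (cancel ℚ.∣ a ℚ.- b ∣ ℚ.∣ b ∣)
  (ℚₚ.+-monoˡ-≤ (ℚ.- ℚ.∣ b ∣) (∣a∣≤∣a-b∣+∣b∣ a b))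
  where
  cancel : ∀ u v → (u ℚ.+ v) ℚ.- v ≡ u
  cancel = solve 2 (λ u v → (u :+ v) :- v := u) refl

reverse-triangle : ∀ a b → ℚ.∣ ℚ.∣ a ∣ ℚ.- ℚ.∣ b ∣ ∣ ℚ.≤ ℚ.∣ a ℚ.- b ∣
reverse-triangle a b with ℚₚ.∣p∣≡p∨∣p∣≡-p (ℚ.∣ a ∣ ℚ.- ℚ.∣ b ∣)
... | inj₁ eq = subst (ℚ._≤ ℚ.∣ a ℚ.- b ∣) (sym eq) (∣a∣-∣b∣≤∣a-b∣ a b)
... | inj₂ eq = subst₂ ℚ._≤_ (sym (trans eq (neg-sub ℚ.∣ a ∣ ℚ.∣ b ∣)))
  (∣a-b∣≡∣b-a∣ b a) (∣a∣-∣b∣≤∣a-b∣ b a)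

∣sum-diff∣≤ : ∀ a b c d → ℚ.∣ (a ℚ.+ b) ℚ.- (c ℚ.+ d) ∣ ℚ.≤
              1ℚ ℚ.* (ℚ.∣ a ℚ.- c ∣ ℚ.+ ℚ.∣ b ℚ.- d ∣)
∣sum-diff∣≤ a b c d = subst₂ ℚ._≤_ (cong ℚ.∣_∣ (sym (regroup a b c d)))
  (sym (ℚₚ.*-identityˡ (ℚ.∣ a ℚ.- c ∣ ℚ.+ ℚ.∣ b ℚ.- d ∣)))
  (ℚₚ.∣p+q∣≤∣p∣+∣q∣ (a ℚ.- c) (b ℚ.- d))
  where
  regroup : ∀ a b c d → (a ℚ.+ b) ℚ.- (c ℚ.+ d) ≡ (a ℚ.- c) ℚ.+ (b ℚ.- d)
  regroup = solve 4 (λ a b c d → (a :+ b) :- (c :+ d) := (a :- c) :+ (b :- d)) refl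

*-nonneg : ∀ {p q} → 0ℚ ℚ.≤ p → 0ℚ ℚ.≤ q → 0ℚ ℚ.≤ p ℚ.* q
*-nonneg {p} {q} 0≤p 0≤q = subst (ℚ._≤ p ℚ.* q) (ℚₚ.*-zeroʳ p)
  (ℚₚ.*-monoˡ-≤-nonNeg p {{ℚ.nonNegative 0≤p}} 0≤q)

∣product-diff∣≤ : ∀ A B a b c d → 0ℚ ℚ.< A → 0ℚ ℚ.< B →
  ℚ.∣ a ∣ ℚ.≤ A → ℚ.∣ d ∣ ℚ.≤ B →
  ℚ.∣ a ℚ.* b ℚ.- c ℚ.* d ∣ ℚ.≤ (A ℚ.+ B) ℚ.* (ℚ.∣ a ℚ.- c ∣ ℚ.+ ℚ.∣ b ℚ.- d ∣)
∣product-diff∣≤ A B a b c d 0<A 0<B a≤A d≤B = begin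
  ℚ.∣ a ℚ.* b ℚ.- c ℚ.* d ∣                        ≡⟨ cong ℚ.∣_∣ (regroup a b c d) ⟩
  ℚ.∣ a ℚ.* (b ℚ.- d) ℚ.+ d ℚ.* (a ℚ.- c) ∣        ≤⟨ ℚₚ.∣p+q∣≤∣p∣+∣q∣ (a ℚ.* (b ℚ.- d)) (d ℚ.* (a ℚ.- c)) ⟩
  ℚ.∣ a ℚ.* (b ℚ.- d) ∣ ℚ.+ ℚ.∣ d ℚ.* (a ℚ.- c) ∣  ≡⟨ cong₂ ℚ._+_ (ℚₚ.∣p*q∣≡∣p∣*∣q∣ a (b ℚ.- d)) (ℚₚ.∣p*q∣≡∣p∣*∣q∣ d (a ℚ.- c)) ⟩
  ℚ.∣ a ∣ ℚ.* v ℚ.+ ℚ.∣ d ∣ ℚ.* u                  ≤⟨ ℚₚ.+-mono-≤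
    (ℚₚ.*-monoʳ-≤-nonNeg v {{ℚₚ.∣-∣-nonNeg (b ℚ.- d)}} a≤A)
    (ℚₚ.*-monoʳ-≤-nonNeg u {{ℚₚ.∣-∣-nonNeg (a ℚ.- c)}} d≤B) ⟩
  A ℚ.* v ℚ.+ B ℚ.* u                              ≤⟨ ≤+ (A ℚ.* v ℚ.+ B ℚ.* u) (A ℚ.* u ℚ.+ B ℚ.* v)
    (ℚₚ.+-mono-≤ (*-nonneg (ℚₚ.<⇒≤ 0<A) 0≤u) (*-nonneg (ℚₚ.<⇒≤ 0<B) 0≤v)) ⟩
  (A ℚ.* v ℚ.+ B ℚ.* u) ℚ.+ (A ℚ.* u ℚ.+ B ℚ.* v)  ≡⟨ collect A B u v ⟩
  (A ℚ.+ B) ℚ.* (u ℚ.+ v)                          ∎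
  where
  open ℚₚ.≤-Reasoning
  u = ℚ.∣ a ℚ.- c ∣
  v = ℚ.∣ b ℚ.- d ∣

  0≤u : 0ℚ ℚ.≤ u
  0≤u = ℚₚ.0≤∣p∣ (a ℚ.- c)

  0≤v : 0ℚ ℚ.≤ v
  0≤v = ℚₚ.0≤∣p∣ (b ℚ.- d)

  regroup : ∀ a b c d → a ℚ.* b ℚ.- c ℚ.* d ≡ a ℚ.* (b ℚ.- d) ℚ.+ d ℚ.* (a ℚ.- c)
  regroup = solve 4 (λ a b c d → a :* b :- c :* d := a :* (b :- d) :+ d :* (a :- c)) refl

  collect : ∀ A B u v → (A ℚ.* v ℚ.+ B ℚ.* u) ℚ.+ (A ℚ.* u ℚ.+ B ℚ.* v) ≡
                        (A ℚ.+ B) ℚ.* (u ℚ.+ v)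
  collect = solve 4 (λ A B u v →
    (A :* v :+ B :* u) :+ (A :* u :+ B :* v) := (A :+ B) :* (u :+ v)) refl

∣recip-diff∣≤ : ∀ δ a b → 0ℚ ℚ.< δ → δ ℚ.≤ a → δ ℚ.≤ b →
  ℚ.∣ recip a ℚ.- recip b ∣ ℚ.≤ (recip δ ℚ.* recip δ) ℚ.* ℚ.∣ a ℚ.- b ∣
∣recip-diff∣≤ δ a b 0<δ δ≤a δ≤b = begin
  ℚ.∣ recip a ℚ.- recip b ∣                        ≡⟨ cong ℚ.∣_∣ (recip-diff a b 0<a 0<b) ⟩
  ℚ.∣ (b ℚ.- a) ℚ.* (recip a ℚ.* recip b) ∣        ≡⟨ ℚₚ.∣p*q∣≡∣p∣*∣q∣ (b ℚ.- a) (recip a ℚ.* recip b) ⟩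
  ℚ.∣ b ℚ.- a ∣ ℚ.* ℚ.∣ recip a ℚ.* recip b ∣      ≡⟨ cong₂ ℚ._*_ (∣a-b∣≡∣b-a∣ b a) (ℚₚ.0≤p⇒∣p∣≡p 0≤rr) ⟩
  ℚ.∣ a ℚ.- b ∣ ℚ.* (recip a ℚ.* recip b)          ≤⟨ ℚₚ.*-monoˡ-≤-nonNeg ℚ.∣ a ℚ.- b ∣ {{ℚₚ.∣-∣-nonNeg (a ℚ.- b)}}
    (*-mono-≤ (ℚₚ.<⇒≤ (recip-pos 0<δ)) (ℚₚ.<⇒≤ (recip-pos 0<b))
      (recip-anti 0<δ δ≤a) (recip-anti 0<δ δ≤b)) ⟩
  ℚ.∣ a ℚ.- b ∣ ℚ.* (recip δ ℚ.* recip δ)          ≡⟨ ℚₚ.*-comm ℚ.∣ a ℚ.- b ∣ (recip δ ℚ.* recip δ) ⟩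
  (recip δ ℚ.* recip δ) ℚ.* ℚ.∣ a ℚ.- b ∣          ∎
  where
  open ℚₚ.≤-Reasoning
  0<a : 0ℚ ℚ.< a
  0<a = ℚₚ.<-≤-trans 0<δ δ≤a
  0<b : 0ℚ ℚ.< b
  0<b = ℚₚ.<-≤-trans 0<δ δ≤b
  0≤rr : 0ℚ ℚ.≤ recip a ℚ.* recip b
  0≤rr = ℚₚ.<⇒≤ (*-pos (recip-pos 0<a) (recip-pos 0<b))

Bounded : ℝ → Set
Bounded x = Σ[ B ∈ ℚ ] 0ℚ ℚ.< B × Eventually λ n → ℚ.∣ seq x n ∣ ℚ.≤ B

bounded : ∀ x → Bounded x
bounded x = case cauchy x 1ℚ (ℚₚ.positive⁻¹ 1ℚ) of λ where
  (N , h) → 1ℚ ℚ.+ ℚ.∣ seq x N ∣ ,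
    ℚₚ.+-mono-<-≤ (ℚₚ.positive⁻¹ 1ℚ) (ℚₚ.0≤∣p∣ (seq x N)) ,
    N , λ n le → ℚₚ.≤-trans (∣a∣≤∣a-b∣+∣b∣ (seq x n) (seq x N))
      (ℚₚ.+-monoˡ-≤ ℚ.∣ seq x N ∣ (ℚₚ.<⇒≤ (h n N le ℕₚ.≤-refl)))

-- A sequence is Cauchy if its oscillation is controlled by that of two
-- reals on a common tail.
cauchy-by : ∀ (x y : ℝ) (z : ℕ → ℚ) (B : ℚ) → 0ℚ ℚ.< B → (N₀ : ℕ) →
  (∀ i j → N₀ ℕ.≤ i → N₀ ℕ.≤ j → ℚ.∣ z i ℚ.- z j ∣ ℚ.≤
    B ℚ.* (ℚ.∣ seq x i ℚ.- seq x j ∣ ℚ.+ ℚ.∣ seq y i ℚ.- seq y j ∣)) →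
  IsCauchy z
cauchy-by x y z B 0<B N₀ bound ε 0<ε with split 0<B 0<ε
... | δ , 0<δ , Bδ≡ε with cauchy x (δ ℚ.* ½) (half-pos 0<δ)
                        | cauchy y (δ ℚ.* ½) (half-pos 0<δ)
... | M , p | N , q = N₀ ℕ.⊔ (M ℕ.⊔ N) , λ i j i≥ j≥ →
  ℚₚ.≤-<-trans (bound i j (ℕₚ.m⊔n≤o⇒m≤o N₀ _ i≥) (ℕₚ.m⊔n≤o⇒m≤o N₀ _ j≥))
    (subst (_ ℚ.<_) Bδ≡ε (ℚₚ.*-monoʳ-<-pos B {{ℚ.positive 0<B}}
      (subst (_ ℚ.<_) (halves δ) (ℚₚ.+-mono-<
        (p i j (ℕₚ.m⊔n≤o⇒m≤o M N (ℕₚ.m⊔n≤o⇒n≤o N₀ _ i≥))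
               (ℕₚ.m⊔n≤o⇒m≤o M N (ℕₚ.m⊔n≤o⇒n≤o N₀ _ j≥)))
        (q i j (ℕₚ.m⊔n≤o⇒n≤o M N (ℕₚ.m⊔n≤o⇒n≤o N₀ _ i≥))
               (ℕₚ.m⊔n≤o⇒n≤o M N (ℕₚ.m⊔n≤o⇒n≤o N₀ _ j≥)))))))

constant-cauchy : ∀ p → IsCauchy (λ _ → p)
constant-cauchy p ε 0<ε = 0 , λ _ _ _ _ →
  subst (ℚ._< ε) (cong ℚ.∣_∣ (sym (ℚₚ.+-inverseʳ p))) 0<ε

+-cauchy : ∀ x y → IsCauchy (λ n → seq x n ℚ.+ seq y n)
+-cauchy x y =
  cauchy-by x y (λ n → seq x n ℚ.+ seq y n) 1ℚ (ℚₚ.positive⁻¹ 1ℚ) 0 λ i j _ _ →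
    ∣sum-diff∣≤ (seq x i) (seq y i) (seq x j) (seq y j)

neg-cauchy : ∀ x → IsCauchy (λ n → ℚ.- seq x n)
neg-cauchy x ε 0<ε = case cauchy x ε 0<ε of λ where
  (N , h) → N , λ i j i≥ j≥ → subst (ℚ._< ε)
    (trans (sym (ℚₚ.∣-p∣≡∣p∣ (seq x i ℚ.- seq x j)))
      (cong ℚ.∣_∣ (ℚₚ.neg-distrib-+ (seq x i) (ℚ.- seq x j))))
    (h i j i≥ j≥)

*-cauchy : ∀ x y → Bounded x → Bounded y → IsCauchy (λ n → seq x n ℚ.* seq y n)
*-cauchy x y (A , 0<A , M , p) (B , 0<B , N , q) =
  cauchy-by x y (λ n → seq x n ℚ.* seq y n) (A ℚ.+ B) (ℚₚ.+-mono-< 0<A 0<B) (M ℕ.⊔ N)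
    λ i j i≥ j≥ → ∣product-diff∣≤ A B (seq x i) (seq y i) (seq x j) (seq y j) 0<A 0<B
      (p i (ℕₚ.m⊔n≤o⇒m≤o M N i≥)) (q j (ℕₚ.m⊔n≤o⇒n≤o M N j≥))

abs-cauchy : ∀ x → IsCauchy (λ n → ℚ.∣ seq x n ∣)
abs-cauchy x ε 0<ε = case cauchy x ε 0<ε of λ where
  (N , h) → N , λ i j i≥ j≥ →
    ℚₚ.≤-<-trans (reverse-triangle (seq x i) (seq x j)) (h i j i≥ j≥)

recip-cauchy : ∀ x {δ} → 0ℚ ℚ.< δ → Eventually (λ n → δ ℚ.≤ seq x n) →
               IsCauchy (λ n → recip (seq x n))
recip-cauchy x {δ} 0<δ (N₀ , δ≤) ε 0<ε
  with split (*-pos (recip-pos 0<δ) (recip-pos 0<δ)) 0<ε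
... | η , 0<η , Kη≡ε with cauchy x η 0<η
... | N , h = N₀ ℕ.⊔ N , λ i j i≥ j≥ → ℚₚ.≤-<-trans
  (∣recip-diff∣≤ δ (seq x i) (seq x j) 0<δ
    (δ≤ i (ℕₚ.m⊔n≤o⇒m≤o N₀ N i≥)) (δ≤ j (ℕₚ.m⊔n≤o⇒m≤o N₀ N j≥)))
  (subst (recip δ ℚ.* recip δ ℚ.* ℚ.∣ seq x i ℚ.- seq x j ∣ ℚ.<_) Kη≡ε
    (ℚₚ.*-monoʳ-<-pos (recip δ ℚ.* recip δ)
      {{ℚ.positive (*-pos (recip-pos 0<δ) (recip-pos 0<δ))}}
      (h i j (ℕₚ.m⊔n≤o⇒n≤o N₀ N i≥) (ℕₚ.m⊔n≤o⇒n≤o N₀ N j≥))))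

infix  8 -_
infixl 7 _*_
infixl 6 _+_ _-_
infixr 8 _^_

-- The operations are opaque because comparing unfolded reals would make
-- the type checker compare the proofs of the Cauchy property.
opaque
  fromℚ : ℚ → ℝ
  fromℚ p = mkℝ (λ _ → p) (constant-cauchy p)

  _+_ : ℝ → ℝ → ℝ
  x + y = mkℝ (λ n → seq x n ℚ.+ seq y n) (+-cauchy x y)

  -_ : ℝ → ℝ
  - x = mkℝ (λ n → ℚ.- seq x n) (neg-cauchy x)

  _*_ : ℝ → ℝ → ℝ
  x * y = mkℝ (λ n → seq x n ℚ.* seq y n) (*-cauchy x y (bounded x) (bounded y))

  ∣_∣ : ℝ → ℝ
  ∣ x ∣ = mkℝ (λ n → ℚ.∣ seq x n ∣) (abs-cauchy x)

_-_ : ℝ → ℝ → ℝ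
x - y = x + - y

0ℝ 1ℝ : ℝ
0ℝ = fromℚ 0ℚ
1ℝ = fromℚ 1ℚ

fromℕ : ℕ → ℝ
fromℕ n = fromℚ (+ n ℚ./ 1)

_^_ : ℝ → ℕ → ℝ
x ^ zero  = 1ℝ
x ^ suc j = x * x ^ j

opaque
  unfolding fromℚ

  pos-below : ∀ {x} (0<x : 0ℝ < x) → Eventually λ n → _<_.gap 0<x ℚ.≤ seq x n
  pos-below {x} (mk< δ _ h) =
    mapₑ (λ {n} → subst (ℚ._≤ seq x n) (ℚₚ.+-identityˡ δ)) h

  0<-intro : ∀ {x δ} → 0ℚ ℚ.< δ → Eventually (λ n → δ ℚ.≤ seq x n) → 0ℝ < x
  0<-intro {x} {δ} 0<δ h = mk< δ 0<δ
    (mapₑ (λ {n} → subst (ℚ._≤ seq x n) (sym (ℚₚ.+-identityˡ δ))) h)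

opaque
  inv : (x : ℝ) → 0ℝ < x → ℝ
  inv x 0<x = mkℝ (λ n → recip (seq x n))
    (recip-cauchy x (_<_.gap-pos 0<x) (pos-below 0<x))

∑ ∏ : ∀ {A : Set} → List A → (A → ℝ) → ℝ
∑ xs f = List.foldr (λ a s → f a + s) 0ℝ xs
∏ xs f = List.foldr (λ a s → f a * s) 1ℝ xs

infix 4 _⟶_

_⟶_ : (ℕ → ℝ) → ℝ → Set
x ⟶ a = ∀ ε → 0ℝ < ε → Eventually λ k → ∣ x k - a ∣ < ε

_⟶∞ : (ℕ → ℝ) → Set
x ⟶∞ = ∀ M → Eventually λ k → M < x k

-- L is the natural logarithm of x, that is,
-- exp L = Σ_{j ≥ 0} L^j / j! converges to x.
IsLog : ℝ → ℝ → Set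
IsLog x L = (λ N → ∑ (upTo N) λ j → fromℚ (1/! j) * L ^ j) ⟶ x
  where
  1/! : ℕ → ℚ
  1/! j = (+ 1 ℚ./ j !) {{ℕₚ._!≢0 j}}

opaque
  unfolding fromℚ

  0<y-x : ∀ {x y} → x < y → 0ℝ < y - x
  0<y-x {x} {y} (mk< δ 0<δ h) = 0<-intro 0<δ (mapₑ (λ {n} →
    shift (seq x n) (seq y n)) h)
    where
    cancel : ∀ a d → (a ℚ.+ d) ℚ.- a ≡ d
    cancel = solve 2 (λ a d → (a :+ d) :- a := d) refl

    shift : ∀ a b → a ℚ.+ δ ℚ.≤ b → δ ℚ.≤ b ℚ.- a
    shift a b le = subst (ℚ._≤ b ℚ.- a) (cancel a δ) (ℚₚ.+-monoˡ-≤ (ℚ.- a) le)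

  0<x*y : ∀ {x y} → 0ℝ < x → 0ℝ < y → 0ℝ < x * y
  0<x*y {x} {y} 0<x@(mk< δ 0<δ _) 0<y@(mk< η 0<η _) = 0<-intro (*-pos 0<δ 0<η)
    (mapₑ (λ { {n} (p , q) → *-mono-≤ {δ} {seq x n} {η} {seq y n}
        (ℚₚ.≤-trans (ℚₚ.<⇒≤ 0<δ) p) (ℚₚ.<⇒≤ 0<η) p q })
      (pos-below 0<x ∩ₑ pos-below 0<y))

  0<x^j : ∀ {x} → 0ℝ < x → ∀ j → 0ℝ < x ^ j
  0<x^j 0<x zero    = 0<-intro (ℚₚ.positive⁻¹ 1ℚ) (0 , λ _ _ → ℚₚ.≤-refl)
  0<x^j {x} 0<x (suc j) = 0<x*y {x} {x ^ j} 0<x (0<x^j 0<x j)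

  power-bounds : ∀ x n → 0ℚ ℚ.≤ seq x n → seq x n ℚ.≤ 1ℚ →
                 ∀ j → 0ℚ ℚ.≤ seq (x ^ j) n × seq (x ^ j) n ℚ.≤ 1ℚ
  power-bounds x n 0≤a a≤1 zero = ℚₚ.<⇒≤ (ℚₚ.positive⁻¹ 1ℚ) , ℚₚ.≤-refl
  power-bounds x n 0≤a a≤1 (suc j) with power-bounds x n 0≤a a≤1 j
  ... | l , u =
    *-nonneg {seq x n} {seq (x ^ j) n} 0≤a l ,
    *-mono-≤ {seq x n} {1ℚ} {seq (x ^ j) n} {1ℚ}
      (ℚₚ.<⇒≤ (ℚₚ.positive⁻¹ 1ℚ)) l a≤1 u

  x^[1+j]<1 : ∀ {x} → 0ℝ < x → x < 1ℝ → ∀ j → x ^ suc j < 1ℝ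
  x^[1+j]<1 {x} 0<x@(mk< δ 0<δ _) (mk< η 0<η k) j = mk< η 0<η
    (mapₑ (λ { {n} (p , q) → bound n (ℚₚ.≤-trans (ℚₚ.<⇒≤ 0<δ) p) q })
      (pos-below 0<x ∩ₑ k))
    where
    bound : ∀ n → 0ℚ ℚ.≤ seq x n → seq x n ℚ.+ η ℚ.≤ 1ℚ →
            seq (x ^ suc j) n ℚ.+ η ℚ.≤ 1ℚ
    bound n 0≤a a+η≤1 = ℚₚ.≤-trans
      (ℚₚ.+-monoˡ-≤ η (subst (seq x n ℚ.* seq (x ^ j) n ℚ.≤_) (ℚₚ.*-identityʳ (seq x n))
        (*-mono-≤ {seq x n} {seq x n} {seq (x ^ j) n} {1ℚ} 0≤a
          (proj₁ bounds) ℚₚ.≤-refl (proj₂ bounds))))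
      a+η≤1
      where
      bounds : 0ℚ ℚ.≤ seq (x ^ j) n × seq (x ^ j) n ℚ.≤ 1ℚ
      bounds = power-bounds x n 0≤a (ℚₚ.≤-trans (≤+ (seq x n) η (ℚₚ.<⇒≤ 0<η)) a+η≤1) j

record OpenUnitInterval : Set where
  field
    value : ℝ
    0<    : 0ℝ < value
    <1    : value < 1ℝ

open OpenUnitInterval public

-- The n-element subsets of ℕ, as strictly increasing vectors.  Irrelevance
-- of the proof makes subsets with the same elements equal.

Increasing : ∀ {n} → Vec ℕ n → Set
Increasing = Linked ℕ._<_

record ℕ⁽_⁾ (n : ℕ) : Set where
  constructor mk
  field
    elements    : Vec ℕ n
    .increasing : Increasing elements

open ℕ⁽_⁾ public using (elements)

∷-increasing : ∀ {n x} {xs : Vec ℕ n} →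
               All (x ℕ.<_) xs → Increasing xs → Increasing (x ∷ xs)
∷-increasing []        _   = [-]
∷-increasing (x<y ∷ _) inc = x<y ∷ inc

head<tail : ∀ {n x} {xs : Vec ℕ n} → Increasing (x ∷ xs) → All (x ℕ.<_) xs
head<tail [-]         = []
head<tail (x<y ∷ inc) = Linked⇒All ℕₚ.<-trans x<y inc

tail-increasing : ∀ {n x} {xs : Vec ℕ n} → Increasing (x ∷ xs) → Increasing xs
tail-increasing = Linked.tail

map-suc-increasing : ∀ {n} {xs : Vec ℕ n} →
                     Increasing xs → Increasing (Vec.map suc xs)
map-suc-increasing inc = map⁺ (Linked.map s≤s inc)

map-pred-increasing : ∀ {n} {xs : Vec ℕ n} → All (0 ℕ.<_) xs →
                      Increasing xs → Increasing (Vec.map ℕ.pred xs)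
map-pred-increasing []         inc = []
map-pred-increasing (0<x ∷ 0<xs) inc =
  ∷-increasing (pred-< 0<x (head<tail inc)) (map-pred-increasing 0<xs (tail-increasing inc))
  where
  pred-< : ∀ {n x} {ys : Vec ℕ n} → 0 ℕ.< x → All (x ℕ.<_) ys →
           All (ℕ.pred x ℕ.<_) (Vec.map ℕ.pred ys)
  pred-< 0<x []                = []
  pred-< (s≤s z≤n) (s≤s x<y ∷ x<ys) = x<y ∷ pred-< (s≤s z≤n) x<ys

∅ : ℕ⁽ 0 ⁾
∅ = mk [] []

infix 20 _+1

_+1 : ∀ {n} → ℕ⁽ n ⁾ → ℕ⁽ n ⁾
mk xs inc +1 = mk (Vec.map suc xs) (map-suc-increasing inc)

0∪_+1 : ∀ {n} → ℕ⁽ n ⁾ → ℕ⁽ suc n ⁾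
0∪ mk xs inc +1 = mk (0 ∷ Vec.map suc xs)
  (∷-increasing (0<map-suc xs) (map-suc-increasing inc))
  where
  0<map-suc : ∀ {n} (xs : Vec ℕ n) → All (0 ℕ.<_) (Vec.map suc xs)
  0<map-suc []       = []
  0<map-suc (_ ∷ xs) = s≤s z≤n ∷ 0<map-suc xs

-- All n-element subsets of {0 , … , m - 1}, each listed once: those which
-- contain 0, followed by those which do not.
subsets : (n m : ℕ) → List ℕ⁽ n ⁾
subsets zero    m       = ∅ ∷ []
subsets (suc n) zero    = []
subsets (suc n) (suc m) =
  List.map 0∪_+1 (subsets n m) ++ List.map _+1 (subsets (suc n) m)

-- The order-preserving bijection ℕ → ℕ ∖ A for A listed in increasing
-- order; see θ-mono-<, θ-∉ and θ-surjective.
θ : ∀ {n} → Vec ℕ n → ℕ → ℕ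
θ []       x = x
θ (a ∷ as) x with x ℕₚ.<? a
... | yes _ = x
... | no  _ = θ as (suc x)

x≤θ : ∀ {n} (as : Vec ℕ n) x → x ℕ.≤ θ as x
x≤θ []       x = ℕₚ.≤-refl
x≤θ (a ∷ as) x with x ℕₚ.<? a
... | yes _ = ℕₚ.≤-refl
... | no  _ = ℕₚ.<⇒≤ (x≤θ as (suc x))

θ-mono-< : ∀ {n} (as : Vec ℕ n) {x y} → x ℕ.< y → θ as x ℕ.< θ as y
θ-mono-< []       x<y = x<y
θ-mono-< (a ∷ as) {x} {y} x<y with x ℕₚ.<? a | y ℕₚ.<? a
... | yes _  | yes _  = x<y
... | yes _  | no _   = ℕₚ.<-trans x<y (x≤θ as (suc y))
... | no x≮a | yes y<a = ⊥-elim (x≮a (ℕₚ.<-trans x<y y<a))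
... | no _   | no _   = θ-mono-< as (s≤s x<y)

below-∉ : ∀ {n x} {as : Vec ℕ n} → All (x ℕ.<_) as → x ∉ as
below-∉ (x<a ∷ _)  (here refl) = ℕₚ.<-irrefl refl x<a
below-∉ (_ ∷ x<as) (there x∈)  = below-∉ x<as x∈

θ-∉ : ∀ {n} (as : Vec ℕ n) → Increasing as → ∀ x → θ as x ∉ as
θ-∉ (a ∷ as) inc x with x ℕₚ.<? a
... | yes x<a = below-∉ (x<a ∷ All.map (ℕₚ.<-trans x<a) (head<tail inc))
... | no x≮a  = λ where
  (here eq)  → ℕₚ.<-irrefl (sym eq) (ℕₚ.≤-<-trans (ℕₚ.≮⇒≥ x≮a) (x≤θ as (suc x)))
  (there ∈as) → θ-∉ as (tail-increasing inc) (suc x) ∈as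

θ-fixes : ∀ {n x} (as : Vec ℕ n) → All (x ℕ.<_) as → θ as x ≡ x
θ-fixes []       []        = refl
θ-fixes {x = x} (a ∷ as) (x<a ∷ _) with x ℕₚ.<? a
... | yes _  = refl
... | no x≮a = ⊥-elim (x≮a x<a)

θ-surjective : ∀ {n} (as : Vec ℕ n) → Increasing as →
               ∀ {y} → y ∉ as → ∃[ x ] θ as x ≡ y
θ-surjective []       inc {y} y∉ = y , refl
θ-surjective (a ∷ as) inc {y} y∉ with ℕₚ.<-cmp y a
... | tri≈ _ y≡a _ = ⊥-elim (y∉ (here y≡a))
... | tri< y<a _ _ = y , θ-fixes (a ∷ as) (y<a ∷ All.map (ℕₚ.<-trans y<a) (head<tail inc))
... | tri> _ _ a<y with θ-surjective as (tail-increasing inc) (y∉ ∘ there)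
...   | zero  , θ0≡y = ⊥-elim (ℕₚ.<-irrefl
          (trans (sym (θ-fixes as (All.map (ℕₚ.≤-<-trans z≤n) (head<tail inc)))) θ0≡y)
          (ℕₚ.≤-<-trans z≤n a<y))
...   | suc x , θx≡y = x , θ-above
  where
  θ-above : θ (a ∷ as) x ≡ y
  θ-above with x ℕₚ.<? a
  ... | no _    = θx≡y
  ... | yes x<a = ⊥-elim (ℕₚ.<⇒≱ a<y (subst (ℕ._≤ a)
    (trans (sym (θ-fixes as (All.map (ℕₚ.≤-<-trans x<a) (head<tail inc)))) θx≡y) x<a))

insert : ∀ {n} → ℕ → Vec ℕ n → Vec ℕ (suc n)
insert y []       = y ∷ []
insert y (x ∷ xs) with y ℕₚ.<? x
... | yes _ = y ∷ x ∷ xs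
... | no  _ = x ∷ insert y xs

insert-All : ∀ {n y} {P : ℕ → Set} {xs : Vec ℕ n} →
             P y → All P xs → All P (insert y xs)
insert-All py [] = py ∷ []
insert-All {y = y} py (_∷_ {x = x} px pxs) with y ℕₚ.<? x
... | yes _ = py ∷ px ∷ pxs
... | no  _ = px ∷ insert-All py pxs

insert-increasing : ∀ {n y} (xs : Vec ℕ n) → y ∉ xs →
                    Increasing xs → Increasing (insert y xs)
insert-increasing []       y∉ inc = [-]
insert-increasing {y = y} (x ∷ xs) y∉ inc with y ℕₚ.<? x
... | yes y<x = y<x ∷ inc
... | no  y≮x = ∷-increasing
  (insert-All (ℕₚ.≤∧≢⇒< (ℕₚ.≮⇒≥ y≮x) (λ x≡y → y∉ (here (sym x≡y)))) (head<tail inc))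
  (insert-increasing xs (y∉ ∘ there) (tail-increasing inc))

-- X_{t+1} as a function of X_t and ξ_t.  Since the elements are listed in
-- increasing order, 0 ∈ X_t if and only if 0 is the first of them.
next : ∀ {n} → ℕ⁽ n ⁾ → ℕ → ℕ⁽ n ⁾
next (mk []           inc) ξ = ∅
next (mk (suc x ∷ xs) inc) ξ = mk (Vec.map ℕ.pred (suc x ∷ xs))
  (map-pred-increasing (s≤s z≤n ∷ All.map (ℕₚ.≤-<-trans z≤n) (head<tail inc)) inc)
next (mk (zero ∷ xs)  inc) ξ = mk (insert (θ xs* ξ) xs*)
  (insert-increasing xs* (θ-∉ xs* (xs*-inc inc) ξ) (xs*-inc inc))
  where
  xs* = Vec.map ℕ.pred xs

  xs*-inc : Increasing (0 ∷ xs) → Increasing xs*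
  xs*-inc inc = map-pred-increasing (head<tail inc) (tail-increasing inc)

-- ℓ = m - n + 1
levels : ℕ → ℕ → ℕ
levels m n = suc (m ℕ.∸ n)

module _ (m n : ℕ) (q : OpenUnitInterval) where

  truncatedGeometric : ℕ → ℝ
  truncatedGeometric x =
    (1ℝ - value q) *
    inv (1ℝ - value q ^ levels m n) (0<y-x (x^[1+j]<1 (0< q) (<1 q) (m ℕ.∸ n))) *
    value q ^ x

  transition : ℕ⁽ n ⁾ → ℕ⁽ n ⁾ → ℝ
  transition A B = ∑ (upTo (levels m n)) λ x →
    if does (≡-dec ℕₚ._≟_ (elements (next A x)) (elements B))
    then truncatedGeometric x else 0ℝ

  record IsStationary (π : ℕ⁽ n ⁾ → ℝ) : Set where
    field
      nonnegative  : ∀ A → 0ℝ ≤ π A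
      concentrated : ∀ A → ¬ All (ℕ._< m) (elements A) → π A ≈ 0ℝ
      total        : ∑ (subsets n m) π ≈ 1ℝ
      balance      : ∀ B → All (ℕ._< m) (elements B) →
                     π B ≈ ∑ (subsets n m) λ A → π A * transition A B

-- The stationary distribution of the unbounded process, in which the ξ_t
-- have the full geometric distribution (1 - q) q^x.
π∞ : ∀ n → OpenUnitInterval → ℕ⁽ n ⁾ → ℝ
π∞ n q B = q-Pochhammer * inv (value q ^ (n C 2)) (0<x^j (0< q) (n C 2)) *
  ∏ (Vec.toList (elements B)) (λ x → value q ^ x)
  where
  q-Pochhammer : ℝ
  q-Pochhammer = ∏ (List.map suc (upTo n)) λ i → 1ℝ - value q ^ i

-- d = ½ Σ_{A} ∣ μ A - ν A ∣, the sum being over all n-element A ⊂ ℕ.  The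
-- terms are nonnegative, so the sum can be taken along the exhaustion by
-- the finite families of A ⊂ {0 , … , N - 1}.
IsTotalVariation : ∀ {n} → (μ ν : ℕ⁽ n ⁾ → ℝ) → ℝ → Set
IsTotalVariation {n} μ ν d =
  (λ N → fromℚ ½ * ∑ (subsets n N) λ A → ∣ μ A - ν A ∣) ⟶ d

-- Let x = q and ℓ = m - n + 1.  Up to normalisation, the stationary
-- distribution of the bounded process is π∞ B ∏_{b ∈ B} (1 - x^(1 + e b)) on
-- the n-element B ⊂ {0 , … , m - 1}, where e b is the number of elements of
-- {b + 1 , … , m - 1} ∖ B.  Summation against this weight ν ≤ π∞ obeys a
-- recursion on (n , m) that splits the sets according to whether they contain
-- 0, from which stationarity follows by induction; uniqueness is Doeblin's
-- argument, and gives Z π = ν, where Z is the total mass of ν.  Then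
-- ∣π - π∞∣ ≤ (1 - Z) π + (π∞ - ν) bounds the distance by 1 - Z, and the recursion
-- for Z yields 1 - Z ≤ x^ℓ ((1 - x^n) (m + 1) + (1 + x + … + x^(n-1))) ≤ 3 m x^ℓ.
-- Finally x^(-ℓ) / m = exp (ℓ log x⁻¹ - log m) tends to infinity.

module Submission where

open import Defs
open import Algebra.Bundles using (CommutativeRing)
import Algebra.Solver.Ring
open import Algebra.Solver.Ring.AlmostCommutativeRing
  using (fromCommutativeRing; _-Raw-AlmostCommutative⟶_; Induced-equivalence)
open import Algebra.Structures using (IsCommutativeRing)
open import Data.Bool.Base using (true; false; _∧_; if_then_else_)
open import Data.Empty using (⊥-elim)
import Data.Integer.Base as ℤ
import Data.Integer.Properties as ℤₚ
open import Data.List.Base as List using (List; []; _∷_; _++_; upTo)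
import Data.List.Properties as Listₚ
import Data.List.Relation.Unary.All as AllL
import Data.List.Relation.Unary.All.Properties as AllLₚ
open import Data.Maybe.Base using (just; nothing)
open import Data.Nat.Base as ℕ using (ℕ; zero; suc; _!; z≤n; s≤s)
import Data.Nat.Combinatorics as Comb
import Data.Nat.Properties as ℕₚ
open import Data.Product.Base using (_×_; _,_; ∃-syntax; proj₁; proj₂)
open import Data.Rational.Base as ℚ using (ℚ; 0ℚ; 1ℚ; ½)
import Data.Rational.Properties as ℚₚ
open import Data.Rational.Solver using (module +-*-Solver)
import Data.Rational.Unnormalised.Base as ℚᵘ
import Data.Rational.Unnormalised.Properties as ℚᵘₚ
open import Data.Sum.Base using (_⊎_; inj₁; inj₂)
open import Data.Vec.Base as Vec using (Vec; []; _∷_)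
open import Data.Vec.Properties as Vecₚ using (≡-dec)
open import Data.Vec.Relation.Unary.All as All using (All; []; _∷_)
import Data.Vec.Relation.Unary.All.Properties as Allₚ
open import Data.Vec.Relation.Unary.Linked using (linked?)
open import Function.Base using (_∘_)
open import Level using (0ℓ)
open import Relation.Binary.Bundles using (Poset)
open import Relation.Binary.Definitions using (WeaklyDecidable)
open import Relation.Binary.PropositionalEquality
  using (_≡_; refl; sym; trans; cong; cong₂; subst; subst₂)
import Relation.Binary.Reasoning.PartialOrder as PartialOrderReasoning
open import Relation.Nullary using (¬_; yes; no; does)
open import Relation.Nullary.Decidable using (recompute)

-- The ordered ring of real numbers

-- The product formula for the stationary weight is never written down. The recursion itself is
-- taken as the definition of a linear functional `stationarySum n m` of a test function, and the
-- weight of a set is the value at its indicator. In this dual form stationarity becomes one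
-- identity, `stationarySum-suc`, whose sides split the sets before and after a step according to
-- whether they contain 0. The extra factor `1 - x^ℓ` of a set containing 0 is there to cancel the
-- normalisation of the truncated geometric throw.
--
-- Logarithms enter only as numbers whose exponential partial sums have a given limit, and the
-- series at `z = ℓ log q⁻¹ - log m` comes with no limit at all. Hence the law exp (a + b) = exp a
-- exp b is proved for partial sums with an explicit remainder that tends to 0, and `z` enters only
-- through the lower bound `1 + z` for its partial sums.
--
-- The distance is an infinite sum whose convergence has to be shown. It is given by a finite
-- expression over the subsets of {0 , ... , m - 1}, and the convergence then follows from a tail
-- estimate for `π∞`.

eventually-≈ : ∀ {x y} → Eventually (λ n → seq x n ≡ seq y n) → x ≈ y
eventually-≈ {x} {y} h = mk≈ λ ε 0<ε → mapₑ (λ {n} eq →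
  subst (ℚ._< ε) (sym (trans (cong (λ a → ℚ.∣ a ℚ.- seq y n ∣) eq)
    (cong ℚ.∣_∣ (ℚₚ.+-inverseʳ (seq y n))))) 0<ε) h

pointwise-≈ : ∀ {x y} → (∀ n → seq x n ≡ seq y n) → x ≈ y
pointwise-≈ eq = eventually-≈ (0 , λ n _ → eq n)

pointwise-≤ : ∀ {x y} → Eventually (λ n → seq x n ℚ.≤ seq y n) → x ≤ y
pointwise-≤ {x} {y} h = mk≤ λ ε 0<ε → mapₑ (λ {n} le →
  ℚₚ.≤-trans le (≤+ (seq y n) ε (ℚₚ.<⇒≤ 0<ε))) h

≈-by : ∀ {x y} (B : ℚ) → 0ℚ ℚ.< B →
       (∀ δ → 0ℚ ℚ.< δ → Eventually λ n → ℚ.∣ seq x n ℚ.- seq y n ∣ ℚ.< B ℚ.* δ) → x ≈ y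
≈-by {x} {y} B 0<B h = mk≈ λ ε 0<ε → let δ , 0<δ , Bδ≡ε = split 0<B 0<ε in
  mapₑ (λ {n} → subst (ℚ.∣ seq x n ℚ.- seq y n ∣ ℚ.<_) Bδ≡ε) (h δ 0<δ)

∣sub∣-triangle : ∀ a b c → ℚ.∣ a ℚ.- c ∣ ℚ.≤ ℚ.∣ a ℚ.- b ∣ ℚ.+ ℚ.∣ b ℚ.- c ∣
∣sub∣-triangle a b c = subst (λ d → ℚ.∣ d ∣ ℚ.≤ ℚ.∣ a ℚ.- b ∣ ℚ.+ ℚ.∣ b ℚ.- c ∣) (telescope a b c)
  (ℚₚ.∣p+q∣≤∣p∣+∣q∣ (a ℚ.- b) (b ℚ.- c))
  where
  open +-*-Solver
  telescope : ∀ a b c → (a ℚ.- b) ℚ.+ (b ℚ.- c) ≡ a ℚ.- c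
  telescope = solve 3 (λ a b c → (a :- b) :+ (b :- c) := a :- c) refl

p≤∣p∣ : ∀ p → p ℚ.≤ ℚ.∣ p ∣
p≤∣p∣ p with ℚₚ.≤-total 0ℚ p
... | inj₁ 0≤p = ℚₚ.≤-reflexive (sym (ℚₚ.0≤p⇒∣p∣≡p 0≤p))
... | inj₂ p≤0 = ℚₚ.≤-trans p≤0 (ℚₚ.0≤∣p∣ p)

≈-refl : ∀ {x} → x ≈ x
≈-refl = pointwise-≈ λ _ → refl

≈-sym : ∀ {x y} → x ≈ y → y ≈ x
≈-sym {x} {y} (mk≈ h) = mk≈ λ ε 0<ε → mapₑ (λ {n} →
  subst (ℚ._< ε) (∣a-b∣≡∣b-a∣ (seq x n) (seq y n))) (h ε 0<ε)

≈-trans : ∀ {x y z} → x ≈ y → y ≈ z → x ≈ z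
≈-trans {x} {y} {z} (mk≈ h) (mk≈ k) = mk≈ λ ε 0<ε → mapₑ (λ { {n} (p , q) →
  ℚₚ.≤-<-trans (∣sub∣-triangle (seq x n) (seq y n) (seq z n))
    (subst (_ ℚ.<_) (halves ε) (ℚₚ.+-mono-< p q)) })
  (h (ε ℚ.* ½) (half-pos 0<ε) ∩ₑ k (ε ℚ.* ½) (half-pos 0<ε))

≈⇒≤ : ∀ {x y} → x ≈ y → x ≤ y
≈⇒≤ {x} {y} (mk≈ h) = mk≤ λ ε 0<ε → mapₑ (λ {n} lt →
  subst₂ ℚ._≤_ (-‿+-cancel (seq x n) (seq y n)) (ℚₚ.+-comm ε (seq y n))
    (ℚₚ.+-monoˡ-≤ (seq y n) (ℚₚ.≤-trans (p≤∣p∣ _) (ℚₚ.<⇒≤ lt))))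
  (h ε 0<ε)

≤-trans : ∀ {x y z} → x ≤ y → y ≤ z → x ≤ z
≤-trans {x} {y} {z} (mk≤ h) (mk≤ k) = mk≤ λ ε 0<ε → mapₑ (λ { {n} (p , q) →
  ℚₚ.≤-trans p (subst (seq y n ℚ.+ ε ℚ.* ½ ℚ.≤_)
    (trans (ℚₚ.+-assoc (seq z n) _ _) (cong (seq z n ℚ.+_) (halves ε)))
    (ℚₚ.+-monoˡ-≤ (ε ℚ.* ½) q)) })
  (h (ε ℚ.* ½) (half-pos 0<ε) ∩ₑ k (ε ℚ.* ½) (half-pos 0<ε))

sub-≤ : ∀ {p q r} → p ℚ.≤ q ℚ.+ r → p ℚ.- q ℚ.≤ r
sub-≤ {p} {q} {r} h = subst (p ℚ.- q ℚ.≤_) (cancel q r) (ℚₚ.+-monoˡ-≤ (ℚ.- q) h)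
  where
  open +-*-Solver
  cancel : ∀ q r → (q ℚ.+ r) ℚ.- q ≡ r
  cancel = solve 2 (λ q r → (q :+ r) :- q := r) refl

∣∣-≤ : ∀ {p r} → p ℚ.≤ r → ℚ.- p ℚ.≤ r → ℚ.∣ p ∣ ℚ.≤ r
∣∣-≤ {p} {r} h k with ℚₚ.∣p∣≡p∨∣p∣≡-p p
... | inj₁ eq = subst (ℚ._≤ r) (sym eq) h
... | inj₂ eq = subst (ℚ._≤ r) (sym eq) k

half-< : ∀ {ε} → 0ℚ ℚ.< ε → ε ℚ.* ½ ℚ.< ε
half-< {ε} 0<ε = subst₂ ℚ._<_ (ℚₚ.+-identityʳ (ε ℚ.* ½)) (halves ε)
  (ℚₚ.+-monoʳ-< (ε ℚ.* ½) (half-pos 0<ε))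

≤-antisym : ∀ {x y} → x ≤ y → y ≤ x → x ≈ y
≤-antisym {x} {y} (mk≤ h) (mk≤ k) = mk≈ λ ε 0<ε → mapₑ (λ { {n} (p , q) →
  ℚₚ.≤-<-trans (∣∣-≤ (sub-≤ {seq x n} p)
    (subst (ℚ._≤ ε ℚ.* ½) (sym (neg-sub (seq x n) (seq y n))) (sub-≤ {seq y n} q)))
    (half-< 0<ε) })
  (h (ε ℚ.* ½) (half-pos 0<ε) ∩ₑ k (ε ℚ.* ½) (half-pos 0<ε))

poset : Poset 0ℓ 0ℓ 0ℓ
poset = record
  { Carrier = ℝ ; _≈_ = _≈_ ; _≤_ = _≤_
  ; isPartialOrder = record
    { isPreorder = record
      { isEquivalence = record { refl = ≈-refl ; sym = ≈-sym ; trans = ≈-trans }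
      ; reflexive = ≈⇒≤
      ; trans = ≤-trans }
    ; antisym = ≤-antisym } }

module ≤-Reasoning = PartialOrderReasoning poset

<⇒≤ : ∀ {x y} → x < y → x ≤ y
<⇒≤ {x} {y} (mk< δ 0<δ h) = pointwise-≤
  (mapₑ (λ {n} → ℚₚ.≤-trans (≤+ (seq x n) δ (ℚₚ.<⇒≤ 0<δ))) h)

≤-<-trans : ∀ {x y z} → x ≤ y → y < z → x < z
≤-<-trans {x} {y} {z} (mk≤ h) (mk< δ 0<δ k) = mk< (δ ℚ.* ½) (half-pos 0<δ)
  (mapₑ (λ { {n} (p , q) → ℚₚ.≤-trans (ℚₚ.+-monoˡ-≤ (δ ℚ.* ½) p)
      (subst (ℚ._≤ seq z n) (sym (trans (ℚₚ.+-assoc (seq y n) _ _)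
        (cong (seq y n ℚ.+_) (halves δ)))) q) })
    (h (δ ℚ.* ½) (half-pos 0<δ) ∩ₑ k))

<-≤-trans : ∀ {x y z} → x < y → y ≤ z → x < z
<-≤-trans {x} {y} {z} (mk< δ 0<δ h) (mk≤ k) = mk< (δ ℚ.* ½) (half-pos 0<δ)
  (mapₑ (λ { {n} (p , q) → ℚₚ.≤-trans
      (subst₂ ℚ._≤_ (regroup (seq x n) δ) refl
        (ℚₚ.+-monoˡ-≤ (ℚ.- (δ ℚ.* ½)) (ℚₚ.≤-trans p q)))
      (ℚₚ.≤-reflexive (cancel (seq z n) (δ ℚ.* ½))) })
    (h ∩ₑ k (δ ℚ.* ½) (half-pos 0<δ)))
  where
  open +-*-Solver
  regroup : ∀ a δ → (a ℚ.+ δ) ℚ.- δ ℚ.* ½ ≡ a ℚ.+ δ ℚ.* ½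
  regroup = solve 2 (λ a δ → (a :+ δ) :- δ :* con ½ := a :+ δ :* con ½) refl

  cancel : ∀ a d → (a ℚ.+ d) ℚ.- d ≡ a
  cancel = solve 2 (λ a d → (a :+ d) :- d := a) refl

opaque
  unfolding fromℚ

  +-cong : ∀ {x x′ y y′} → x ≈ x′ → y ≈ y′ → x + y ≈ x′ + y′
  +-cong {x} {x′} {y} {y′} (mk≈ h) (mk≈ k) = mk≈ λ ε 0<ε → mapₑ (λ { {n} (p , q) →
    ℚₚ.≤-<-trans (∣sum-diff∣≤ (seq x n) (seq y n) (seq x′ n) (seq y′ n))
      (subst₂ ℚ._<_ (sym (ℚₚ.*-identityˡ _)) (halves ε) (ℚₚ.+-mono-< p q)) })
    (h (ε ℚ.* ½) (half-pos 0<ε) ∩ₑ k (ε ℚ.* ½) (half-pos 0<ε))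

  -‿cong : ∀ {x y} → x ≈ y → - x ≈ - y
  -‿cong {x} {y} (mk≈ h) = mk≈ λ ε 0<ε → mapₑ (λ {n} →
    subst (ℚ._< ε) (trans (sym (ℚₚ.∣-p∣≡∣p∣ (seq x n ℚ.- seq y n)))
      (cong ℚ.∣_∣ (ℚₚ.neg-distrib-+ (seq x n) (ℚ.- seq y n))))) (h ε 0<ε)

  *-cong : ∀ {x x′ y y′} → x ≈ x′ → y ≈ y′ → x * y ≈ x′ * y′
  *-cong {x} {x′} {y} {y′} (mk≈ h) (mk≈ k) = let
      A , 0<A , a = bounded x
      B , 0<B , b = bounded y′
      0<A+B = ℚₚ.+-mono-< 0<A 0<B
    in ≈-by (A ℚ.+ B) 0<A+B λ δ 0<δ → mapₑ (λ { {n} (((p , q) , r) , s) →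
      ℚₚ.≤-<-trans
        (∣product-diff∣≤ A B (seq x n) (seq y n) (seq x′ n) (seq y′ n) 0<A 0<B r s)
        (ℚₚ.*-monoʳ-<-pos (A ℚ.+ B) {{ℚ.positive 0<A+B}}
          (subst (_ ℚ.<_) (halves δ) (ℚₚ.+-mono-< p q))) })
      (h (δ ℚ.* ½) (half-pos 0<δ) ∩ₑ k (δ ℚ.* ½) (half-pos 0<δ) ∩ₑ a ∩ₑ b)

  ∣∣-cong : ∀ {x y} → x ≈ y → ∣ x ∣ ≈ ∣ y ∣
  ∣∣-cong {x} {y} (mk≈ h) = mk≈ λ ε 0<ε → mapₑ (λ {n} →
    ℚₚ.≤-<-trans (reverse-triangle (seq x n) (seq y n))) (h ε 0<ε)

  isCommutativeRing : IsCommutativeRing _≈_ _+_ _*_ -_ 0ℝ 1ℝ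
  isCommutativeRing = record
      { isRing = record
        { +-isAbelianGroup = record
          { isGroup = record
            { isMonoid = record
              { isSemigroup = record
                { isMagma = record
                  { isEquivalence = record { refl = ≈-refl ; sym = ≈-sym ; trans = ≈-trans }
                  ; ∙-cong = +-cong }
                ; assoc = λ x y z → pointwise-≈ λ n → ℚₚ.+-assoc (seq x n) (seq y n) (seq z n) }
              ; identity = (λ x → pointwise-≈ λ n → ℚₚ.+-identityˡ (seq x n)) ,
                           (λ x → pointwise-≈ λ n → ℚₚ.+-identityʳ (seq x n)) }
            ; inverse = (λ x → pointwise-≈ λ n → ℚₚ.+-inverseˡ (seq x n)) ,
                        (λ x → pointwise-≈ λ n → ℚₚ.+-inverseʳ (seq x n))
            ; ⁻¹-cong = -‿cong }
          ; comm = λ x y → pointwise-≈ λ n → ℚₚ.+-comm (seq x n) (seq y n) }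
        ; *-cong = *-cong
        ; *-assoc = λ x y z → pointwise-≈ λ n → ℚₚ.*-assoc (seq x n) (seq y n) (seq z n)
        ; *-identity = (λ x → pointwise-≈ λ n → ℚₚ.*-identityˡ (seq x n)) ,
                       (λ x → pointwise-≈ λ n → ℚₚ.*-identityʳ (seq x n))
        ; distrib = (λ x y z → pointwise-≈ λ n → ℚₚ.*-distribˡ-+ (seq x n) (seq y n) (seq z n)) ,
                    (λ x y z → pointwise-≈ λ n → ℚₚ.*-distribʳ-+ (seq x n) (seq y n) (seq z n)) }
      ; *-comm = λ x y → pointwise-≈ λ n → ℚₚ.*-comm (seq x n) (seq y n) }

  fromℚ-+ : ∀ p q → fromℚ (p ℚ.+ q) ≈ fromℚ p + fromℚ q
  fromℚ-+ p q = pointwise-≈ λ _ → refl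

  fromℚ-* : ∀ p q → fromℚ (p ℚ.* q) ≈ fromℚ p * fromℚ q
  fromℚ-* p q = pointwise-≈ λ _ → refl

  fromℚ-neg : ∀ p → fromℚ (ℚ.- p) ≈ - fromℚ p
  fromℚ-neg p = pointwise-≈ λ _ → refl

  fromℚ-mono-≤ : ∀ {p q} → p ℚ.≤ q → fromℚ p ≤ fromℚ q
  fromℚ-mono-≤ p≤q = pointwise-≤ (0 , λ _ _ → p≤q)

  fromℚ-pos : ∀ {p} → 0ℚ ℚ.< p → 0ℝ < fromℚ p
  fromℚ-pos {p} 0<p = 0<-intro 0<p (0 , λ _ _ → ℚₚ.≤-refl)

  +-mono-≤ : ∀ {x x′ y y′} → x ≤ x′ → y ≤ y′ → x + y ≤ x′ + y′
  +-mono-≤ {x} {x′} {y} {y′} (mk≤ h) (mk≤ k) = mk≤ λ ε 0<ε → mapₑ (λ { {n} (p , q) →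
    subst (seq x n ℚ.+ seq y n ℚ.≤_)
      (trans (regroup (seq x′ n) (seq y′ n) (ε ℚ.* ½))
          (cong (seq x′ n ℚ.+ seq y′ n ℚ.+_) (halves ε)))
      (ℚₚ.+-mono-≤ p q) })
    (h (ε ℚ.* ½) (half-pos 0<ε) ∩ₑ k (ε ℚ.* ½) (half-pos 0<ε))
    where
    open +-*-Solver
    regroup : ∀ a b d → (a ℚ.+ d) ℚ.+ (b ℚ.+ d) ≡ (a ℚ.+ b) ℚ.+ (d ℚ.+ d)
    regroup = solve 3 (λ a b d → (a :+ d) :+ (b :+ d) := (a :+ b) :+ (d :+ d)) refl

  -- If - δ ≤ a, - δ ≤ b, a ≤ A and b ≤ B, then
  -- a b = (a + δ)(b + δ) - δ (a + b + δ) ≥ - δ (A + B + δ).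
  0≤x*y : ∀ {x y} → 0ℝ ≤ x → 0ℝ ≤ y → 0ℝ ≤ x * y
  0≤x*y {x} {y} (mk≤ h) (mk≤ k) = mk≤ λ ε 0<ε → let
      A , 0<A , a = bounded x
      B , 0<B , b = bounded y
      C = A ℚ.+ B ℚ.+ 1ℚ
      0<C = ℚₚ.+-mono-< (ℚₚ.+-mono-< 0<A 0<B) (ℚₚ.positive⁻¹ 1ℚ)
      δ₀ , 0<δ₀ , Cδ₀≡ε = split 0<C 0<ε
      δ = δ₀ ℚ.⊓ 1ℚ
      0<δ = ⊓-pos 0<δ₀ (ℚₚ.positive⁻¹ 1ℚ)
    in mapₑ (λ { {n} (((p , q) , r) , s) → begin
      0ℚ ≤⟨ *-nonneg p q ⟩
      (seq x n ℚ.+ δ) ℚ.* (seq y n ℚ.+ δ) ≡⟨ expand (seq x n) (seq y n) δ ⟩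
      seq x n ℚ.* seq y n ℚ.+ (seq x n ℚ.+ seq y n ℚ.+ δ) ℚ.* δ ≤⟨ ℚₚ.+-monoʳ-≤
          (seq x n ℚ.* seq y n)
        (*-mono-≤ (ℚₚ.<⇒≤ 0<C) (ℚₚ.<⇒≤ 0<δ)
          (ℚₚ.+-mono-≤ (ℚₚ.+-mono-≤ (ℚₚ.≤-trans (p≤∣p∣ _) r) (ℚₚ.≤-trans (p≤∣p∣ _) s))
              (ℚₚ.p⊓q≤q δ₀ 1ℚ))
          (ℚₚ.p⊓q≤p δ₀ 1ℚ)) ⟩
      seq x n ℚ.* seq y n ℚ.+ C ℚ.* δ₀ ≡⟨ cong (seq x n ℚ.* seq y n ℚ.+_) Cδ₀≡ε ⟩
      seq x n ℚ.* seq y n ℚ.+ ε ∎ })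
      (h δ 0<δ ∩ₑ k δ 0<δ ∩ₑ a ∩ₑ b)
    where
    open ℚₚ.≤-Reasoning
    open +-*-Solver
    expand : ∀ a b d → (a ℚ.+ d) ℚ.* (b ℚ.+ d) ≡ a ℚ.* b ℚ.+ (a ℚ.+ b ℚ.+ d) ℚ.* d
    expand = solve 3 (λ a b d → (a :+ d) :* (b :+ d) := a :* b :+ (a :+ b :+ d) :* d) refl

    ⊓-pos : ∀ {p q} → 0ℚ ℚ.< p → 0ℚ ℚ.< q → 0ℚ ℚ.< p ℚ.⊓ q
    ⊓-pos {p} {q} 0<p 0<q with ℚₚ.⊓-sel p q
    ... | inj₁ eq = subst (0ℚ ℚ.<_) (sym eq) 0<p
    ... | inj₂ eq = subst (0ℚ ℚ.<_) (sym eq) 0<q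

  x≤∣x∣ : ∀ x → x ≤ ∣ x ∣
  x≤∣x∣ x = pointwise-≤ (0 , λ n _ → p≤∣p∣ (seq x n))

  0≤∣x∣ : ∀ x → 0ℝ ≤ ∣ x ∣
  0≤∣x∣ x = pointwise-≤ (0 , λ n _ → ℚₚ.0≤∣p∣ (seq x n))

  ∣-x∣≈∣x∣ : ∀ x → ∣ - x ∣ ≈ ∣ x ∣
  ∣-x∣≈∣x∣ x = pointwise-≈ λ n → ℚₚ.∣-p∣≡∣p∣ (seq x n)

  ∣x+y∣≤∣x∣+∣y∣ : ∀ x y → ∣ x + y ∣ ≤ ∣ x ∣ + ∣ y ∣
  ∣x+y∣≤∣x∣+∣y∣ x y = pointwise-≤ (0 , λ n _ → ℚₚ.∣p+q∣≤∣p∣+∣q∣ (seq x n) (seq y n))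

  ∣x*y∣≈∣x∣*∣y∣ : ∀ x y → ∣ x * y ∣ ≈ ∣ x ∣ * ∣ y ∣
  ∣x*y∣≈∣x∣*∣y∣ x y = pointwise-≈ λ n → ℚₚ.∣p*q∣≡∣p∣*∣q∣ (seq x n) (seq y n)

  ∣x∣≤y : ∀ {x y} → x ≤ y → - x ≤ y → ∣ x ∣ ≤ y
  ∣x∣≤y (mk≤ h) (mk≤ k) = mk≤ λ ε 0<ε → mapₑ (λ { (p , q) → ∣∣-≤ p q }) (h ε 0<ε ∩ₑ k ε 0<ε)

opaque
  unfolding fromℚ inv

  inv-inverse : ∀ x (0<x : 0ℝ < x) → x * inv x 0<x ≈ 1ℝ
  inv-inverse x 0<x = eventually-≈ (mapₑ
    (λ {n} δ≤x → recip-inverse (ℚₚ.<-≤-trans (_<_.gap-pos 0<x) δ≤x)) (pos-below 0<x))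

  0≤inv : ∀ x (0<x : 0ℝ < x) → 0ℝ ≤ inv x 0<x
  0≤inv x 0<x = pointwise-≤ (mapₑ
    (λ {n} δ≤x → ℚₚ.<⇒≤ (recip-pos (ℚₚ.<-≤-trans (_<_.gap-pos 0<x) δ≤x))) (pos-below 0<x))

commutativeRing : CommutativeRing 0ℓ 0ℓ
commutativeRing = record { isCommutativeRing = isCommutativeRing }

-- Equality of reals cannot be decided, so the ring solver takes its coefficients in ℚ, where
-- constants such as ½ can be compared.
fromℚ-homomorphism : CommutativeRing.rawRing ℚₚ.+-*-commutativeRing
  -Raw-AlmostCommutative⟶ fromCommutativeRing commutativeRing
fromℚ-homomorphism = record
  { ⟦_⟧    = fromℚ
  ; +-homo = fromℚ-+
  ; *-homo = fromℚ-*
  ; -‿homo = fromℚ-neg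
  ; 0-homo = ≈-refl
  ; 1-homo = ≈-refl }

fromℚ-≟ : WeaklyDecidable (Induced-equivalence fromℚ-homomorphism)
fromℚ-≟ p q with p ℚₚ.≟ q
... | yes refl = just ≈-refl
... | no _     = nothing

module RingSolver = Algebra.Solver.Ring _ _ fromℚ-homomorphism fromℚ-≟
open RingSolver using (solve; _:=_; _:+_; _:*_; _:-_; :-_; con)


open CommutativeRing commutativeRing using
  ( +-assoc; +-comm; +-identityˡ; +-identityʳ; -‿inverseʳ
  ; *-assoc; *-comm; *-identityˡ; *-identityʳ; distribˡ; distribʳ; zeroˡ; zeroʳ )

≤-refl : ∀ {x} → x ≤ x
≤-refl = ≈⇒≤ ≈-refl

≈-reflexive : ∀ {x y} → x ≡ y → x ≈ y
≈-reflexive refl = ≈-refl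

+-congˡ : ∀ {x y z} → y ≈ z → x + y ≈ x + z
+-congˡ = +-cong ≈-refl

+-congʳ : ∀ {x y z} → y ≈ z → y + x ≈ z + x
+-congʳ h = +-cong h ≈-refl

*-congˡ : ∀ {x y z} → y ≈ z → x * y ≈ x * z
*-congˡ = *-cong ≈-refl

*-congʳ : ∀ {x y z} → y ≈ z → y * x ≈ z * x
*-congʳ h = *-cong h ≈-refl

+-monoˡ-≤ : ∀ {x y} z → x ≤ y → x + z ≤ y + z
+-monoˡ-≤ z h = +-mono-≤ h ≤-refl

+-monoʳ-≤ : ∀ {x y} z → x ≤ y → z + x ≤ z + y
+-monoʳ-≤ z h = +-mono-≤ ≤-refl h

0≤y-x : ∀ {x y} → x ≤ y → 0ℝ ≤ y - x
0≤y-x {x} {y} h = ≤-trans (≈⇒≤ (≈-sym (-‿inverseʳ x))) (+-monoˡ-≤ (- x) h)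

x≤y : ∀ {x y} → 0ℝ ≤ y - x → x ≤ y
x≤y {x} {y} h = begin
  x            ≈⟨ +-identityˡ x ⟨
  0ℝ + x       ≤⟨ +-monoˡ-≤ x h ⟩
  (y - x) + x  ≈⟨ solve 2 (λ x y → y :- x :+ x := y) ≈-refl x y ⟩
  y            ∎
  where open ≤-Reasoning

neg-mono-≤ : ∀ {x y} → x ≤ y → - y ≤ - x
neg-mono-≤ {x} {y} h = x≤y (≤-trans (0≤y-x h)
  (≈⇒≤ (solve 2 (λ x y → y :- x := :- x :- :- y) ≈-refl x y)))

sub-monoʳ-≤ : ∀ {x y} z → x ≤ y → z - y ≤ z - x
sub-monoʳ-≤ z h = +-monoʳ-≤ z (neg-mono-≤ h)

x-y≤x : ∀ {x y} → 0ℝ ≤ y → x - y ≤ x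
x-y≤x {x} {y} h = ≤-trans (sub-monoʳ-≤ x h)
  (≈⇒≤ (solve 1 (λ x → x :- con 0ℚ := x) ≈-refl x))

*-monoʳ-≤ : ∀ {x y z} → 0ℝ ≤ z → x ≤ y → z * x ≤ z * y
*-monoʳ-≤ {x} {y} {z} 0≤z h = x≤y (≤-trans (0≤x*y 0≤z (0≤y-x h))
  (≈⇒≤ (solve 3 (λ x y z → z :* (y :- x) := z :* y :- z :* x) ≈-refl x y z)))

*-monoˡ-≤ : ∀ {x y z} → 0ℝ ≤ z → x ≤ y → x * z ≤ y * z
*-monoˡ-≤ {x} {y} {z} 0≤z h = begin
  x * z  ≈⟨ *-comm x z ⟩
  z * x  ≤⟨ *-monoʳ-≤ 0≤z h ⟩
  z * y  ≈⟨ *-comm z y ⟩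
  y * z  ∎
  where open ≤-Reasoning

0≤1 : 0ℝ ≤ 1ℝ
0≤1 = fromℚ-mono-≤ (ℚₚ.<⇒≤ (ℚₚ.positive⁻¹ 1ℚ))

0≤x+y : ∀ {x y} → 0ℝ ≤ x → 0ℝ ≤ y → 0ℝ ≤ x + y
0≤x+y h k = ≤-trans (≈⇒≤ (≈-sym (+-identityˡ 0ℝ))) (+-mono-≤ h k)

x≤x+y : ∀ {x y} → 0ℝ ≤ y → x ≤ x + y
x≤x+y {x} h = ≤-trans (≈⇒≤ (≈-sym (+-identityʳ x))) (+-monoʳ-≤ x h)

y≤x+y : ∀ {x y} → 0ℝ ≤ x → y ≤ x + y
y≤x+y {x} {y} h = ≤-trans (x≤x+y h) (≈⇒≤ (+-comm y x))

x*y≤x : ∀ {x y} → 0ℝ ≤ x → y ≤ 1ℝ → x * y ≤ x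
x*y≤x {x} h k = ≤-trans (*-monoʳ-≤ h k) (≈⇒≤ (*-identityʳ x))

0≤x⇒∣x∣≈x : ∀ {x} → 0ℝ ≤ x → ∣ x ∣ ≈ x
0≤x⇒∣x∣≈x {x} h = ≤-antisym (∣x∣≤y ≤-refl
  (≤-trans (neg-mono-≤ h) (≤-trans (≈⇒≤ (solve 0 (:- con 0ℚ := con 0ℚ) ≈-refl)) h))) (x≤∣x∣ x)

∣x-y∣≈∣y-x∣ : ∀ x y → ∣ x - y ∣ ≈ ∣ y - x ∣
∣x-y∣≈∣y-x∣ x y = ≈-trans (≈-sym (∣-x∣≈∣x∣ (x - y)))
  (∣∣-cong (solve 2 (λ x y → :- (x :- y) := y :- x) ≈-refl x y))

∣x∣≤0⇒x≈0 : ∀ {x} → ∣ x ∣ ≤ 0ℝ → x ≈ 0ℝ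
∣x∣≤0⇒x≈0 {x} h = ≤-antisym (≤-trans (x≤∣x∣ x) h) (begin
  0ℝ        ≈⟨ solve 0 (con 0ℚ := :- con 0ℚ) ≈-refl ⟩
  - 0ℝ      ≤⟨ neg-mono-≤ (≤-trans (≤-trans (x≤∣x∣ (- x)) (≈⇒≤ (∣-x∣≈∣x∣ x))) h) ⟩
  - (- x)   ≈⟨ solve 1 (λ x → :- :- x := x) ≈-refl x ⟩
  x         ∎)
  where open ≤-Reasoning

x*z≈y*z⇒x≈y : ∀ {x y z} → 0ℝ < z → x * z ≈ y * z → x ≈ y
x*z≈y*z⇒x≈y {x} {y} {z} 0<z h = ≈-trans (≈-sym (undo x)) (≈-trans (*-congʳ h) (undo y))
  where
  undo : ∀ x → x * z * inv z 0<z ≈ x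
  undo x = ≈-trans (*-assoc x z _) (≈-trans (*-congˡ (inv-inverse z 0<z)) (*-identityʳ x))

x*z≤y*z⇒x≤y : ∀ {x y z} → 0ℝ < z → x * z ≤ y * z → x ≤ y
x*z≤y*z⇒x≤y {x} {y} {z} 0<z h = ≤-trans (≈⇒≤ (≈-sym (undo x)))
  (≤-trans (*-monoˡ-≤ (0≤inv z 0<z) h) (≈⇒≤ (undo y)))
  where
  undo : ∀ x → x * z * inv z 0<z ≈ x
  undo x = ≈-trans (*-assoc x z _) (≈-trans (*-congˡ (inv-inverse z 0<z)) (*-identityʳ x))

-- Finite sums and powers.

module _ {A : Set} where

  ∑-cong-All : ∀ {xs : List A} {f g} → AllL.All (λ a → f a ≈ g a) xs → ∑ xs f ≈ ∑ xs g
  ∑-cong-All AllL.[]       = ≈-refl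
  ∑-cong-All (h AllL.∷ hs) = +-cong h (∑-cong-All hs)

  ∑-cong : ∀ (xs : List A) {f g} → (∀ a → f a ≈ g a) → ∑ xs f ≈ ∑ xs g
  ∑-cong xs h = ∑-cong-All (AllL.universal h xs)

  ∑-mono-≤-All : ∀ {xs : List A} {f g} → AllL.All (λ a → f a ≤ g a) xs → ∑ xs f ≤ ∑ xs g
  ∑-mono-≤-All AllL.[]       = ≤-refl
  ∑-mono-≤-All (h AllL.∷ hs) = +-mono-≤ h (∑-mono-≤-All hs)

  ∑-mono-≤ : ∀ (xs : List A) {f g} → (∀ a → f a ≤ g a) → ∑ xs f ≤ ∑ xs g
  ∑-mono-≤ xs h = ∑-mono-≤-All (AllL.universal h xs)

  ∑-zero : ∀ (xs : List A) → ∑ xs (λ _ → 0ℝ) ≈ 0ℝ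
  ∑-zero []       = ≈-refl
  ∑-zero (x ∷ xs) = ≈-trans (+-identityˡ _) (∑-zero xs)

  ∑-nonneg : ∀ (xs : List A) {f} → (∀ a → 0ℝ ≤ f a) → 0ℝ ≤ ∑ xs f
  ∑-nonneg xs h = ≤-trans (≈⇒≤ (≈-sym (∑-zero xs))) (∑-mono-≤ xs h)

  ∑-+ : ∀ (xs : List A) f g → ∑ xs (λ a → f a + g a) ≈ ∑ xs f + ∑ xs g
  ∑-+ []       f g = ≈-sym (+-identityˡ 0ℝ)
  ∑-+ (x ∷ xs) f g = ≈-trans (+-congˡ (∑-+ xs f g))
    (solve 4 (λ a b s t → (a :+ b) :+ (s :+ t) := (a :+ s) :+ (b :+ t))
        ≈-refl (f x) (g x) (∑ xs f) (∑ xs g))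

  ∑-*ˡ : ∀ (xs : List A) c f → ∑ xs (λ a → c * f a) ≈ c * ∑ xs f
  ∑-*ˡ []       c f = ≈-sym (zeroʳ c)
  ∑-*ˡ (x ∷ xs) c f = ≈-trans (+-congˡ (∑-*ˡ xs c f)) (≈-sym (distribˡ c (f x) (∑ xs f)))

  ∑-*ʳ : ∀ (xs : List A) c f → ∑ xs (λ a → f a * c) ≈ ∑ xs f * c
  ∑-*ʳ xs c f = ≈-trans (∑-cong xs λ a → *-comm (f a) c) (≈-trans (∑-*ˡ xs c f) (*-comm c (∑ xs f)))

  ∑-sub : ∀ (xs : List A) f g → ∑ xs (λ a → f a - g a) ≈ ∑ xs f - ∑ xs g
  ∑-sub []       f g = ≈-sym (-‿inverseʳ 0ℝ)
  ∑-sub (x ∷ xs) f g = ≈-trans (+-congˡ (∑-sub xs f g))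
    (solve 4 (λ a b s t → (a :- b) :+ (s :- t) := (a :+ s) :- (b :+ t))
        ≈-refl (f x) (g x) (∑ xs f) (∑ xs g))

  ∑-++ : ∀ (xs ys : List A) f → ∑ (xs ++ ys) f ≈ ∑ xs f + ∑ ys f
  ∑-++ []       ys f = ≈-sym (+-identityˡ _)
  ∑-++ (x ∷ xs) ys f = ≈-trans (+-congˡ (∑-++ xs ys f)) (≈-sym (+-assoc (f x) (∑ xs f) (∑ ys f)))

  ∑-map : ∀ {B : Set} (h : B → A) (xs : List B) f → ∑ (List.map h xs) f ≡ ∑ xs (f ∘ h)
  ∑-map h []       f = refl
  ∑-map h (x ∷ xs) f = cong (f (h x) +_) (∑-map h xs f)

  ∣∑∣≤∑∣∣ : ∀ (xs : List A) f → ∣ ∑ xs f ∣ ≤ ∑ xs (λ a → ∣ f a ∣)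
  ∣∑∣≤∑∣∣ []       f = ≈⇒≤ (0≤x⇒∣x∣≈x ≤-refl)
  ∣∑∣≤∑∣∣ (x ∷ xs) f = ≤-trans (∣x+y∣≤∣x∣+∣y∣ (f x) (∑ xs f)) (+-monoʳ-≤ ∣ f x ∣ (∣∑∣≤∑∣∣ xs f))

∑-swap : ∀ {A B : Set} (xs : List A) (ys : List B) (f : A → B → ℝ) →
         ∑ xs (λ a → ∑ ys (f a)) ≈ ∑ ys (λ b → ∑ xs (λ a → f a b))
∑-swap []       ys f = ≈-sym (∑-zero ys)
∑-swap (x ∷ xs) ys f = ≈-trans (+-congˡ (∑-swap xs ys f))
  (≈-sym (∑-+ ys (f x) (λ b → ∑ xs (λ a → f a b))))

∑-upTo-suc : ∀ n f → ∑ (upTo (suc n)) f ≡ f 0 + ∑ (upTo n) (f ∘ suc)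
∑-upTo-suc n f = cong (f 0 +_)
  (trans (cong (λ xs → ∑ xs f) (sym (Listₚ.map-upTo suc n))) (∑-map suc (upTo n) f))

∑-upTo-last : ∀ n f → ∑ (upTo (suc n)) f ≈ ∑ (upTo n) f + f n
∑-upTo-last zero    f = +-comm (f 0) 0ℝ
∑-upTo-last (suc n) f = begin-equality
  ∑ (upTo (suc (suc n))) f               ≡⟨ ∑-upTo-suc (suc n) f ⟩
  f 0 + ∑ (upTo (suc n)) (f ∘ suc)       ≈⟨ +-congˡ (∑-upTo-last n (f ∘ suc)) ⟩
  f 0 + (∑ (upTo n) (f ∘ suc) + f (suc n)) ≈⟨ +-assoc _ _ _ ⟨
  f 0 + ∑ (upTo n) (f ∘ suc) + f (suc n) ≡⟨ cong (_+ f (suc n)) (∑-upTo-suc n f) ⟨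
  ∑ (upTo (suc n)) f + f (suc n)         ∎
  where open ≤-Reasoning

^-nonneg : ∀ {x} → 0ℝ ≤ x → ∀ n → 0ℝ ≤ x ^ n
^-nonneg h zero    = 0≤1
^-nonneg h (suc n) = 0≤x*y h (^-nonneg h n)

^-≤1 : ∀ {x} → 0ℝ ≤ x → x ≤ 1ℝ → ∀ n → x ^ n ≤ 1ℝ
^-≤1 h k zero    = ≤-refl
^-≤1 h k (suc n) = ≤-trans (x*y≤x h (^-≤1 h k n)) k

^-+ : ∀ x m n → x ^ (m ℕ.+ n) ≈ x ^ m * x ^ n
^-+ x zero    n = ≈-sym (*-identityˡ (x ^ n))
^-+ x (suc m) n = ≈-trans (*-congˡ (^-+ x m n)) (≈-sym (*-assoc x (x ^ m) (x ^ n)))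

^-*-distrib : ∀ x y n → (x * y) ^ n ≈ x ^ n * y ^ n
^-*-distrib x y zero    = ≈-sym (*-identityˡ 1ℝ)
^-*-distrib x y (suc n) = ≈-trans (*-congˡ (^-*-distrib x y n))
  (solve 4 (λ x y a b → x :* y :* (a :* b) := x :* a :* (y :* b)) ≈-refl x y (x ^ n) (y ^ n))

1^n≈1 : ∀ n → 1ℝ ^ n ≈ 1ℝ
1^n≈1 zero    = ≈-refl
1^n≈1 (suc n) = ≈-trans (*-identityˡ _) (1^n≈1 n)

^-cong : ∀ {x y} n → x ≈ y → x ^ n ≈ y ^ n
^-cong zero    h = ≈-refl
^-cong (suc n) h = *-cong h (^-cong n h)

-- Natural numbers and inverse factorials as reals, and the Archimedean property.

/-as-fromℚᵘ : ∀ i n → ℚ.toℚᵘ (i ℚ./ suc n) ℚᵘ.≃ ℚᵘ.mkℚᵘ i n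
/-as-fromℚᵘ i n = ℚₚ.toℚᵘ-fromℚᵘ (ℚᵘ.mkℚᵘ i n)

-- `ℚ._/_` divides by a gcd and does not compute on an open numerator; such identities are therefore
-- checked by cross-multiplication in the unnormalised rationals.
[1+n]/1 : ∀ n → ℤ.+ suc n ℚ./ 1 ≡ 1ℚ ℚ.+ ℤ.+ n ℚ./ 1
[1+n]/1 n = ℚₚ.toℚᵘ-injective (begin
  ℚ.toℚᵘ (ℤ.+ suc n ℚ./ 1)                ≈⟨ /-as-fromℚᵘ (ℤ.+ suc n) 0 ⟩
  ℚᵘ.mkℚᵘ (ℤ.+ suc n) 0                   ≈⟨ ℚᵘ.*≡*
      (cong (ℤ._* ℤ.+ 1) (sym (cong (λ i → ℤ.1ℤ ℤ.+ i) (ℤₚ.*-identityʳ (ℤ.+ n))))) ⟩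
  ℚᵘ.1ℚᵘ ℚᵘ.+ ℚᵘ.mkℚᵘ (ℤ.+ n) 0           ≈⟨ ℚᵘₚ.+-congʳ ℚᵘ.1ℚᵘ (/-as-fromℚᵘ (ℤ.+ n) 0) ⟨
  ℚᵘ.1ℚᵘ ℚᵘ.+ ℚ.toℚᵘ (ℤ.+ n ℚ./ 1)        ≈⟨ ℚₚ.toℚᵘ-homo-+ 1ℚ (ℤ.+ n ℚ./ 1) ⟨
  ℚ.toℚᵘ (1ℚ ℚ.+ ℤ.+ n ℚ./ 1)             ∎)
  where open ℚᵘₚ.≃-Reasoning

-- Copies the coefficient local to `IsLog`, so that `IsLog x L` unfolds to `expSum L ⟶ x`.
1/! : ℕ → ℚ
1/! j = (ℤ.+ 1 ℚ./ j !) {{ℕₚ._!≢0 j}}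

[1+j]*1/![1+j] : ∀ j → (ℤ.+ suc j ℚ./ 1) ℚ.* 1/! (suc j) ≡ 1/! j
[1+j]*1/![1+j] j = cancel (j !) {{ℕₚ._!≢0 j}} {{ℕₚ._!≢0 (suc j)}}
  where
  open ℚᵘₚ.≃-Reasoning
  cancel : ∀ d .{{_ : ℕ.NonZero d}} .{{_ : ℕ.NonZero (suc j ℕ.* d)}} →
           (ℤ.+ suc j ℚ./ 1) ℚ.* (ℤ.+ 1 ℚ./ (suc j ℕ.* d)) ≡ ℤ.+ 1 ℚ./ d
  cancel (suc d) = ℚₚ.toℚᵘ-injective (begin
    ℚ.toℚᵘ ((ℤ.+ suc j ℚ./ 1) ℚ.* (ℤ.+ 1 ℚ./ (suc j ℕ.* suc d)))
      ≈⟨ ℚₚ.toℚᵘ-homo-* (ℤ.+ suc j ℚ./ 1) (ℤ.+ 1 ℚ./ (suc j ℕ.* suc d)) ⟩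
    ℚ.toℚᵘ (ℤ.+ suc j ℚ./ 1) ℚᵘ.* ℚ.toℚᵘ (ℤ.+ 1 ℚ./ (suc j ℕ.* suc d))
      ≈⟨ ℚᵘₚ.*-cong (/-as-fromℚᵘ (ℤ.+ suc j) 0) (/-as-fromℚᵘ (ℤ.+ 1) (d ℕ.+ j ℕ.* suc d)) ⟩
    ℚᵘ.mkℚᵘ (ℤ.+ suc j) 0 ℚᵘ.* ℚᵘ.mkℚᵘ (ℤ.+ 1) (d ℕ.+ j ℕ.* suc d)
      ≈⟨ ℚᵘ.*≡* (cong ℤ.+_ (cong suc (arith d))) ⟩
    ℚᵘ.mkℚᵘ (ℤ.+ 1) d
      ≈⟨ /-as-fromℚᵘ (ℤ.+ 1) d ⟨
    ℚ.toℚᵘ (ℤ.+ 1 ℚ./ suc d) ∎)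
    where
    arith : ∀ d → d ℕ.+ (j ℕ.* 1) ℕ.* suc d ≡ d ℕ.+ j ℕ.* suc d ℕ.+ 0 ℕ.+ 0
    arith d = trans (cong (λ i → d ℕ.+ i ℕ.* suc d) (ℕₚ.*-identityʳ j))
      (sym (trans (ℕₚ.+-identityʳ _) (ℕₚ.+-identityʳ _)))

fromℕ-suc : ∀ n → fromℕ (suc n) ≈ 1ℝ + fromℕ n
fromℕ-suc n = ≈-trans (≈-reflexive (cong fromℚ ([1+n]/1 n))) (fromℚ-+ 1ℚ (ℤ.+ n ℚ./ 1))

fromℕ-+ : ∀ m n → fromℕ (m ℕ.+ n) ≈ fromℕ m + fromℕ n
fromℕ-+ zero    n = ≈-sym (+-identityˡ (fromℕ n))
fromℕ-+ (suc m) n = begin-equality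
  fromℕ (suc (m ℕ.+ n))        ≈⟨ fromℕ-suc (m ℕ.+ n) ⟩
  1ℝ + fromℕ (m ℕ.+ n)         ≈⟨ +-congˡ (fromℕ-+ m n) ⟩
  1ℝ + (fromℕ m + fromℕ n)     ≈⟨ +-assoc 1ℝ (fromℕ m) (fromℕ n) ⟨
  1ℝ + fromℕ m + fromℕ n       ≈⟨ +-congʳ (fromℕ-suc m) ⟨
  fromℕ (suc m) + fromℕ n      ∎
  where open ≤-Reasoning

0≤fromℕ : ∀ n → 0ℝ ≤ fromℕ n
0≤fromℕ zero    = ≤-refl
0≤fromℕ (suc n) = ≤-trans (0≤x+y 0≤1 (0≤fromℕ n)) (≈⇒≤ (≈-sym (fromℕ-suc n)))

1≤fromℕ[1+n] : ∀ n → 1ℝ ≤ fromℕ (suc n)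
1≤fromℕ[1+n] n = ≤-trans (x≤x+y (0≤fromℕ n)) (≈⇒≤ (≈-sym (fromℕ-suc n)))

0<1 : 0ℝ < 1ℝ
0<1 = fromℚ-pos (ℚₚ.positive⁻¹ 1ℚ)

0<fromℕ[1+n] : ∀ n → 0ℝ < fromℕ (suc n)
0<fromℕ[1+n] n = <-≤-trans 0<1 (1≤fromℕ[1+n] n)

fromℕ-mono-≤ : ∀ {m n} → m ℕ.≤ n → fromℕ m ≤ fromℕ n
fromℕ-mono-≤ {m} {n} m≤n = ≤-trans (x≤x+y (0≤fromℕ (n ℕ.∸ m)))
  (≈⇒≤ (≈-trans (≈-sym (fromℕ-+ m (n ℕ.∸ m))) (≈-reflexive (cong fromℕ (ℕₚ.m+[n∸m]≡n m≤n)))))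

p≤∣↥p∣/1 : ∀ p → p ℚ.≤ ℤ.+ ℤ.∣ ℚ.↥ p ∣ ℚ./ 1
p≤∣↥p∣/1 p@(ℚ.mkℚ i d _) = ℚₚ.toℚᵘ-cancel-≤ (begin
  ℚᵘ.mkℚᵘ i d                      ≤⟨ ℚᵘ.*≤* (bound i) ⟩
  ℚᵘ.mkℚᵘ (ℤ.+ ℤ.∣ i ∣) 0          ≃⟨ /-as-fromℚᵘ (ℤ.+ ℤ.∣ i ∣) 0 ⟨
  ℚ.toℚᵘ (ℤ.+ ℤ.∣ i ∣ ℚ./ 1)       ∎)
  where
  open ℚᵘₚ.≤-Reasoning
  bound : ∀ i → i ℤ.* ℤ.+ 1 ℤ.≤ ℤ.+ ℤ.∣ i ∣ ℤ.* ℤ.+ suc d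
  bound (ℤ.+ n)      = ℤₚ.*-monoˡ-≤-nonNeg (ℤ.+ n) (ℤ.+≤+ (s≤s z≤n))
  bound ℤ.-[1+ n ] = ℤ.-≤+

opaque
  unfolding fromℚ

  archimedean : ∀ x → ∃[ c ] x ≤ fromℕ c
  archimedean x = let B , _ , b = bounded x in ℤ.∣ ℚ.↥ B ∣ ,
    pointwise-≤ (mapₑ (λ {n} le → ℚₚ.≤-trans (p≤∣p∣ (seq x n)) (ℚₚ.≤-trans le (p≤∣↥p∣/1 B))) b)

  ≤-by-fromℚ : ∀ {x y} → (∀ ε → 0ℚ ℚ.< ε → x ≤ y + fromℚ ε) → x ≤ y
  ≤-by-fromℚ {x} {y} h = mk≤ λ ε 0<ε → mapₑ (λ {n} le →
    subst (seq x n ℚ.≤_) (trans (ℚₚ.+-assoc (seq y n) _ _) (cong (seq y n ℚ.+_) (halves ε))) le)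
    (_≤_.almost (h (ε ℚ.* ½) (half-pos 0<ε)) (ε ℚ.* ½) (half-pos 0<ε))

opaque
  unfolding fromℚ inv

  0<inv : ∀ x (0<x : 0ℝ < x) → 0ℝ < inv x 0<x
  0<inv x 0<x = let B , 0<B , b = bounded x in
    0<-intro (recip-pos 0<B) (mapₑ (λ { {n} (δ≤x , ∣x∣≤B) →
      recip-anti (ℚₚ.<-≤-trans (_<_.gap-pos 0<x) δ≤x) (ℚₚ.≤-trans (p≤∣p∣ (seq x n)) ∣x∣≤B) })
      (pos-below 0<x ∩ₑ b))

-- Bernoulli's inequality for 1 / x ≥ 1 + η.
bernoulli : ∀ {x η} → 0ℝ ≤ x → 0ℝ ≤ η → x + η ≤ 1ℝ → ∀ n → (1ℝ + fromℕ n * η) * x ^ n ≤ 1ℝ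
bernoulli {x} {η} 0≤x 0≤η x+η≤1 zero = ≈⇒≤
    (solve 1 (λ η → (con 1ℚ :+ con 0ℚ :* η) :* con 1ℚ := con 1ℚ) ≈-refl η)
bernoulli {x} {η} 0≤x 0≤η x+η≤1 (suc n) = begin
  (1ℝ + fromℕ (suc n) * η) * (x * x ^ n)
    ≈⟨ *-congʳ (+-congˡ (*-congʳ (fromℕ-suc n))) ⟩
  (1ℝ + (1ℝ + fromℕ n) * η) * (x * x ^ n)
    ≈⟨ solve 4 (λ x η c p → (con 1ℚ :+ (con 1ℚ :+ c) :* η) :* (x :* p) :=
         x :* ((con 1ℚ :+ c :* η) :* p) :+ η :* (x :* p)) ≈-refl x η (fromℕ n) (x ^ n) ⟩
  x * ((1ℝ + fromℕ n * η) * x ^ n) + η * x ^ suc n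
    ≤⟨ +-mono-≤ (x*y≤x 0≤x (bernoulli 0≤x 0≤η x+η≤1 n)) (x*y≤x 0≤η (^-≤1 0≤x x≤1 (suc n))) ⟩
  x + η ≤⟨ x+η≤1 ⟩
  1ℝ ∎
  where
  open ≤-Reasoning
  x≤1 : x ≤ 1ℝ
  x≤1 = ≤-trans (x≤x+y 0≤η) x+η≤1

-- Bernoulli's inequality gives `n * η * x ^ n ≤ 1`, so any `n` above `C / (η * ε)` will do.
geometric-decay : ∀ {x η} → 0ℝ ≤ x → 0ℝ < η → x + η ≤ 1ℝ → ∀ C ε → 0ℝ < ε →
                  Eventually λ n → C * x ^ n ≤ ε
geometric-decay {x} {η} 0≤x 0<η x+η≤1 C ε 0<ε =
  let N , le = archimedean (C * inv (η * ε) 0<ηε)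
  in N , λ n N≤n → begin
    C * x ^ n
      ≈⟨ *-congʳ (≈-trans (*-congˡ (≈-trans (*-comm _ _) (inv-inverse (η * ε) 0<ηε)))
          (*-identityʳ C)) ⟨
    C * (inv (η * ε) 0<ηε * (η * ε)) * x ^ n
      ≈⟨ *-congʳ (*-assoc C _ _) ⟨
    C * inv (η * ε) 0<ηε * (η * ε) * x ^ n
      ≤⟨ *-monoˡ-≤ (^-nonneg 0≤x n) (*-monoˡ-≤ (<⇒≤ 0<ηε) (≤-trans le (fromℕ-mono-≤ N≤n))) ⟩
    fromℕ n * (η * ε) * x ^ n
      ≈⟨ solve 4 (λ c η ε p → c :* (η :* ε) :* p := ε :* (c :* η :* p))
          ≈-refl (fromℕ n) η ε (x ^ n) ⟩
    ε * (fromℕ n * η * x ^ n)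
      ≤⟨ *-monoʳ-≤ (<⇒≤ 0<ε)
          (≤-trans (*-monoˡ-≤ (^-nonneg 0≤x n) (y≤x+y 0≤1)) (bernoulli 0≤x (<⇒≤ 0<η) x+η≤1 n)) ⟩
    ε * 1ℝ ≈⟨ *-identityʳ ε ⟩
    ε ∎
  where
  open ≤-Reasoning
  0<ηε = 0<x*y 0<η 0<ε

-- Limits with a nonstrict bound, which absorb the equality of reals.
infix 4 _⇝_
_⇝_ : (ℕ → ℝ) → ℝ → Set
f ⇝ a = ∀ ε → 0ℝ < ε → Eventually λ k → ∣ f k - a ∣ ≤ ε

⟶⇒⇝ : ∀ {f a} → f ⟶ a → f ⇝ a
⟶⇒⇝ h ε 0<ε = mapₑ <⇒≤ (h ε 0<ε)

0<½x : ∀ {x} → 0ℝ < x → 0ℝ < fromℚ ½ * x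
0<½x = 0<x*y (fromℚ-pos (ℚₚ.positive⁻¹ ½))

½x+½x≈x : ∀ x → fromℚ ½ * x + fromℚ ½ * x ≈ x
½x+½x≈x = solve 1 (λ x → con ½ :* x :+ con ½ :* x := x) ≈-refl

½x<x : ∀ {x} → 0ℝ < x → fromℚ ½ * x < x
½x<x {x} 0<x = <-≤-trans (lemma (0<½x 0<x)) (≈⇒≤ (½x+½x≈x x))
  where
  opaque
    unfolding fromℚ
    lemma : ∀ {x} → 0ℝ < x → x < x + x
    lemma {x} (mk< δ 0<δ h) = mk< δ 0<δ (mapₑ (λ {n} le →
      ℚₚ.+-monoʳ-≤ (seq x n) (subst (ℚ._≤ seq x n) (ℚₚ.+-identityˡ δ) le)) h)

⇝⇒⟶ : ∀ {f a} → f ⇝ a → f ⟶ a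
⇝⇒⟶ h ε 0<ε = mapₑ (λ le → ≤-<-trans le (½x<x 0<ε)) (h (fromℚ ½ * ε) (0<½x 0<ε))

⇝-const : ∀ a → (λ _ → a) ⇝ a
⇝-const a ε 0<ε = 0 , λ _ _ →
    ≤-trans (≈⇒≤ (≈-trans (∣∣-cong (-‿inverseʳ a)) (0≤x⇒∣x∣≈x ≤-refl))) (<⇒≤ 0<ε)

∣x-z∣≤ : ∀ x y z → ∣ x - z ∣ ≤ ∣ x - y ∣ + ∣ y - z ∣
∣x-z∣≤ x y z = ≤-trans (≈⇒≤ (∣∣-cong
  (solve 3 (λ x y z → x :- z := (x :- y) :+ (y :- z)) ≈-refl x y z))) (∣x+y∣≤∣x∣+∣y∣ _ _)

⇝-close : ∀ {f g a} → f ⇝ a → (λ k → g k - f k) ⇝ 0ℝ → g ⇝ a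
⇝-close {f} {g} {a} hf hg ε 0<ε = mapₑ (λ { {k} (p , q) → begin
  ∣ g k - a ∣                        ≤⟨ ∣x-z∣≤ (g k) (f k) a ⟩
  ∣ g k - f k ∣ + ∣ f k - a ∣        ≈⟨ +-congʳ
      (∣∣-cong (solve 1 (λ x → x := x :- con 0ℚ) ≈-refl (g k - f k))) ⟩
  ∣ g k - f k - 0ℝ ∣ + ∣ f k - a ∣   ≤⟨ +-mono-≤ p q ⟩
  fromℚ ½ * ε + fromℚ ½ * ε          ≈⟨ ½x+½x≈x ε ⟩
  ε                                  ∎ })
  (hg _ (0<½x 0<ε) ∩ₑ hf _ (0<½x 0<ε))
  where open ≤-Reasoning

⇝-mono-≤ : ∀ {f g a b} → f ⇝ a → g ⇝ b → Eventually (λ k → f k ≤ g k) → a ≤ b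
⇝-mono-≤ {f} {g} {a} {b} hf hg (K , h) = ≤-by-fromℚ λ ε 0<ε →
  let 0<δ = 0<½x (fromℚ-pos 0<ε)
      N , k = (hf _ 0<δ ∩ₑ hg _ 0<δ) ∩ₑ (K , h)
      (p , q) , r = k N ℕₚ.≤-refl
  in begin
    a ≈⟨ solve 2 (λ a f → a := f :+ (a :- f)) ≈-refl a (f N) ⟩
    f N + (a - f N) ≤⟨ +-mono-≤ r (≤-trans (≤-trans (x≤∣x∣ _) (≈⇒≤ (∣x-y∣≈∣y-x∣ a (f N)))) p) ⟩
    g N + fromℚ ½ * fromℚ ε ≈⟨ +-congʳ (solve 2 (λ b g → g := b :+ (g :- b)) ≈-refl b (g N)) ⟩
    b + (g N - b) + fromℚ ½ * fromℚ ε ≤⟨ +-monoˡ-≤ _ (+-monoʳ-≤ b (≤-trans (x≤∣x∣ _) q)) ⟩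
    b + fromℚ ½ * fromℚ ε + fromℚ ½ * fromℚ ε ≈⟨ ≈-trans (+-assoc b _ _)
        (+-congˡ (½x+½x≈x (fromℚ ε))) ⟩
    b + fromℚ ε ∎
  where open ≤-Reasoning

⇝-* : ∀ {f g a b} → f ⇝ a → g ⇝ b → (λ k → f k * g k) ⇝ a * b
⇝-* {f} {g} {a} {b} hf hg ε 0<ε = mapₑ (λ { {k} ((p , q) , r) → begin
    ∣ f k * g k - a * b ∣
      ≈⟨ ∣∣-cong (solve 4 (λ f g a b → f :* g :- a :* b :=
          (f :- a :+ a) :* (g :- b) :+ b :* (f :- a)) ≈-refl (f k) (g k) a b) ⟩
    ∣ (f k - a + a) * (g k - b) + b * (f k - a) ∣
      ≤⟨ ∣x+y∣≤∣x∣+∣y∣ _ _ ⟩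
    ∣ (f k - a + a) * (g k - b) ∣ + ∣ b * (f k - a) ∣
      ≈⟨ +-cong (∣x*y∣≈∣x∣*∣y∣ _ _) (∣x*y∣≈∣x∣*∣y∣ _ _) ⟩
    ∣ f k - a + a ∣ * ∣ g k - b ∣ + ∣ b ∣ * ∣ f k - a ∣
      ≤⟨ +-mono-≤ (≤-trans (*-monoʳ-≤ (0≤∣x∣ _) q)
                    (*-monoˡ-≤ (<⇒≤ 0<δ) (≤-trans (∣x+y∣≤∣x∣+∣y∣ _ _) (+-monoˡ-≤ ∣ a ∣ r))))
                  (*-monoʳ-≤ (0≤∣x∣ b) p) ⟩
    (1ℝ + ∣ a ∣) * δ + ∣ b ∣ * δ
      ≈⟨ distribʳ δ _ _ ⟨
    c * δ
      ≈⟨ ≈-trans (≈-sym (*-assoc c _ ε)) (≈-trans (*-congʳ (inv-inverse c 0<c)) (*-identityˡ ε)) ⟩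
    ε ∎ })
    (hf δ 0<δ ∩ₑ hg δ 0<δ ∩ₑ hf 1ℝ 0<1)
  where
  open ≤-Reasoning
  -- The bound `hf` at 1 gives `∣ f k ∣ ≤ 1 + ∣ a ∣`, so the two errors add up to at most `c * δ`,
  -- which is `ε`.
  c = 1ℝ + ∣ a ∣ + ∣ b ∣
  0<c : 0ℝ < c
  0<c = <-≤-trans 0<1 (≤-trans (x≤x+y (0≤∣x∣ a)) (x≤x+y (0≤∣x∣ b)))
  δ = inv c 0<c * ε
  0<δ : 0ℝ < δ
  0<δ = 0<x*y (0<inv c 0<c) 0<ε

-- The exponential series

convolution : (f g : ℕ → ℝ) → ℕ → ℝ
convolution f g zero    = f 0 * g 0
convolution f g (suc n) = f 0 * g (suc n) + convolution (f ∘ suc) g n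

-- If f i = x^(i + d) / (i + d)! and g k = y^k / k!, then differentiating the
-- convolution of the generating functions gives a recursion in n; d records
-- how often the recursion has already shifted f.
convolution-suc : ∀ {x y} d f g →
  (∀ i → fromℕ (suc (i ℕ.+ d)) * f (suc i) ≈ x * f i) →
  (∀ k → fromℕ (suc k) * g (suc k) ≈ y * g k) → ∀ n →
  fromℕ (suc (n ℕ.+ d)) * convolution f g (suc n) ≈
  (x + y) * convolution f g n + fromℕ d * (f 0 * g (suc n))
convolution-suc {x} {y} d f g hf hg zero = begin-equality
  fromℕ (suc d) * (f 0 * g 1 + f 1 * g 0)
    ≈⟨ solve 5 (λ s a b c e → s :* (a :* b :+ c :* e) := s :* (a :* b) :+ s :* c :* e)
        ≈-refl (fromℕ (suc d)) (f 0) (g 1) (f 1) (g 0) ⟩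
  fromℕ (suc d) * (f 0 * g 1) + fromℕ (suc d) * f 1 * g 0
    ≈⟨ +-cong (*-congʳ (fromℕ-suc d)) (*-congʳ (hf 0)) ⟩
  (1ℝ + fromℕ d) * (f 0 * g 1) + x * f 0 * g 0
    ≈⟨ solve 5 (λ d a b x e → (con 1ℚ :+ d) :* (a :* b) :+ x :* a :* e :=
        a :* (con 1ℚ :* b) :+ x :* a :* e :+ d :* (a :* b)) ≈-refl (fromℕ d) (f 0) (g 1) x (g 0) ⟩
  f 0 * (1ℝ * g 1) + x * f 0 * g 0 + fromℕ d * (f 0 * g 1)
    ≈⟨ +-congʳ (+-congʳ (*-congˡ (hg 0))) ⟩
  f 0 * (y * g 0) + x * f 0 * g 0 + fromℕ d * (f 0 * g 1)
    ≈⟨ +-congʳ (solve 4 (λ x y a b → a :* (y :* b) :+ x :* a :* b := (x :+ y) :* (a :* b))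
        ≈-refl x y (f 0) (g 0)) ⟩
  (x + y) * (f 0 * g 0) + fromℕ d * (f 0 * g 1) ∎
  where open ≤-Reasoning
convolution-suc {x} {y} d f g hf hg (suc n) = begin-equality
  fromℕ (suc (suc n ℕ.+ d)) * (f 0 * g (suc (suc n)) + r′)
    ≈⟨ distribˡ _ _ _ ⟩
  fromℕ (suc (suc n ℕ.+ d)) * (f 0 * g (suc (suc n))) + fromℕ (suc (suc n ℕ.+ d)) * r′
    ≈⟨ +-cong (*-congʳ (fromℕ-+ (suc (suc n)) d))
         (≈-trans (*-congʳ (≈-reflexive (cong (fromℕ ∘ suc) (sym (ℕₚ.+-suc n d)))))
           (convolution-suc (suc d) (f ∘ suc) g
             (λ i → ≈-trans (*-congʳ (≈-reflexive (cong (fromℕ ∘ suc) (ℕₚ.+-suc i d))))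
                 (hf (suc i))) hg n)) ⟩
  (fromℕ (suc (suc n)) + fromℕ d) * (f 0 * g (suc (suc n))) +
      ((x + y) * r + fromℕ (suc d) * (f 1 * g (suc n)))
    ≈⟨ solve 9 (λ N d a b xy r d′ c e →
         (N :+ d) :* (a :* b) :+ (xy :* r :+ d′ :* (c :* e)) :=
         a :* (N :* b) :+ xy :* r :+ d′ :* c :* e :+ d :* (a :* b)) ≈-refl
         (fromℕ (suc (suc n))) (fromℕ d) (f 0) (g (suc (suc n))) (x + y) r (fromℕ (suc d)) (f 1)
             (g (suc n)) ⟩
  f 0 * (fromℕ (suc (suc n)) * g (suc (suc n))) + (x + y) * r + fromℕ (suc d) * f 1 * g
      (suc n) + fromℕ d * (f 0 * g (suc (suc n)))
    ≈⟨ +-congʳ (+-cong (+-congʳ (*-congˡ (hg (suc n)))) (*-congʳ (hf 0))) ⟩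
  f 0 * (y * g (suc n)) + (x + y) * r + x * f 0 * g (suc n) + fromℕ d * (f 0 * g (suc (suc n)))
    ≈⟨ +-congʳ (solve 5 (λ x y a b r → a :* (y :* b) :+ (x :+ y) :* r :+ x :* a :* b :=
        (x :+ y) :* (a :* b :+ r)) ≈-refl x y (f 0) (g (suc n)) r) ⟩
  (x + y) * (f 0 * g (suc n) + r) + fromℕ d * (f 0 * g (suc (suc n))) ∎
  where
  open ≤-Reasoning
  r  = convolution (f ∘ suc) g n
  r′ = convolution (f ∘ suc) g (suc n)

-- ∑_{i < N} f i (∑_{N - i ≤ k < K} g k), so that for K = N it is the part of
-- the product of partial sums which the partial sum of the convolution lacks.
remainder : ℕ → (f g : ℕ → ℝ) → ℕ → ℝ
remainder K f g zero    = 0ℝ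
remainder K f g (suc N) =
  f 0 * (∑ (upTo K) g - ∑ (upTo (suc N)) g) + remainder K (f ∘ suc) g N

-- `K` is kept apart from `N` because the induction removes values of `f` only and leaves the sum
-- over `g` whole.
∑-convolution : ∀ K f g N → ∑ (upTo N) f * ∑ (upTo K) g ≈
                ∑ (upTo N) (convolution f g) + remainder K f g N
∑-convolution K f g zero    = ≈-trans (zeroˡ _) (≈-sym (+-identityˡ 0ℝ))
∑-convolution K f g (suc N) = begin-equality
  ∑ (upTo (suc N)) f * G                            ≡⟨ cong (_* G) (∑-upTo-suc N f) ⟩
  (f 0 + ∑ (upTo N) (f ∘ suc)) * G                  ≈⟨ distribʳ G _ _ ⟩
  f 0 * G + ∑ (upTo N) (f ∘ suc) * G                ≈⟨ +-congˡ (∑-convolution K (f ∘ suc) g N) ⟩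
  f 0 * G + (c + R)
    ≈⟨ solve 6 (λ a G c R b s → a :* G :+ (c :+ R) :=
        a :* b :+ (a :* s :+ c) :+ (a :* (G :- (b :+ s)) :+ R))
        ≈-refl (f 0) G c R (g 0) (∑ (upTo N) (g ∘ suc)) ⟩
  f 0 * g 0 + (f 0 * ∑ (upTo N) (g ∘ suc) + c) + (f 0 * (G - (g 0 + ∑ (upTo N) (g ∘ suc))) + R)
    ≈⟨ +-cong (+-congˡ (≈-trans (+-congʳ (≈-sym (∑-*ˡ (upTo N) (f 0) (g ∘ suc))))
        (≈-sym (∑-+ (upTo N) _ _))))
        (+-congʳ (*-congˡ (+-congˡ (-‿cong (≈-reflexive (sym (∑-upTo-suc N g))))))) ⟩
  f 0 * g 0 + ∑ (upTo N) (convolution f g ∘ suc) + remainder K f g (suc N)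
    ≡⟨ cong (_+ remainder K f g (suc N)) (∑-upTo-suc N (convolution f g)) ⟨
  ∑ (upTo (suc N)) (convolution f g) + remainder K f g (suc N) ∎
  where
  open ≤-Reasoning
  G = ∑ (upTo K) g
  c = ∑ (upTo N) (convolution (f ∘ suc) g)
  R = remainder K (f ∘ suc) g N

∑-upTo-diff-nonneg : ∀ {g} → (∀ k → 0ℝ ≤ g k) → ∀ {M K} → M ℕ.≤ K → 0ℝ ≤ ∑ (upTo K) g - ∑ (upTo M) g
∑-upTo-diff-nonneg {g} h {K = K} z≤n = ≤-trans (∑-nonneg (upTo K) h)
  (≈⇒≤ (solve 1 (λ s → s := s :- con 0ℚ) ≈-refl _))
∑-upTo-diff-nonneg {g} h (s≤s {M} {K} le) = ≤-trans (∑-upTo-diff-nonneg (h ∘ suc) le)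
  (≈⇒≤ (≈-trans (solve 3 (λ a s t → s :- t := (a :+ s) :- (a :+ t)) ≈-refl (g 0) _ _)
    (≈-reflexive (sym (cong₂ _-_ (∑-upTo-suc K g) (∑-upTo-suc M g))))))

remainder-nonneg : ∀ K {f g} → (∀ k → 0ℝ ≤ f k) → (∀ k → 0ℝ ≤ g k) →
                   ∀ {N} → N ℕ.≤ K → 0ℝ ≤ remainder K f g N
remainder-nonneg K hf hg {zero}  le = ≤-refl
remainder-nonneg K hf hg {suc N} le = 0≤x+y (0≤x*y (hf 0) (∑-upTo-diff-nonneg hg le))
  (remainder-nonneg K (hf ∘ suc) hg (ℕₚ.<⇒≤ le))

-- A geometric bound for the remainder of a product of series.

2ℝ ½ℝ : ℝ
2ℝ = fromℚ (ℤ.+ 2 ℚ./ 1)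
½ℝ = fromℚ ½

0≤2 : 0ℝ ≤ 2ℝ
0≤2 = fromℚ-mono-≤ (ℚₚ.<⇒≤ (ℚₚ.positive⁻¹ _))

0≤½ : 0ℝ ≤ ½ℝ
0≤½ = fromℚ-mono-≤ (ℚₚ.<⇒≤ (ℚₚ.positive⁻¹ _))

-- The weights `2 ^ i` are paid back as a factor `½ ^ N` in any sum over indices beyond `N`. For an
-- exponential series they only replace `x` by `2 * ∣ x ∣`, so the scaled sums stay bounded.
scaled : (ℕ → ℝ) → ℕ → ℝ
scaled f i = 2ℝ ^ i * ∣ f i ∣

scaled-nonneg : ∀ f i → 0ℝ ≤ scaled f i
scaled-nonneg f i = 0≤x*y (^-nonneg 0≤2 i) (0≤∣x∣ (f i))

½*scaled : ∀ f N → ∑ (upTo N) (scaled (f ∘ suc)) ≈ ½ℝ * ∑ (upTo N) (scaled f ∘ suc)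
½*scaled f N = ≈-trans (∑-cong (upTo N) λ i →
  solve 2 (λ p a → p :* a := con ½ :* (con (ℤ.+ 2 ℚ./ 1) :* p :* a)) ≈-refl (2ℝ ^ i) ∣ f (suc i) ∣)
  (∑-*ˡ (upTo N) ½ℝ (scaled f ∘ suc))

∣∣≤scaled : ∀ f i → ∣ f i ∣ ≤ scaled f i
∣∣≤scaled f i = ≤-trans (≈⇒≤ (≈-sym (*-identityˡ _))) (*-monoˡ-≤ (0≤∣x∣ (f i)) (1≤2^ i))
  where
  1≤2^ : ∀ i → 1ℝ ≤ 2ℝ ^ i
  1≤2^ zero    = ≤-refl
  1≤2^ (suc i) = ≤-trans (1≤2^ i) (≤-trans (x≤x+y (^-nonneg 0≤2 i))
    (≈⇒≤ (solve 1 (λ p → p :+ p := con (ℤ.+ 2 ℚ./ 1) :* p) ≈-refl (2ℝ ^ i))))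

tail-bound : ∀ g {M K} → M ℕ.≤ K →
  ∣ ∑ (upTo K) g - ∑ (upTo M) g ∣ ≤ ½ℝ ^ M * ∑ (upTo K) (scaled g)
tail-bound g {K = K} z≤n = begin
  ∣ ∑ (upTo K) g - 0ℝ ∣        ≈⟨ ∣∣-cong (solve 1 (λ s → s :- con 0ℚ := s) ≈-refl _) ⟩
  ∣ ∑ (upTo K) g ∣             ≤⟨ ∣∑∣≤∑∣∣ (upTo K) g ⟩
  ∑ (upTo K) (λ k → ∣ g k ∣)   ≤⟨ ∑-mono-≤ (upTo K) (∣∣≤scaled g) ⟩
  ∑ (upTo K) (scaled g)        ≈⟨ *-identityˡ _ ⟨
  1ℝ * ∑ (upTo K) (scaled g)   ∎
  where open ≤-Reasoning
tail-bound g (s≤s {M} {K} le) = begin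
  ∣ ∑ (upTo (suc K)) g - ∑ (upTo (suc M)) g ∣
    ≡⟨ cong ∣_∣ (cong₂ _-_ (∑-upTo-suc K g) (∑-upTo-suc M g)) ⟩
  ∣ (g 0 + ∑ (upTo K) (g ∘ suc)) - (g 0 + ∑ (upTo M) (g ∘ suc)) ∣
    ≈⟨ ∣∣-cong (solve 3 (λ a s t → (a :+ s) :- (a :+ t) := s :- t) ≈-refl (g 0) _ _) ⟩
  ∣ ∑ (upTo K) (g ∘ suc) - ∑ (upTo M) (g ∘ suc) ∣
    ≤⟨ tail-bound (g ∘ suc) le ⟩
  ½ℝ ^ M * ∑ (upTo K) (scaled (g ∘ suc))
    ≈⟨ *-congˡ (½*scaled g K) ⟩
  ½ℝ ^ M * (½ℝ * ∑ (upTo K) (scaled g ∘ suc))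
    ≈⟨ solve 2 (λ p s → p :* (con ½ :* s) := con ½ :* p :* s) ≈-refl (½ℝ ^ M) _ ⟩
  ½ℝ ^ suc M * ∑ (upTo K) (scaled g ∘ suc)
    ≤⟨ *-monoʳ-≤ (^-nonneg 0≤½ (suc M)) (y≤x+y (scaled-nonneg g 0)) ⟩
  ½ℝ ^ suc M * (scaled g 0 + ∑ (upTo K) (scaled g ∘ suc))
    ≡⟨ cong (½ℝ ^ suc M *_) (∑-upTo-suc K (scaled g)) ⟨
  ½ℝ ^ suc M * ∑ (upTo (suc K)) (scaled g) ∎
  where open ≤-Reasoning

-- Every product `f i * g k` in the remainder has `i + k ≥ N`, so its absolute value is at most
-- `½ ^ N` times that of the scaled product.
remainder-bound : ∀ K f g {N} → N ℕ.≤ K →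
  ∣ remainder K f g N ∣ ≤ ∑ (upTo K) (scaled g) * (½ℝ ^ N * ∑ (upTo N) (scaled f))
remainder-bound K f g {zero}  le = ≤-trans (≈⇒≤ (0≤x⇒∣x∣≈x ≤-refl))
  (≈⇒≤ (solve 1 (λ c → con 0ℚ := c :* (con 1ℚ :* con 0ℚ)) ≈-refl _))
remainder-bound K f g {suc N} le = begin
  ∣ f 0 * t + remainder K (f ∘ suc) g N ∣
    ≤⟨ ∣x+y∣≤∣x∣+∣y∣ _ _ ⟩
  ∣ f 0 * t ∣ + ∣ remainder K (f ∘ suc) g N ∣
    ≤⟨ +-mono-≤ (≤-trans (≈⇒≤ (∣x*y∣≈∣x∣*∣y∣ _ _)) (*-monoʳ-≤ (0≤∣x∣ (f 0)) (tail-bound g le)))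
        (≤-trans (remainder-bound K (f ∘ suc) g (ℕₚ.<⇒≤ le))
            (≈⇒≤ (*-congˡ (*-congˡ (½*scaled f N))))) ⟩
  ∣ f 0 ∣ * (½ℝ * ½ℝ ^ N * C) + C * (½ℝ ^ N * (½ℝ * s))
    ≈⟨ solve 4 (λ a h C s → a :* (con ½ :* h :* C) :+ C :* (h :* (con ½ :* s)) :=
        C :* (con ½ :* h :* (con 1ℚ :* a :+ s))) ≈-refl
         ∣ f 0 ∣ (½ℝ ^ N) C s ⟩
  C * (½ℝ ^ suc N * (scaled f 0 + s))
    ≡⟨ cong (λ u → C * (½ℝ ^ suc N * u)) (∑-upTo-suc N (scaled f)) ⟨
  C * (½ℝ ^ suc N * ∑ (upTo (suc N)) (scaled f)) ∎
  where
  open ≤-Reasoning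
  t = ∑ (upTo K) g - ∑ (upTo (suc N)) g
  C = ∑ (upTo K) (scaled g)
  s = ∑ (upTo N) (scaled f ∘ suc)

-- The functional equation of the exponential, on partial sums.

expTerm : ℝ → ℕ → ℝ
expTerm x j = fromℚ (1/! j) * x ^ j

expSum : ℝ → ℕ → ℝ
expSum x N = ∑ (upTo N) (expTerm x)

expTerm-suc : ∀ x j → fromℕ (suc j) * expTerm x (suc j) ≈ x * expTerm x j
expTerm-suc x j = begin-equality
  fromℕ (suc j) * (fromℚ (1/! (suc j)) * (x * x ^ j))
    ≈⟨ solve 4 (λ a b x p → a :* (b :* (x :* p)) := a :* b :* (x :* p)) ≈-refl _ _ x (x ^ j) ⟩
  fromℕ (suc j) * fromℚ (1/! (suc j)) * (x * x ^ j)
    ≈⟨ *-congʳ (≈-trans (≈-sym (fromℚ-* _ _)) (≈-reflexive (cong fromℚ ([1+j]*1/![1+j] j)))) ⟩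
  fromℚ (1/! j) * (x * x ^ j)
    ≈⟨ solve 3 (λ b x p → b :* (x :* p) := x :* (b :* p)) ≈-refl _ x (x ^ j) ⟩
  x * (fromℚ (1/! j) * x ^ j) ∎
  where open ≤-Reasoning

expTerm-cong : ∀ {x y} j → x ≈ y → expTerm x j ≈ expTerm y j
expTerm-cong j h = *-congˡ (^-cong j h)

expSum-cong : ∀ {x y} N → x ≈ y → expSum x N ≈ expSum y N
expSum-cong N h = ∑-cong (upTo N) λ j → expTerm-cong j h

-- This is the binomial theorem without binomial coefficients: by `convolution-suc` at `d = 0` both
-- sides satisfy `(n + 1) c (n + 1) = (x + y) c n`, and `n + 1` can be cancelled.
convolution-expTerm : ∀ x y n → convolution (expTerm x) (expTerm y) n ≈ expTerm (x + y) n
convolution-expTerm x y zero    = ≈-trans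
  (solve 1 (λ a → a :* con 1ℚ :* (a :* con 1ℚ) := a :* a) ≈-refl (fromℚ (1/! 0)))
  (≈-trans (*-identityˡ _) (≈-sym (*-identityʳ _)))
convolution-expTerm x y (suc n) = x*z≈y*z⇒x≈y (0<fromℕ[1+n] n) (begin-equality
  convolution (expTerm x) (expTerm y) (suc n) * fromℕ (suc n)
    ≈⟨ *-comm _ _ ⟩
  fromℕ (suc n) * convolution (expTerm x) (expTerm y) (suc n)
    ≡⟨ cong (λ k → fromℕ (suc k) * convolution (expTerm x) (expTerm y) (suc n)) (ℕₚ.+-identityʳ n) ⟨
  fromℕ (suc (n ℕ.+ 0)) * convolution (expTerm x) (expTerm y) (suc n)
    ≈⟨ convolution-suc {x} {y} 0 (expTerm x) (expTerm y)
         (λ i → ≈-trans (*-congʳ (≈-reflexive (cong (fromℕ ∘ suc) (ℕₚ.+-identityʳ i))))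
             (expTerm-suc x i))
         (expTerm-suc y) n ⟩
  (x + y) * convolution (expTerm x) (expTerm y) n + 0ℝ * (expTerm x 0 * expTerm y (suc n))
    ≈⟨ solve 3 (λ a c b → a :* c :+ con 0ℚ :* b := a :* c) ≈-refl (x + y) _ _ ⟩
  (x + y) * convolution (expTerm x) (expTerm y) n
    ≈⟨ *-congˡ (convolution-expTerm x y n) ⟩
  (x + y) * expTerm (x + y) n
    ≈⟨ expTerm-suc (x + y) n ⟨
  fromℕ (suc n) * expTerm (x + y) (suc n)
    ≈⟨ *-comm _ _ ⟩
  expTerm (x + y) (suc n) * fromℕ (suc n) ∎)
  where open ≤-Reasoning

expSum-* : ∀ x y N → expSum x N * expSum y N ≈ expSum (x + y) N + remainder N (expTerm x)
    (expTerm y) N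
expSum-* x y N = ≈-trans (∑-convolution N (expTerm x) (expTerm y) N)
  (+-congʳ (∑-cong (upTo N) (convolution-expTerm x y)))

0≤1/! : ∀ j → 0ℝ ≤ fromℚ (1/! j)
0≤1/! zero    = 0≤1
0≤1/! (suc j) = x*z≤y*z⇒x≤y (0<fromℕ[1+n] j) (begin
  0ℝ * fromℕ (suc j)                    ≈⟨ zeroˡ _ ⟩
  0ℝ                                    ≤⟨ 0≤1/! j ⟩
  fromℚ (1/! j)                         ≡⟨ cong fromℚ ([1+j]*1/![1+j] j) ⟨
  fromℚ ((ℤ.+ suc j ℚ./ 1) ℚ.* 1/! (suc j)) ≈⟨ fromℚ-* _ _ ⟩
  fromℕ (suc j) * fromℚ (1/! (suc j))   ≈⟨ *-comm _ _ ⟩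
  fromℚ (1/! (suc j)) * fromℕ (suc j)   ∎)
  where open ≤-Reasoning

1/!≤1 : ∀ j → fromℚ (1/! j) ≤ 1ℝ
1/!≤1 zero    = ≤-refl
1/!≤1 (suc j) = begin
  fromℚ (1/! (suc j))                   ≈⟨ *-identityˡ _ ⟨
  1ℝ * fromℚ (1/! (suc j))              ≤⟨ *-monoˡ-≤ (0≤1/! (suc j)) (1≤fromℕ[1+n] j) ⟩
  fromℕ (suc j) * fromℚ (1/! (suc j))   ≈⟨ fromℚ-* _ _ ⟨
  fromℚ ((ℤ.+ suc j ℚ./ 1) ℚ.* 1/! (suc j)) ≡⟨ cong fromℚ ([1+j]*1/![1+j] j) ⟩
  fromℚ (1/! j)                         ≤⟨ 1/!≤1 j ⟩
  1ℝ                                    ∎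
  where open ≤-Reasoning

^-mono-≤ : ∀ {x y} → 0ℝ ≤ x → x ≤ y → ∀ n → x ^ n ≤ y ^ n
^-mono-≤ 0≤x h zero    = ≤-refl
^-mono-≤ 0≤x h (suc n) = ≤-trans (*-monoˡ-≤ (^-nonneg 0≤x n) h)
  (*-monoʳ-≤ (≤-trans 0≤x h) (^-mono-≤ 0≤x h n))

∣x^n∣≈∣x∣^n : ∀ x n → ∣ x ^ n ∣ ≈ ∣ x ∣ ^ n
∣x^n∣≈∣x∣^n x zero    = 0≤x⇒∣x∣≈x 0≤1
∣x^n∣≈∣x∣^n x (suc n) = ≈-trans (∣x*y∣≈∣x∣*∣y∣ x (x ^ n)) (*-congˡ (∣x^n∣≈∣x∣^n x n))

expTerm-nonneg : ∀ {x} → 0ℝ ≤ x → ∀ j → 0ℝ ≤ expTerm x j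
expTerm-nonneg h j = 0≤x*y (0≤1/! j) (^-nonneg h j)

expSum-nonneg : ∀ {x} → 0ℝ ≤ x → ∀ N → 0ℝ ≤ expSum x N
expSum-nonneg h N = ∑-nonneg (upTo N) (expTerm-nonneg h)

expSum-mono-≤ : ∀ {x y} → 0ℝ ≤ x → x ≤ y → ∀ N → expSum x N ≤ expSum y N
expSum-mono-≤ 0≤x h N = ∑-mono-≤ (upTo N) λ j → *-monoʳ-≤ (0≤1/! j) (^-mono-≤ 0≤x h j)

-- For nonnegative arguments the remainder is a sum of nonnegative products.
expSum-submultiplicative : ∀ {x y} → 0ℝ ≤ x → 0ℝ ≤ y → ∀ N →
    expSum (x + y) N ≤ expSum x N * expSum y N
expSum-submultiplicative {x} {y} 0≤x 0≤y N = ≤-trans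
  (x≤x+y (remainder-nonneg N (expTerm-nonneg 0≤x) (expTerm-nonneg 0≤y) ℕₚ.≤-refl))
  (≈⇒≤ (≈-sym (expSum-* x y N)))

expSum-½≤2 : ∀ N → expSum ½ℝ N ≤ 2ℝ
expSum-½≤2 N = begin
  expSum ½ℝ N                           ≤⟨ ∑-mono-≤ (upTo N)
      (λ j → ≤-trans (*-monoˡ-≤ (^-nonneg 0≤½ j) (1/!≤1 j)) (≈⇒≤ (*-identityˡ _))) ⟩
  ∑ (upTo N) (½ℝ ^_)                    ≤⟨ x≤x+y (0≤x*y 0≤2 (^-nonneg 0≤½ N)) ⟩
  ∑ (upTo N) (½ℝ ^_) + 2ℝ * ½ℝ ^ N      ≈⟨ geometric N ⟩
  2ℝ                                    ∎
  where
  open ≤-Reasoning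
  geometric : ∀ N → ∑ (upTo N) (½ℝ ^_) + 2ℝ * ½ℝ ^ N ≈ 2ℝ
  geometric zero    = solve 0 (con 0ℚ :+ con (ℤ.+ 2 ℚ./ 1) :* con 1ℚ := con (ℤ.+ 2 ℚ./ 1)) ≈-refl
  geometric (suc N) = ≈-trans (+-congʳ (∑-upTo-last N (½ℝ ^_)))
    (≈-trans (solve 2 (λ s p → s :+ p :+ con (ℤ.+ 2 ℚ./ 1) :* (con ½ :* p) :=
        s :+ con (ℤ.+ 2 ℚ./ 1) :* p) ≈-refl _ (½ℝ ^ N))
      (geometric N))

expSum-0 : ∀ N → expSum 0ℝ (suc N) ≈ 1ℝ
expSum-0 N = ≈-trans (≈-reflexive (∑-upTo-suc N (expTerm 0ℝ)))
  (≈-trans (+-cong (*-identityʳ _)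
      (≈-trans (∑-cong (upTo N) λ j → ≈-trans (*-congˡ (zeroˡ _)) (zeroʳ _)) (∑-zero (upTo N))))
    (+-identityʳ _))

expSum-[c/2]≤2^c : ∀ c N → expSum (fromℕ c * ½ℝ) (suc N) ≤ 2ℝ ^ c
expSum-[c/2]≤2^c zero N = ≈⇒≤ (≈-trans (expSum-cong (suc N) (zeroˡ ½ℝ)) (expSum-0 N))
expSum-[c/2]≤2^c (suc c) N = begin
  expSum (fromℕ (suc c) * ½ℝ) (suc N)
    ≈⟨ expSum-cong (suc N)
        (≈-trans (*-congʳ (fromℕ-suc c))
        (≈-trans (distribʳ ½ℝ 1ℝ (fromℕ c)) (+-congʳ (*-identityˡ ½ℝ)))) ⟩
  expSum (½ℝ + fromℕ c * ½ℝ) (suc N)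
    ≤⟨ expSum-submultiplicative 0≤½ (0≤x*y (0≤fromℕ c) 0≤½) (suc N) ⟩
  expSum ½ℝ (suc N) * expSum (fromℕ c * ½ℝ) (suc N)
    ≤⟨ *-monoˡ-≤ (expSum-nonneg (0≤x*y (0≤fromℕ c) 0≤½) (suc N)) (expSum-½≤2 (suc N)) ⟩
  2ℝ * expSum (fromℕ c * ½ℝ) (suc N)
    ≤⟨ *-monoʳ-≤ 0≤2 (expSum-[c/2]≤2^c c N) ⟩
  2ℝ * 2ℝ ^ c ∎
  where open ≤-Reasoning

-- Choose a natural number `c ≥ 2 x`. Submultiplicativity bounds the sum at `c / 2` by the `c`-th
-- power of the sum at ½, and the latter is at most 2 by comparison with a geometric series.
-- Uniformity in `N` is what makes the remainder of a product vanish in the limit.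
expSum-bounded : ∀ x → 0ℝ ≤ x → ∃[ C ] 0ℝ ≤ C × (∀ N → expSum x N ≤ C)
expSum-bounded x 0≤x with archimedean (2ℝ * x)
... | c , le = 2ℝ ^ c , ^-nonneg 0≤2 c , bound
  where
  open ≤-Reasoning
  bound : ∀ N → expSum x N ≤ 2ℝ ^ c
  bound zero    = ^-nonneg 0≤2 c
  bound (suc N) = begin
    expSum x (suc N)             ≤⟨ expSum-mono-≤ 0≤x (≤-trans
      (≈⇒≤ (solve 1 (λ x → x := con (ℤ.+ 2 ℚ./ 1) :* x :* con ½) ≈-refl x)) (*-monoˡ-≤ 0≤½ le))
          (suc N) ⟩
    expSum (fromℕ c * ½ℝ) (suc N) ≤⟨ expSum-[c/2]≤2^c c N ⟩
    2ℝ ^ c ∎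

scaled-expTerm : ∀ x i → scaled (expTerm x) i ≈ expTerm (2ℝ * ∣ x ∣) i
scaled-expTerm x i = begin-equality
  2ℝ ^ i * ∣ fromℚ (1/! i) * x ^ i ∣        ≈⟨ *-congˡ
      (≈-trans (∣x*y∣≈∣x∣*∣y∣ _ _) (*-cong (0≤x⇒∣x∣≈x (0≤1/! i)) (∣x^n∣≈∣x∣^n x i))) ⟩
  2ℝ ^ i * (fromℚ (1/! i) * ∣ x ∣ ^ i)      ≈⟨ solve 3 (λ p c a → p :* (c :* a) := c :* (p :* a))
      ≈-refl (2ℝ ^ i) _ (∣ x ∣ ^ i) ⟩
  fromℚ (1/! i) * (2ℝ ^ i * ∣ x ∣ ^ i)      ≈⟨ *-congˡ (^-*-distrib 2ℝ ∣ x ∣ i) ⟨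
  fromℚ (1/! i) * (2ℝ * ∣ x ∣) ^ i          ∎
  where open ≤-Reasoning

-- The difference is the remainder, which is at most `D * C * ½ ^ N` with `C` and `D` bounding the
-- exponential sums at `2 * ∣ x ∣` and `2 * ∣ y ∣`. The passage to absolute values admits arguments
-- of either sign.
expSum-+ : ∀ x y → (λ N → expSum x N * expSum y N - expSum (x + y) N) ⇝ 0ℝ
expSum-+ x y ε 0<ε =
  let C , 0≤C , hC = scaled-bounded x
      D , 0≤D , hD = scaled-bounded y
  in mapₑ (λ {N} le → begin
    ∣ expSum x N * expSum y N - expSum (x + y) N - 0ℝ ∣
      ≈⟨ ∣∣-cong (≈-trans (+-congʳ (+-congʳ (expSum-* x y N)))
          (solve 2 (λ s r → s :+ r :- s :- con 0ℚ := r) ≈-refl _ _)) ⟩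
    ∣ remainder N (expTerm x) (expTerm y) N ∣
      ≤⟨ remainder-bound N (expTerm x) (expTerm y) ℕₚ.≤-refl ⟩
    ∑ (upTo N) (scaled (expTerm y)) * (½ℝ ^ N * ∑ (upTo N) (scaled (expTerm x)))
      ≤⟨ ≤-trans (*-monoˡ-≤ (0≤x*y (^-nonneg 0≤½ N) (∑-nonneg (upTo N) (scaled-nonneg (expTerm x))))
          (hD N))
           (*-monoʳ-≤ 0≤D (*-monoʳ-≤ (^-nonneg 0≤½ N) (hC N))) ⟩
    D * (½ℝ ^ N * C)
      ≈⟨ solve 3 (λ D p C → D :* (p :* C) := D :* C :* p) ≈-refl D (½ℝ ^ N) C ⟩
    D * C * ½ℝ ^ N
      ≤⟨ le ⟩
    ε ∎)
  (geometric-decay 0≤½ (fromℚ-pos (ℚₚ.positive⁻¹ ½))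
      (≈⇒≤ (solve 0 (con ½ :+ con ½ := con 1ℚ) ≈-refl)) (D * C) ε 0<ε)
  where
  open ≤-Reasoning
  scaled-bounded : ∀ x → ∃[ C ] 0ℝ ≤ C × (∀ N → ∑ (upTo N) (scaled (expTerm x)) ≤ C)
  scaled-bounded x = let C , 0≤C , h = expSum-bounded (2ℝ * ∣ x ∣) (0≤x*y 0≤2 (0≤∣x∣ x)) in
    C , 0≤C , λ N → ≤-trans (≈⇒≤ (∑-cong (upTo N) (scaled-expTerm x))) (h N)

expSum-multiple : ∀ {a Q} → expSum a ⇝ Q → ∀ j → expSum (fromℕ j * a) ⇝ Q ^ j
-- The threshold is 1 because the empty partial sum is 0 and not 1.
expSum-multiple {a} {Q} h zero = λ ε 0<ε → 1 , λ { (suc N) _ → begin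
  ∣ expSum (0ℝ * a) (suc N) - 1ℝ ∣
    ≈⟨ ∣∣-cong (+-congʳ (≈-trans (expSum-cong (suc N) (zeroˡ a)) (expSum-0 N))) ⟩
  ∣ 1ℝ - 1ℝ ∣ ≤⟨ proj₂ (⇝-const 1ℝ ε 0<ε) 0 z≤n ⟩
  ε ∎ }
  where open ≤-Reasoning
expSum-multiple {a} {Q} h (suc j) = ⇝-close (⇝-* h (expSum-multiple h j)) λ ε 0<ε →
    mapₑ (λ {N} le → begin
  ∣ expSum (fromℕ (suc j) * a) N - expSum a N * expSum (fromℕ j * a) N - 0ℝ ∣
    ≈⟨ ∣∣-cong (≈-trans (+-congʳ (+-congʳ (expSum-cong N
         (≈-trans (*-congʳ (fromℕ-suc j))
             (≈-trans (distribʳ a 1ℝ (fromℕ j)) (+-congʳ (*-identityˡ a)))))))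
         (solve 2 (λ s t → s :- t :- con 0ℚ := con 0ℚ :- (t :- s)) ≈-refl _ _)) ⟩
  ∣ 0ℝ - (expSum a N * expSum (fromℕ j * a) N - expSum (a + fromℕ j * a) N) ∣
    ≈⟨ ∣x-y∣≈∣y-x∣ _ _ ⟩
  ∣ expSum a N * expSum (fromℕ j * a) N - expSum (a + fromℕ j * a) N - 0ℝ ∣
    ≤⟨ le ⟩
  ε ∎) (expSum-+ a (fromℕ j * a) ε 0<ε)
  where open ≤-Reasoning

1+z≤expSum : ∀ {z} → 0ℝ ≤ z → ∀ N → 1ℝ + z ≤ expSum z (suc (suc N))
1+z≤expSum {z} 0≤z N = begin
  1ℝ + z
    ≈⟨ solve 1 (λ z → con 1ℚ :+ z := con 1ℚ :* con 1ℚ :+ (con 1ℚ :* (z :* con 1ℚ) :+ con 0ℚ))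
        ≈-refl z ⟩
  expTerm z 0 + (expTerm z 1 + 0ℝ)
    ≤⟨ +-monoʳ-≤ _ (+-monoʳ-≤ _ (∑-nonneg (upTo N) (λ j → expTerm-nonneg 0≤z (suc (suc j))))) ⟩
  expTerm z 0 + (expTerm z 1 + ∑ (upTo N) (expTerm z ∘ suc ∘ suc))
    ≡⟨ cong (expTerm z 0 +_) (∑-upTo-suc N (expTerm z ∘ suc)) ⟨
  expTerm z 0 + ∑ (upTo (suc N)) (expTerm z ∘ suc)
    ≡⟨ ∑-upTo-suc (suc N) (expTerm z) ⟨
  expSum z (suc (suc N)) ∎
  where open ≤-Reasoning

-- exp (ℓ a) = exp z exp b ≥ (1 + z) exp b, where nothing is assumed about the
-- signs of a and b.
exp-growth : ∀ {a b z Q M} ℓ → expSum a ⇝ Q → expSum b ⇝ M → 1ℝ ≤ M → 0ℝ ≤ z →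
             z + b ≈ fromℕ ℓ * a → (1ℝ + z) * M ≤ Q ^ ℓ
exp-growth {a} {b} {z} {Q} {M} ℓ ha hb 1≤M 0≤z eq =
  ⇝-mono-≤ (⇝-* (⇝-const (1ℝ + z)) hb)
    (⇝-close (expSum-multiple ha ℓ) λ ε 0<ε → mapₑ
      (λ {N} → ≤-trans (≈⇒≤ (∣∣-cong (+-congʳ (+-congˡ (-‿cong (expSum-cong N (≈-sym eq))))))))
          (expSum-+ z b ε 0<ε))
    (mapₑ (λ { {N} (h , le) → *-monoˡ-≤ (0≤expSum-b N h) le })
        (hb 1ℝ 0<1 ∩ₑ (2 , λ { (suc (suc N)) _ → 1+z≤expSum 0≤z N ; (suc zero) (s≤s ()) })))
  where
  open ≤-Reasoning
  -- A partial sum within 1 of the limit `M ≥ 1` is nonnegative, which allows multiplying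
  -- `1 + z ≤ expSum z N` by it.
  0≤expSum-b : ∀ N → ∣ expSum b N - M ∣ ≤ 1ℝ → 0ℝ ≤ expSum b N
  0≤expSum-b N h = begin
    0ℝ ≤⟨ 0≤y-x 1≤M ⟩
    M - 1ℝ ≤⟨ sub-monoʳ-≤ M (≤-trans (x≤∣x∣ _) (≤-trans (≈⇒≤ (∣x-y∣≈∣y-x∣ M (expSum b N))) h)) ⟩
    M - (M - expSum b N) ≈⟨ solve 2 (λ M s → M :- (M :- s) := s) ≈-refl M _ ⟩
    expSum b N ∎

-- Finite sets of natural numbers

infix 4 _⊂[_]
_⊂[_] : ∀ {n} → ℕ⁽ n ⁾ → ℕ → Set
A ⊂[ m ] = All (ℕ._< m) (elements A)

elements-injective : ∀ {n} {A B : ℕ⁽ n ⁾} → elements A ≡ elements B → A ≡ B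
elements-injective {A = mk _ _} {B = mk _ _} refl = refl

map-pred-suc : ∀ {n} (xs : Vec ℕ n) → Vec.map ℕ.pred (Vec.map suc xs) ≡ xs
map-pred-suc xs = trans (sym (Vecₚ.map-∘ ℕ.pred suc xs)) (Vecₚ.map-id xs)

map-suc-pred : ∀ {n} {xs : Vec ℕ n} → All (0 ℕ.<_) xs → Vec.map suc (Vec.map ℕ.pred xs) ≡ xs
map-suc-pred []                = refl
map-suc-pred (s≤s z≤n ∷ 0<xs) = cong (_ ∷_) (map-suc-pred 0<xs)

-- Mirrors the two halves of `subsets`, so that later inductions on `(n , m)` avoid the underlying
-- vectors.
data View {n} : ℕ⁽ suc n ⁾ → Set where
  with-0    : ∀ A → View 0∪ A +1
  without-0 : ∀ A → View (A +1)

view : ∀ {n} (A : ℕ⁽ suc n ⁾) → View A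
view (mk (zero ∷ xs) inc) = subst View
  (elements-injective (cong (0 ∷_) (map-suc-pred (head<tail inc′))))
  (with-0 (mk (Vec.map ℕ.pred xs) (map-pred-increasing (head<tail inc) (tail-increasing inc))))
  where
  inc′ = recompute (linked? ℕₚ._<?_ (0 ∷ xs)) inc
view (mk (suc x ∷ xs) inc) = subst View
  (elements-injective (map-suc-pred (0<all inc′)))
  (without-0 (mk (Vec.map ℕ.pred (suc x ∷ xs)) (map-pred-increasing (0<all inc) inc)))
  where
  0<all : Increasing (suc x ∷ xs) → All (0 ℕ.<_) (suc x ∷ xs)
  0<all inc = s≤s z≤n ∷ All.map (ℕₚ.≤-<-trans z≤n) (head<tail inc)
  inc′ = recompute (linked? ℕₚ._<?_ (suc x ∷ xs)) inc

+1-⊂ : ∀ {n m} (A : ℕ⁽ n ⁾) → A ⊂[ m ] → A +1 ⊂[ suc m ]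
+1-⊂ A h = Allₚ.map⁺ (All.map s≤s h)

+1-⊂⁻ : ∀ {n m} (A : ℕ⁽ n ⁾) → A +1 ⊂[ suc m ] → A ⊂[ m ]
+1-⊂⁻ A h = All.map ℕ.s≤s⁻¹ (Allₚ.map⁻ h)

0∪-⊂ : ∀ {n m} (A : ℕ⁽ n ⁾) → A ⊂[ m ] → 0∪ A +1 ⊂[ suc m ]
0∪-⊂ A h = s≤s z≤n ∷ +1-⊂ A h

0∪-⊂⁻ : ∀ {n m} (A : ℕ⁽ n ⁾) → 0∪ A +1 ⊂[ suc m ] → A ⊂[ m ]
0∪-⊂⁻ A (_ ∷ h) = +1-⊂⁻ A h

¬⊂[0] : ∀ {n} (A : ℕ⁽ suc n ⁾) → ¬ (A ⊂[ 0 ])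
¬⊂[0] (mk (_ ∷ _) _) (() ∷ _)

⊂⇒≤ : ∀ {n} m (A : ℕ⁽ n ⁾) → A ⊂[ m ] → n ℕ.≤ m
⊂⇒≤ {zero}  m       A h = z≤n
⊂⇒≤ {suc n} zero    A h = ⊥-elim (¬⊂[0] A h)
⊂⇒≤ {suc n} (suc m) A h with view A
... | with-0 B    = s≤s (⊂⇒≤ m B (0∪-⊂⁻ B h))
... | without-0 B = ℕₚ.m≤n⇒m≤1+n (⊂⇒≤ m B (+1-⊂⁻ B h))

initial : ∀ n → ℕ⁽ n ⁾
initial zero    = ∅
initial (suc n) = 0∪ initial n +1

⊂⇒initial : ∀ {n} (A : ℕ⁽ n ⁾) → A ⊂[ n ] → A ≡ initial n
⊂⇒initial {zero}  (mk [] _) h = refl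
⊂⇒initial {suc n} A h with view A
... | with-0 B    = cong 0∪_+1 (⊂⇒initial B (0∪-⊂⁻ B h))
... | without-0 B = ⊥-elim (ℕₚ.<-irrefl refl (⊂⇒≤ n B (+1-⊂⁻ B h)))

initial-⊂ : ∀ n → initial n ⊂[ n ]
initial-⊂ zero    = []
initial-⊂ (suc n) = 0∪-⊂ (initial n) (initial-⊂ n)

⊂-mono : ∀ {n m k} (A : ℕ⁽ n ⁾) → m ℕ.≤ k → A ⊂[ m ] → A ⊂[ k ]
⊂-mono A m≤k = All.map (λ x<m → ℕₚ.<-≤-trans x<m m≤k)

subsets-⊂ : ∀ n m → AllL.All (_⊂[ m ]) (subsets n m)
subsets-⊂ zero    m       = [] AllL.∷ AllL.[]
subsets-⊂ (suc n) zero    = AllL.[]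
subsets-⊂ (suc n) (suc m) = AllLₚ.++⁺
  (AllLₚ.map⁺ (AllL.map (λ {A} → 0∪-⊂ A) (subsets-⊂ n m)))
  (AllLₚ.map⁺ (AllL.map (λ {A} → +1-⊂ A) (subsets-⊂ (suc n) m)))

∑-subsets-cong : ∀ n m {f g} → (∀ A → A ⊂[ m ] → f A ≈ g A) → ∑ (subsets n m) f ≈ ∑ (subsets n m) g
∑-subsets-cong n m h = ∑-cong-All (AllL.map (λ {A} → h A) (subsets-⊂ n m))

∑-subsets-mono-≤ : ∀ n m {f g} → (∀ A → A ⊂[ m ] → f A ≤ g A) →
    ∑ (subsets n m) f ≤ ∑ (subsets n m) g
∑-subsets-mono-≤ n m h = ∑-mono-≤-All (AllL.map (λ {A} → h A) (subsets-⊂ n m))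

∑-subsets-suc : ∀ n m f → ∑ (subsets (suc n) (suc m)) f ≈
                ∑ (subsets n m) (f ∘ 0∪_+1) + ∑ (subsets (suc n) m) (f ∘ _+1)
∑-subsets-suc n m f = ≈-trans (∑-++ (List.map 0∪_+1 (subsets n m)) _ f)
  (≈-reflexive (cong₂ _+_ (∑-map 0∪_+1 (subsets n m) f) (∑-map _+1 (subsets (suc n) m) f)))

∑-subsets-restrict : ∀ n {m N} → m ℕ.≤ N → ∀ h → (∀ A → ¬ A ⊂[ m ] → h A ≈ 0ℝ) →
                     ∑ (subsets n N) h ≈ ∑ (subsets n m) h
∑-subsets-restrict zero            m≤N h out = ≈-refl
∑-subsets-restrict (suc n) {N = N} z≤n h out =
  ≈-trans (∑-cong (subsets (suc n) N) λ A → out A (¬⊂[0] A)) (∑-zero (subsets (suc n) N))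
∑-subsets-restrict (suc n) (s≤s {m} {N} m≤N) h out = begin-equality
  ∑ (subsets (suc n) (suc N)) h
    ≈⟨ ∑-subsets-suc n N h ⟩
  ∑ (subsets n N) (h ∘ 0∪_+1) + ∑ (subsets (suc n) N) (h ∘ _+1)
    ≈⟨ +-cong (∑-subsets-restrict n m≤N (h ∘ 0∪_+1) λ A ¬A⊂ → out 0∪ A +1 (¬A⊂ ∘ 0∪-⊂⁻ A))
              (∑-subsets-restrict (suc n) m≤N (h ∘ _+1) λ A ¬A⊂ → out (A +1) (¬A⊂ ∘ +1-⊂⁻ A)) ⟩
  ∑ (subsets n m) (h ∘ 0∪_+1) + ∑ (subsets (suc n) m) (h ∘ _+1)
    ≈⟨ ∑-subsets-suc n m h ⟨
  ∑ (subsets (suc n) (suc m)) h ∎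
  where open ≤-Reasoning

χ : ∀ {n} → ℕ⁽ n ⁾ → ℕ⁽ n ⁾ → ℝ
χ B A = if does (≡-dec ℕₚ._≟_ (elements A) (elements B)) then 1ℝ else 0ℝ

χ-sym : ∀ {n} (A B : ℕ⁽ n ⁾) → χ A B ≡ χ B A
χ-sym A B with ≡-dec ℕₚ._≟_ (elements A) (elements B) | ≡-dec ℕₚ._≟_ (elements B) (elements A)
... | yes _ | yes _ = refl
... | no _  | no _  = refl
... | yes p | no ¬p = ⊥-elim (¬p (sym p))
... | no ¬p | yes p = ⊥-elim (¬p (sym p))

does-≡-dec-map-suc : ∀ {n} (xs ys : Vec ℕ n) →
  does (≡-dec ℕₚ._≟_ (Vec.map suc xs) (Vec.map suc ys)) ≡ does (≡-dec ℕₚ._≟_ xs ys)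
does-≡-dec-map-suc []       []       = refl
does-≡-dec-map-suc (x ∷ xs) (y ∷ ys) = cong (does (x ℕₚ.≟ y) ∧_) (does-≡-dec-map-suc xs ys)

χ-+1 : ∀ {n} (A B : ℕ⁽ n ⁾) → χ (B +1) (A +1) ≡ χ B A
χ-+1 A B = cong (if_then 1ℝ else 0ℝ) (does-≡-dec-map-suc (elements A) (elements B))

χ-0∪ : ∀ {n} (A B : ℕ⁽ n ⁾) → χ 0∪ B +1 0∪ A +1 ≡ χ B A
χ-0∪ A B = cong (if_then 1ℝ else 0ℝ) (does-≡-dec-map-suc (elements A) (elements B))

χ-0∪-+1 : ∀ {n} (A : ℕ⁽ n ⁾) B → χ 0∪ A +1 (B +1) ≡ 0ℝ
χ-0∪-+1 A (mk (_ ∷ _) _) = refl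

χ-+1-0∪ : ∀ {n} (A : ℕ⁽ n ⁾) B → χ (B +1) 0∪ A +1 ≡ 0ℝ
χ-+1-0∪ A (mk (_ ∷ _) _) = refl

χ-nonneg : ∀ {n} (A B : ℕ⁽ n ⁾) → 0ℝ ≤ χ A B
χ-nonneg A B with does (≡-dec ℕₚ._≟_ (elements B) (elements A))
... | true  = 0≤1
... | false = ≤-refl

χ≤1 : ∀ {n} (A B : ℕ⁽ n ⁾) → χ A B ≤ 1ℝ
χ≤1 A B with does (≡-dec ℕₚ._≟_ (elements B) (elements A))
... | true  = ≤-refl
... | false = 0≤1

-- This is the form in which it is used that `subsets n m` lists each `n`-element subset of {0 , ...
-- , m - 1} exactly once.
∑-χ : ∀ n m A (f : ℕ⁽ n ⁾ → ℝ) → A ⊂[ m ] → ∑ (subsets n m) (λ B → χ B A * f B) ≈ f A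
∑-χ zero m (mk [] _) f h = ≈-trans (+-identityʳ _) (*-identityˡ _)
∑-χ (suc n) zero    A f h = ⊥-elim (¬⊂[0] A h)
∑-χ (suc n) (suc m) A f h with view A
... | with-0 B = begin-equality
  ∑ (subsets (suc n) (suc m)) (λ C → χ C 0∪ B +1 * f C)
    ≈⟨ ∑-subsets-suc n m (λ C → χ C 0∪ B +1 * f C) ⟩
  ∑ (subsets n m) (λ C → χ 0∪ C +1 0∪ B +1 * f 0∪ C +1) + ∑ (subsets (suc n) m)
      (λ C → χ (C +1) 0∪ B +1 * f (C +1))
    ≈⟨ +-cong
      (≈-trans (∑-cong (subsets n m) λ C → ≈-reflexive (cong (_* f 0∪ C +1) (χ-0∪ B C)))
          (∑-χ n m B (f ∘ 0∪_+1) (0∪-⊂⁻ B h)))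
      (≈-trans (∑-cong (subsets (suc n) m) λ C →
          ≈-trans (≈-reflexive (cong (_* f (C +1)) (χ-+1-0∪ B C))) (zeroˡ _))
          (∑-zero (subsets (suc n) m))) ⟩
  f 0∪ B +1 + 0ℝ
    ≈⟨ +-identityʳ _ ⟩
  f 0∪ B +1 ∎
  where open ≤-Reasoning
... | without-0 B = begin-equality
  ∑ (subsets (suc n) (suc m)) (λ C → χ C (B +1) * f C)
    ≈⟨ ∑-subsets-suc n m (λ C → χ C (B +1) * f C) ⟩
  ∑ (subsets n m) (λ C → χ 0∪ C +1 (B +1) * f 0∪ C +1) + ∑ (subsets (suc n) m)
      (λ C → χ (C +1) (B +1) * f (C +1))
    ≈⟨ +-cong
      (≈-trans (∑-cong (subsets n m) λ C →
          ≈-trans (≈-reflexive (cong (_* f 0∪ C +1) (χ-0∪-+1 C B))) (zeroˡ _))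
          (∑-zero (subsets n m)))
      (≈-trans (∑-cong (subsets (suc n) m) λ C → ≈-reflexive (cong (_* f (C +1)) (χ-+1 B C)))
          (∑-χ (suc n) m B (f ∘ _+1) (+1-⊂⁻ B h))) ⟩
  0ℝ + f (B +1)
    ≈⟨ +-identityˡ _ ⟩
  f (B +1) ∎
  where open ≤-Reasoning

∑-χ′ : ∀ n m B (f : ℕ⁽ n ⁾ → ℝ) → B ⊂[ m ] → ∑ (subsets n m) (λ A → χ B A * f A) ≈ f B
∑-χ′ n m B f h = ≈-trans (∑-cong (subsets n m) λ A → ≈-reflexive (cong (_* f A) (χ-sym B A)))
    (∑-χ n m B f h)

-- Throwing a particle into a vacancy.

insertθ : ∀ {n} → Vec ℕ n → ℕ → Vec ℕ (suc n)
insertθ xs x = insert (θ xs x) xs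

-- A step from `0∪ A +1` removes 0 and lowers the rest back to `A`, so the result is `A` with its
-- vacancy number `x` filled. Going through `next` makes it agree with the transition probabilities
-- by definition.
throw : ∀ {n} → ℕ⁽ n ⁾ → ℕ → ℕ⁽ suc n ⁾
throw A x = next 0∪ A +1 x

elements-throw : ∀ {n} (A : ℕ⁽ n ⁾) x → elements (throw A x) ≡ insertθ (elements A) x
elements-throw A x = cong (λ xs → insertθ xs x) (map-pred-suc (elements A))

next-+1 : ∀ {n} (A : ℕ⁽ n ⁾) x → next (A +1) x ≡ A
next-+1 (mk []       _) x = refl
next-+1 (mk (_ ∷ xs) _) x = elements-injective (cong (_ ∷_) (map-pred-suc xs))

θ-map-suc : ∀ {n} (xs : Vec ℕ n) x → θ (Vec.map suc xs) (suc x) ≡ suc (θ xs x)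
θ-map-suc []       x = refl
θ-map-suc (a ∷ as) x with x ℕₚ.<? a | suc x ℕₚ.<? suc a
... | yes _ | yes _ = refl
... | no _  | no _  = θ-map-suc as (suc x)
... | yes p | no ¬p = ⊥-elim (¬p (s≤s p))
... | no ¬p | yes p = ⊥-elim (¬p (ℕ.s≤s⁻¹ p))

insert-map-suc : ∀ {n} y (xs : Vec ℕ n) →
    insert (suc y) (Vec.map suc xs) ≡ Vec.map suc (insert y xs)
insert-map-suc y []       = refl
insert-map-suc y (x ∷ xs) with y ℕₚ.<? x | suc y ℕₚ.<? suc x
... | yes _ | yes _ = refl
... | no _  | no _  = cong (suc x ∷_) (insert-map-suc y xs)
... | yes p | no ¬p = ⊥-elim (¬p (s≤s p))
... | no ¬p | yes p = ⊥-elim (¬p (ℕ.s≤s⁻¹ p))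

insertθ-map-suc : ∀ {n} (xs : Vec ℕ n) x →
    insertθ (Vec.map suc xs) (suc x) ≡ Vec.map suc (insertθ xs x)
insertθ-map-suc xs x = trans (cong (λ y → insert y (Vec.map suc xs)) (θ-map-suc xs x))
    (insert-map-suc (θ xs x) xs)

-- The vacancies of `A +1` are 0 and the shifted vacancies of `A`; those of `0∪ A +1` are the
-- shifted ones only. This lemma and the next two express these facts, on which the induction for
-- stationarity rests.
throw-+1-zero : ∀ {n} (A : ℕ⁽ n ⁾) → throw (A +1) 0 ≡ 0∪ A +1
throw-+1-zero A = elements-injective (trans (elements-throw (A +1) 0) (lemma (elements A)))
  where
  lemma : ∀ {n} (xs : Vec ℕ n) → insertθ (Vec.map suc xs) 0 ≡ 0 ∷ Vec.map suc xs
  lemma []       = refl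
  lemma (x ∷ xs) = refl

throw-+1-suc : ∀ {n} (A : ℕ⁽ n ⁾) x → throw (A +1) (suc x) ≡ throw A x +1
throw-+1-suc A x = elements-injective (trans (elements-throw (A +1) (suc x))
  (trans (insertθ-map-suc (elements A) x) (cong (Vec.map suc) (sym (elements-throw A x)))))

throw-0∪ : ∀ {n} (A : ℕ⁽ n ⁾) x → throw 0∪ A +1 x ≡ 0∪ throw A x +1
throw-0∪ A x = elements-injective (trans (elements-throw 0∪ A +1 x)
  (trans (lemma (elements A)) (cong (λ xs → 0 ∷ Vec.map suc xs) (sym (elements-throw A x)))))
  where
  lemma : ∀ {n} (xs : Vec ℕ n) → insertθ (0 ∷ Vec.map suc xs) x ≡ 0 ∷ Vec.map suc (insertθ xs x)
  lemma xs = trans (cong (λ y → insert y (0 ∷ Vec.map suc xs)) (θ-map-suc xs x))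
    (cong (0 ∷_) (insert-map-suc (θ xs x) xs))

-- At most `n` occupied sites can precede the vacancy number `x`.
θ≤ : ∀ {n} (xs : Vec ℕ n) x → θ xs x ℕ.≤ x ℕ.+ n
θ≤ []       x = ℕₚ.m≤m+n x 0
θ≤ {suc n} (a ∷ as) x with x ℕₚ.<? a
... | yes _ = ℕₚ.m≤m+n x (suc n)
... | no _  = subst (θ as (suc x) ℕ.≤_) (sym (ℕₚ.+-suc x n)) (θ≤ as (suc x))

-- The free bound `k` serves two purposes: `k = m` shows that the state space is preserved, and
-- `k = m - 1` that a throw of height 0 confines the set further.
next-⊂ : ∀ {n m k} (A : ℕ⁽ suc n ⁾) x → A ⊂[ m ] → ℕ.pred m ℕ.≤ k → x ℕ.+ n ℕ.< k → next A x ⊂[ k ]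
next-⊂ {n} {m} {k} A x A⊂ m≤k x+n<k = lemma A A⊂
  where
  pred-< : ∀ {y} → y ℕ.< m → ℕ.pred y ℕ.< k
  pred-< {zero}  _   = ℕₚ.≤-<-trans z≤n x+n<k
  pred-< {suc y} y<m = ℕₚ.<-≤-trans (ℕₚ.pred-mono-≤ y<m) m≤k

  lemma : ∀ (A : ℕ⁽ suc n ⁾) → A ⊂[ m ] → next A x ⊂[ k ]
  lemma (mk (suc _ ∷ _) _) h = Allₚ.map⁺ (All.map pred-< h)
  lemma (mk (zero ∷ xs) _) (_ ∷ h) = insert-All
    (ℕₚ.≤-<-trans (θ≤ (Vec.map ℕ.pred xs) x) x+n<k) (Allₚ.map⁺ (All.map pred-< h))

-- Weighted sums over subsets, and the recursion behind stationarity.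

module _ (x : ℝ) where

  -- A sum over subsets n m in which a set B = { b₀ < b₁ < … } carries the
  -- weight x^(∑ B) times a product of factors α, one for each element.
  weightedSum : (α : ℕ → ℕ → ℝ) (n m : ℕ) → (ℕ⁽ n ⁾ → ℝ) → ℝ
  weightedSum α zero    m       f = f ∅
  weightedSum α (suc n) zero    f = 0ℝ
  weightedSum α (suc n) (suc m) f =
    α n m * weightedSum α n m (f ∘ 0∪_+1) + x ^ suc n * weightedSum α (suc n) m (f ∘ _+1)

  module _ (α : ℕ → ℕ → ℝ) where

    weightedSum-cong : ∀ n m {f g} → (∀ A → A ⊂[ m ] → f A ≈ g A) →
        weightedSum α n m f ≈ weightedSum α n m g
    weightedSum-cong zero    m       h = h ∅ []
    weightedSum-cong (suc n) zero    h = ≈-refl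
    weightedSum-cong (suc n) (suc m) h = +-cong
      (*-congˡ (weightedSum-cong n m λ A A⊂ → h 0∪ A +1 (0∪-⊂ A A⊂)))
      (*-congˡ (weightedSum-cong (suc n) m λ A A⊂ → h (A +1) (+1-⊂ A A⊂)))

    weightedSum-zero : ∀ n m → weightedSum α n m (λ _ → 0ℝ) ≈ 0ℝ
    weightedSum-zero zero    m       = ≈-refl
    weightedSum-zero (suc n) zero    = ≈-refl
    weightedSum-zero (suc n) (suc m) = ≈-trans
      (+-cong (*-congˡ (weightedSum-zero n m)) (*-congˡ (weightedSum-zero (suc n) m)))
      (solve 2 (λ a b → a :* con 0ℚ :+ b :* con 0ℚ := con 0ℚ) ≈-refl (α n m) (x ^ suc n))

    weightedSum-+ : ∀ n m f g →
        weightedSum α n m (λ A → f A + g A) ≈ weightedSum α n m f + weightedSum α n m g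
    weightedSum-+ zero    m       f g = ≈-refl
    weightedSum-+ (suc n) zero    f g = ≈-sym (+-identityˡ 0ℝ)
    weightedSum-+ (suc n) (suc m) f g = ≈-trans
      (+-cong (*-congˡ (weightedSum-+ n m _ _)) (*-congˡ (weightedSum-+ (suc n) m _ _)))
      (solve 6 (λ a b s t u v → a :* (s :+ t) :+ b :* (u :+ v) :=
          a :* s :+ b :* u :+ (a :* t :+ b :* v)) ≈-refl
        (α n m) (x ^ suc n) _ _ _ _)

    weightedSum-*ˡ : ∀ n m c f → weightedSum α n m (λ A → c * f A) ≈ c * weightedSum α n m f
    weightedSum-*ˡ zero    m       c f = ≈-refl
    weightedSum-*ˡ (suc n) zero    c f = ≈-sym (zeroʳ c)
    weightedSum-*ˡ (suc n) (suc m) c f = ≈-trans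
      (+-cong (*-congˡ (weightedSum-*ˡ n m c _)) (*-congˡ (weightedSum-*ˡ (suc n) m c _)))
      (solve 5 (λ a b c s t → a :* (c :* s) :+ b :* (c :* t) := c :* (a :* s :+ b :* t)) ≈-refl
        (α n m) (x ^ suc n) c _ _)

    weightedSum-∑ : ∀ n m {I : Set} (is : List I) (f : I → ℕ⁽ n ⁾ → ℝ) →
      weightedSum α n m (λ A → ∑ is (λ i → f i A)) ≈ ∑ is (λ i → weightedSum α n m (f i))
    weightedSum-∑ n m []       f = weightedSum-zero n m
    weightedSum-∑ n m (i ∷ is) f = ≈-trans (weightedSum-+ n m (f i) _)
        (+-congˡ (weightedSum-∑ n m is f))

    weightedSum-empty : ∀ {n m} → m ℕ.< n → ∀ f → weightedSum α n m f ≈ 0ℝ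
    weightedSum-empty {suc n} {zero}  _         f = ≈-refl
    weightedSum-empty {suc n} {suc m} (s≤s m<n) f = ≈-trans
      (+-cong (*-congˡ (weightedSum-empty m<n _))
          (*-congˡ (weightedSum-empty (ℕₚ.m<n⇒m<1+n m<n) _)))
      (solve 2 (λ a b → a :* con 0ℚ :+ b :* con 0ℚ := con 0ℚ) ≈-refl (α n m) (x ^ suc n))

    module _ (0≤x : 0ℝ ≤ x) (0≤α : ∀ n m → 0ℝ ≤ α n m) where

      weightedSum-nonneg : ∀ n m {f} → (∀ A → 0ℝ ≤ f A) → 0ℝ ≤ weightedSum α n m f
      weightedSum-nonneg zero    m       h = h ∅
      weightedSum-nonneg (suc n) zero    h = ≤-refl
      weightedSum-nonneg (suc n) (suc m) h = 0≤x+y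
        (0≤x*y (0≤α n m) (weightedSum-nonneg n m (h ∘ 0∪_+1)))
        (0≤x*y (^-nonneg 0≤x (suc n)) (weightedSum-nonneg (suc n) m (h ∘ _+1)))

      weightedSum-mono-≤ : ∀ {α′} → (∀ n m → α n m ≤ α′ n m) → ∀ n m {f} → (∀ A → 0ℝ ≤ f A) →
                           weightedSum α n m f ≤ weightedSum α′ n m f
      weightedSum-mono-≤ h zero    m       f≥0 = ≤-refl
      weightedSum-mono-≤ h (suc n) zero    f≥0 = ≤-refl
      weightedSum-mono-≤ h (suc n) (suc m) f≥0 = +-mono-≤
        (≤-trans (*-monoˡ-≤ (weightedSum-nonneg n m (f≥0 ∘ 0∪_+1)) (h n m))
          (*-monoʳ-≤ (≤-trans (0≤α n m) (h n m)) (weightedSum-mono-≤ h n m (f≥0 ∘ 0∪_+1))))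
        (*-monoʳ-≤ (^-nonneg 0≤x (suc n)) (weightedSum-mono-≤ h (suc n) m (f≥0 ∘ _+1)))

  -- These are the factors for putting 0 into a set that then has `n + 1` elements below `m + 1`.
  -- The first factor extends the q-Pochhammer symbol from `n` to `n + 1`; in the second, `m ∸ n` is
  -- the number of vacancies above 0.
  α∞ αₘ : ℕ → ℕ → ℝ
  α∞ n m = 1ℝ - x ^ suc n
  αₘ n m = (1ℝ - x ^ suc n) * (1ℝ - x ^ suc (m ℕ.∸ n))

  stationarySum : (n m : ℕ) → (ℕ⁽ n ⁾ → ℝ) → ℝ
  stationarySum = weightedSum αₘ

  throwSum : ∀ {n} → ℕ → (ℕ⁽ suc n ⁾ → ℝ) → ℕ⁽ n ⁾ → ℝ
  throwSum ℓ f C = ∑ (upTo ℓ) λ i → x ^ i * f (throw C i)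

  throwSum-0∪ : ∀ {n} ℓ (f : ℕ⁽ suc (suc n) ⁾ → ℝ) C →
      throwSum ℓ f 0∪ C +1 ≈ throwSum ℓ (f ∘ 0∪_+1) C
  throwSum-0∪ ℓ f C = ∑-cong (upTo ℓ) λ i → *-congˡ (≈-reflexive (cong f (throw-0∪ C i)))

  throwSum-+1 : ∀ {n} ℓ (f : ℕ⁽ suc n ⁾ → ℝ) C →
      throwSum (suc ℓ) f (C +1) ≈ f 0∪ C +1 + x * throwSum ℓ (f ∘ _+1) C
  throwSum-+1 ℓ f C = begin-equality
    throwSum (suc ℓ) f (C +1)
      ≡⟨ ∑-upTo-suc ℓ (λ i → x ^ i * f (throw (C +1) i)) ⟩
    1ℝ * f (throw (C +1) 0) + ∑ (upTo ℓ) (λ i → x * x ^ i * f (throw (C +1) (suc i)))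
      ≈⟨ +-cong (≈-trans (*-identityˡ _) (≈-reflexive (cong f (throw-+1-zero C))))
           (∑-cong (upTo ℓ) λ i →
               ≈-trans (*-assoc x (x ^ i) _)
               (*-congˡ (*-congˡ (≈-reflexive (cong f (throw-+1-suc C i)))))) ⟩
    f 0∪ C +1 + ∑ (upTo ℓ) (λ i → x * (x ^ i * f (throw C i +1)))
      ≈⟨ +-congˡ (∑-*ˡ (upTo ℓ) x _) ⟩
    f 0∪ C +1 + x * throwSum ℓ (f ∘ _+1) C ∎
    where open ≤-Reasoning

  -- The right-hand side performs one step of the process: a set without 0 moves down, and a set
  -- with 0 throws. Unfolding the left-hand side splits the set after the step instead. In the
  -- inductive step the hypothesis is applied to both halves of the left-hand side, the throw rules
  -- to the right-hand side, and what remains is a polynomial identity in a few sums over subsets of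
  -- {0 , ... , m - 1}.
  stationarySum-suc : ∀ n m f → stationarySum (suc n) (suc m) f ≈
    x ^ suc n * stationarySum (suc n) m f +
    (1ℝ - x) * (1ℝ - x ^ suc n) * stationarySum n m (throwSum (levels m n) f)
  stationarySum-suc zero zero f = solve 2 (λ x a →
    (con 1ℚ :- x :* con 1ℚ) :* (con 1ℚ :- x :* con 1ℚ) :* a :+ x :* con 1ℚ :* con 0ℚ :=
    x :* con 1ℚ :* con 0ℚ :+ (con 1ℚ :- x) :* (con 1ℚ :- x :* con 1ℚ) :* (con 1ℚ :* a :+ con 0ℚ))
        ≈-refl x (f (initial 1))
  stationarySum-suc zero (suc m) f = begin-equality
    (1ℝ - x ^ 1) * (1ℝ - x ^ suc (suc m)) * f (initial 1) + x ^ 1 * stationarySum 1 (suc m)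
        (f ∘ _+1)
      ≈⟨ +-congˡ (*-congˡ (stationarySum-suc zero m (f ∘ _+1))) ⟩
    (1ℝ - x ^ 1) * (1ℝ - x ^ suc (suc m)) * f (initial 1) + x ^ 1 *
        (x ^ 1 * v + (1ℝ - x) * (1ℝ - x ^ 1) * w)
      ≈⟨ solve 5 (λ x p a v w →
           (con 1ℚ :- x :* con 1ℚ) :* (con 1ℚ :- x :* p) :* a :+ x :* con 1ℚ :*
               (x :* con 1ℚ :* v :+ (con 1ℚ :- x) :* (con 1ℚ :- x :* con 1ℚ) :* w) :=
           x :* con 1ℚ :* ((con 1ℚ :- x :* con 1ℚ) :* (con 1ℚ :- p) :* a :+ x :* con 1ℚ :* v) :+
           (con 1ℚ :- x) :* (con 1ℚ :- x :* con 1ℚ) :* (a :+ x :* w)) ≈-refl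
           x (x ^ suc m) (f (initial 1)) v w ⟩
    x ^ 1 * ((1ℝ - x ^ 1) * (1ℝ - x ^ suc m) * f (initial 1) + x ^ 1 * v) + (1ℝ - x) *
        (1ℝ - x ^ 1) * (f (initial 1) + x * w)
      ≈⟨ +-congˡ (*-congˡ (throwSum-+1 (suc m) f ∅)) ⟨
    x ^ 1 * ((1ℝ - x ^ 1) * (1ℝ - x ^ suc m) * f (initial 1) + x ^ 1 * v) + (1ℝ - x) *
        (1ℝ - x ^ 1) * throwSum (suc (suc m)) f ∅ ∎
    where
    open ≤-Reasoning
    v = stationarySum 1 m (f ∘ _+1)
    w = throwSum (suc m) (f ∘ _+1) ∅
  stationarySum-suc (suc n) zero f = solve 4 (λ a b c d →
    a :* con 0ℚ :+ b :* con 0ℚ := b :* con 0ℚ :+ c :* d :* con 0ℚ) ≈-refl _ _ _ _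
  stationarySum-suc (suc n) (suc m) f = begin-equality
    (1ℝ - x * N) * (1ℝ - x * x ^ L) * stationarySum (suc n) (suc m) f₀ + x * N * stationarySum
        (suc (suc n)) (suc m) f₁
      ≈⟨ +-cong (*-congˡ (stationarySum-suc n m f₀)) (*-congˡ (stationarySum-suc (suc n) m f₁)) ⟩
    (1ℝ - x * N) * (1ℝ - x * x ^ L) * (N * u + (1ℝ - x) * (1ℝ - N) * t) + x * N *
        (x * N * v + (1ℝ - x) * (1ℝ - x * N) * w)
      ≈⟨ combine (ℕₚ.<-≤-connex n m) ⟩
    x * N * ((1ℝ - x * N) * (1ℝ - x * x ^ L′) * u + x * N * v) + (1ℝ - x) * (1ℝ - x * N) *
        ((1ℝ - N) * (1ℝ - x * x ^ L) * t + N * (u + x * w′))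
      ≈⟨ +-congˡ (*-congˡ (+-cong
          (*-congˡ (weightedSum-cong αₘ n m λ C _ → throwSum-0∪ (suc L) f C))
           (*-congˡ (≈-trans (weightedSum-cong αₘ (suc n) m λ C _ → throwSum-+1 L f C)
             (≈-trans (weightedSum-+ αₘ (suc n) m f₀ _)
                 (+-congˡ (weightedSum-*ˡ αₘ (suc n) m x _))))))) ⟨
    x * N * stationarySum (suc (suc n)) (suc m) f + (1ℝ - x) * (1ℝ - x * N) * stationarySum (suc n)
        (suc m) (throwSum (suc L) f) ∎
    where
    open ≤-Reasoning
    N  = x ^ suc n
    L  = m ℕ.∸ n
    L′ = m ℕ.∸ suc n
    f₀ = f ∘ 0∪_+1
    f₁ = f ∘ _+1
    u  = stationarySum (suc n) m f₀
    v  = stationarySum (suc (suc n)) m f₁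
    t  = stationarySum n m (throwSum (suc L) f₀)
    w  = stationarySum (suc n) m (throwSum (suc L′) f₁)
    w′ = stationarySum (suc n) m (throwSum L f₁)

    -- If m ≤ n, then L and L′ are truncated, but the sums u, w and w′ are empty.
    combine : (n ℕ.< m) ⊎ (m ℕ.≤ n) →
      (1ℝ - x * N) * (1ℝ - x * x ^ L) * (N * u + (1ℝ - x) * (1ℝ - N) * t) + x * N *
          (x * N * v + (1ℝ - x) * (1ℝ - x * N) * w) ≈
      x * N * ((1ℝ - x * N) * (1ℝ - x * x ^ L′) * u + x * N * v) + (1ℝ - x) * (1ℝ - x * N) *
          ((1ℝ - N) * (1ℝ - x * x ^ L) * t + N * (u + x * w′))
    combine (inj₁ n<m) = ≈-trans
      (+-congʳ (*-congʳ (*-congˡ (+-congˡ (-‿cong (*-congˡ xᴸ))))))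
      (≈-trans
        (solve 7 (λ x N p u t v w →
          (con 1ℚ :- x :* N) :* (con 1ℚ :- x :* (x :* p)) :*
              (N :* u :+ (con 1ℚ :- x) :* (con 1ℚ :- N) :* t) :+ x :* N :*
              (x :* N :* v :+ (con 1ℚ :- x) :* (con 1ℚ :- x :* N) :* w) :=
          x :* N :* ((con 1ℚ :- x :* N) :* (con 1ℚ :- x :* p) :* u :+ x :* N :* v) :+
              (con 1ℚ :- x) :* (con 1ℚ :- x :* N) :*
              ((con 1ℚ :- N) :* (con 1ℚ :- x :* (x :* p)) :* t :+ N :* (u :+ x :* w))) ≈-refl
          x N (x ^ L′) u t v w)
        (+-congˡ (*-congˡ (+-cong (*-congʳ (*-congˡ (+-congˡ (-‿cong (*-congˡ (≈-sym xᴸ))))))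
          (*-congˡ (+-congˡ (*-congˡ
              (≈-reflexive (cong (λ l → stationarySum (suc n) m (throwSum l f₁)) (sym L≡))))))))))
      where
      L≡ : L ≡ suc L′
      L≡ = ℕₚ.+-∸-assoc 1 n<m
      xᴸ : x ^ L ≈ x * x ^ L′
      xᴸ = ≈-reflexive (cong (x ^_) L≡)
    combine (inj₂ m≤n) = ≈-trans
      (+-cong (*-congˡ (+-congʳ (*-congˡ (vanish f₀)))) (*-congˡ (+-congˡ (*-congˡ (vanish _)))))
      (≈-trans
        (solve 6 (λ x N p p′ t v →
          (con 1ℚ :- x :* N) :* (con 1ℚ :- x :* p) :*
              (N :* con 0ℚ :+ (con 1ℚ :- x) :* (con 1ℚ :- N) :* t) :+ x :* N :*
              (x :* N :* v :+ (con 1ℚ :- x) :* (con 1ℚ :- x :* N) :* con 0ℚ) :=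
          x :* N :* ((con 1ℚ :- x :* N) :* (con 1ℚ :- x :* p′) :* con 0ℚ :+ x :* N :* v) :+
              (con 1ℚ :- x) :* (con 1ℚ :- x :* N) :*
              ((con 1ℚ :- N) :* (con 1ℚ :- x :* p) :* t :+ N :* (con 0ℚ :+ x :* con 0ℚ))) ≈-refl
          x N (x ^ L) (x ^ L′) t v)
        (≈-sym (+-cong (*-congˡ (+-congʳ (*-congˡ (vanish f₀))))
            (*-congˡ (+-congˡ (*-congˡ (+-cong (vanish f₀) (*-congˡ (vanish _)))))))))
      where
      vanish : ∀ g → stationarySum (suc n) m g ≈ 0ℝ
      vanish = weightedSum-empty αₘ (s≤s m≤n)

-- The total masses of the two weights.

module _ (x : ℝ) (0≤x : 0ℝ ≤ x) (x≤1 : x ≤ 1ℝ) where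

  0≤1-x^ : ∀ n → 0ℝ ≤ 1ℝ - x ^ n
  0≤1-x^ n = 0≤y-x (^-≤1 0≤x x≤1 n)

  0≤αₘ : ∀ n m → 0ℝ ≤ αₘ x n m
  0≤αₘ n m = 0≤x*y (0≤1-x^ (suc n)) (0≤1-x^ (suc (m ℕ.∸ n)))

  αₘ≤α∞ : ∀ n m → αₘ x n m ≤ α∞ x n m
  αₘ≤α∞ n m = x*y≤x (0≤1-x^ (suc n)) (x-y≤x (^-nonneg 0≤x (suc (m ℕ.∸ n))))

  weightedMass : (α : ℕ → ℕ → ℝ) → ℕ → ℕ → ℝ
  weightedMass α n m = weightedSum x α n m (λ _ → 1ℝ)

  mass∞ massₘ : ℕ → ℕ → ℝ
  mass∞ = weightedMass (α∞ x)
  massₘ = weightedMass (αₘ x)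

  massₘ≤mass∞ : ∀ n m → massₘ n m ≤ mass∞ n m
  massₘ≤mass∞ n m = weightedSum-mono-≤ x (αₘ x) 0≤x 0≤αₘ αₘ≤α∞ n m λ _ → 0≤1

  mass∞≤1 : ∀ n m → mass∞ n m ≤ 1ℝ
  mass∞≤1 zero    m       = ≤-refl
  mass∞≤1 (suc n) zero    = 0≤1
  mass∞≤1 (suc n) (suc m) = begin
    (1ℝ - x ^ suc n) * mass∞ n m + x ^ suc n * mass∞ (suc n) m
      ≤⟨ +-mono-≤ (x*y≤x (0≤1-x^ (suc n)) (mass∞≤1 n m))
          (x*y≤x (^-nonneg 0≤x (suc n)) (mass∞≤1 (suc n) m)) ⟩
    1ℝ - x ^ suc n + x ^ suc n
      ≈⟨ solve 1 (λ p → con 1ℚ :- p :+ p := con 1ℚ) ≈-refl (x ^ suc n) ⟩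
    1ℝ ∎
    where open ≤-Reasoning

  massₘ≤1 : ∀ n m → massₘ n m ≤ 1ℝ
  massₘ≤1 n m = ≤-trans (massₘ≤mass∞ n m) (mass∞≤1 n m)

  1-mass-empty : ∀ α n → 1ℝ - weightedMass α (suc n) n ≤ 1ℝ
  1-mass-empty α n = x-y≤x (≈⇒≤ (≈-sym (weightedSum-empty x α (ℕₚ.n<1+n n) (λ _ → 1ℝ))))

  -- A tail estimate for `π∞`, as `mass∞ n N` is its mass on the subsets of {0 , ... , N - 1}. The
  -- deficits obey the same convex recursion as the masses, and the bound is passed on because
  -- `(1 + n (1 - x)) x ^ n ≤ 1`.
  1-mass∞-bound : ∀ n k → 1ℝ - mass∞ n (k ℕ.+ n) ≤ fromℕ n * x ^ suc k
  1-mass∞-bound zero    k = ≈⇒≤ (solve 1 (λ p → con 1ℚ :- con 1ℚ := con 0ℚ :* p) ≈-refl (x ^ suc k))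
  1-mass∞-bound (suc n) k = subst (λ m → 1ℝ - mass∞ (suc n) m ≤ fromℕ (suc n) * x ^ suc k)
      (sym (ℕₚ.+-suc k n)) (begin
    1ℝ - ((1ℝ - x * N) * mass∞ n (k ℕ.+ n) + x * N * mass∞ (suc n) (k ℕ.+ n))
      ≈⟨ solve 4 (λ x N a b → con 1ℚ :- ((con 1ℚ :- x :* N) :* a :+ x :* N :* b) :=
           (con 1ℚ :- x :* N) :* (con 1ℚ :- a) :+ x :* N :* (con 1ℚ :- b)) ≈-refl x N _ _ ⟩
    (1ℝ - x * N) * (1ℝ - mass∞ n (k ℕ.+ n)) + x * N * (1ℝ - mass∞ (suc n) (k ℕ.+ n))
      ≤⟨ +-mono-≤ (*-monoʳ-≤ (0≤1-x^ (suc n)) (1-mass∞-bound n k))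
          (*-monoʳ-≤ (^-nonneg 0≤x (suc n)) (previous k)) ⟩
    (1ℝ - x * N) * (c * (x * p)) + x * N * (fromℕ (suc n) * p)
      ≈⟨ +-congˡ (*-congˡ (*-congʳ (fromℕ-suc n))) ⟩
    (1ℝ - x * N) * (c * (x * p)) + x * N * ((1ℝ + c) * p)
      ≈⟨ solve 4 (λ x N c p → (con 1ℚ :- x :* N) :* (c :* (x :* p)) :+ x :* N :*
          ((con 1ℚ :+ c) :* p) :=
           x :* p :* c :+ x :* p :* ((con 1ℚ :+ c :* (con 1ℚ :- x)) :* N)) ≈-refl x N c p ⟩
    x * p * c + x * p * ((1ℝ + c * (1ℝ - x)) * N)
      ≤⟨ +-monoʳ-≤ _ (x*y≤x (^-nonneg 0≤x (suc k)) (bernoulli 0≤x (0≤y-x x≤1)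
           (≈⇒≤ (solve 1 (λ x → x :+ (con 1ℚ :- x) := con 1ℚ) ≈-refl x)) n)) ⟩
    x * p * c + x * p
      ≈⟨ solve 2 (λ c p → p :* c :+ p := (con 1ℚ :+ c) :* p) ≈-refl c (x * p) ⟩
    (1ℝ + c) * (x * p)
      ≈⟨ *-congʳ (fromℕ-suc n) ⟨
    fromℕ (suc n) * (x * p) ∎)
    where
    open ≤-Reasoning
    N = x ^ n
    c = fromℕ n
    p = x ^ k
    previous : ∀ k → 1ℝ - mass∞ (suc n) (k ℕ.+ n) ≤ fromℕ (suc n) * x ^ k
    -- There is no set of `n + 1` elements below `n`, so the deficit is the full mass 1.
    previous zero    = ≤-trans (1-mass-empty (α∞ x) n)
        (≤-trans (1≤fromℕ[1+n] n) (≈⇒≤ (≈-sym (*-identityʳ _))))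
    previous (suc k) = subst (λ m → 1ℝ - mass∞ (suc n) m ≤ fromℕ (suc n) * x ^ suc k) (ℕₚ.+-suc k n)
        (1-mass∞-bound (suc n) k)

  geometricSum : ℕ → ℝ
  geometricSum n = ∑ (upTo n) (x ^_)

  [1-x]*geometricSum : ∀ n → (1ℝ - x) * geometricSum n ≈ 1ℝ - x ^ n
  [1-x]*geometricSum zero    = solve 1 (λ x → (con 1ℚ :- x) :* con 0ℚ := con 1ℚ :- con 1ℚ) ≈-refl x
  [1-x]*geometricSum (suc n) = begin-equality
    (1ℝ - x) * geometricSum (suc n)          ≈⟨ *-congˡ (∑-upTo-last n (x ^_)) ⟩
    (1ℝ - x) * (geometricSum n + x ^ n)      ≈⟨ distribˡ _ _ _ ⟩
    (1ℝ - x) * geometricSum n + (1ℝ - x) * x ^ n ≈⟨ +-congʳ ([1-x]*geometricSum n) ⟩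
    1ℝ - x ^ n + (1ℝ - x) * x ^ n            ≈⟨ solve 2
        (λ x p → con 1ℚ :- p :+ (con 1ℚ :- x) :* p := con 1ℚ :- x :* p) ≈-refl x (x ^ n) ⟩
    1ℝ - x * x ^ n                           ∎
    where open ≤-Reasoning

  0≤geometricSum : ∀ n → 0ℝ ≤ geometricSum n
  0≤geometricSum n = ∑-nonneg (upTo n) (^-nonneg 0≤x)

  geometricSum≤n : ∀ n → geometricSum n ≤ fromℕ n
  geometricSum≤n zero    = ≤-refl
  geometricSum≤n (suc n) = begin
    geometricSum (suc n)     ≈⟨ ∑-upTo-last n (x ^_) ⟩
    geometricSum n + x ^ n   ≤⟨ +-mono-≤ (geometricSum≤n n) (^-≤1 0≤x x≤1 n) ⟩
    fromℕ n + 1ℝ             ≈⟨ +-comm _ _ ⟩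
    1ℝ + fromℕ n             ≈⟨ fromℕ-suc n ⟨
    fromℕ (suc n)            ∎
    where open ≤-Reasoning

  -- The exact solution of the recursion for 1 - massₘ, linearised by dropping
  -- the term which is quadratic in the deficit.
  deficit : ℕ → ℕ → ℝ
  deficit ℓ n = (1ℝ - x ^ n) * fromℕ (ℓ ℕ.+ n) + geometricSum n

  0≤deficit : ∀ ℓ n → 0ℝ ≤ deficit ℓ n
  0≤deficit ℓ n = 0≤x+y (0≤x*y (0≤1-x^ n) (0≤fromℕ (ℓ ℕ.+ n))) (0≤geometricSum n)

  deficit-suc : ∀ ℓ n → deficit (suc ℓ) (suc n) ≈
    (1ℝ - x ^ suc n) * (deficit (suc ℓ) n + 1ℝ) + x ^ n * deficit ℓ (suc n)
  deficit-suc ℓ n = begin-equality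
    (1ℝ - x * N) * fromℕ (suc ℓ ℕ.+ suc n) + geometricSum (suc n)
      ≈⟨ +-cong (*-congˡ (≈-trans (fromℕ-suc (ℓ ℕ.+ suc n)) (+-congˡ c-suc)))
          (∑-upTo-last n (x ^_)) ⟩
    (1ℝ - x * N) * (1ℝ + (1ℝ + c)) + (g + N)
      ≈⟨ solve 4 (λ x N c g → (con 1ℚ :- x :* N) :* (con 1ℚ :+ (con 1ℚ :+ c)) :+ (g :+ N) :=
           (con 1ℚ :- x :* N) :* ((con 1ℚ :- N) :* (con 1ℚ :+ c) :+ g :+ con 1ℚ) :+ N :*
               ((con 1ℚ :- x :* N) :* (con 1ℚ :+ c) :+ (g :+ N)) :+
           N :* ((con 1ℚ :- N) :- (con 1ℚ :- x) :* g)) ≈-refl x N c g ⟩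
    (1ℝ - x * N) * ((1ℝ - N) * (1ℝ + c) + g + 1ℝ) + N * ((1ℝ - x * N) * (1ℝ + c) + (g + N)) +
      N * ((1ℝ - N) - (1ℝ - x) * g)
      ≈⟨ ≈-trans (+-congˡ (≈-trans
          (*-congˡ (≈-trans (+-congˡ (-‿cong ([1-x]*geometricSum n))) (-‿inverseʳ _))) (zeroʳ N)))
          (+-identityʳ _) ⟩
    (1ℝ - x * N) * ((1ℝ - N) * (1ℝ + c) + g + 1ℝ) + N * ((1ℝ - x * N) * (1ℝ + c) + (g + N))
      ≈⟨ +-cong (*-congˡ (+-congʳ (+-congʳ (*-congˡ (fromℕ-suc (ℓ ℕ.+ n))))))
           (*-congˡ (+-cong (*-congˡ c-suc) (∑-upTo-last n (x ^_)))) ⟨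
    (1ℝ - x * N) * (deficit (suc ℓ) n + 1ℝ) + N * deficit ℓ (suc n) ∎
    where
    open ≤-Reasoning
    N = x ^ n
    c = fromℕ (ℓ ℕ.+ n)
    g = geometricSum n
    c-suc : fromℕ (ℓ ℕ.+ suc n) ≈ 1ℝ + c
    c-suc = ≈-trans (≈-reflexive (cong fromℕ (ℕₚ.+-suc ℓ n))) (fromℕ-suc (ℓ ℕ.+ n))

  1-massₘ-deficit : ∀ n k → 1ℝ - massₘ n (k ℕ.+ n) ≤ x ^ suc k * deficit (suc k) n
  1-massₘ-deficit zero    k = ≤-trans (≈⇒≤ (-‿inverseʳ 1ℝ))
      (0≤x*y (^-nonneg 0≤x (suc k)) (0≤deficit (suc k) 0))
  1-massₘ-deficit (suc n) k = subst
      (λ m → 1ℝ - massₘ (suc n) m ≤ x ^ suc k * deficit (suc k) (suc n)) (sym (ℕₚ.+-suc k n)) (begin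
    1ℝ - ((1ℝ - x * N) * (1ℝ - x ^ suc (k ℕ.+ n ℕ.∸ n)) * z + x * N * z′)
      ≡⟨ cong (λ l → 1ℝ - ((1ℝ - x * N) * (1ℝ - x ^ suc l) * z + x * N * z′)) (ℕₚ.m+n∸n≡m k n) ⟩
    1ℝ - ((1ℝ - x * N) * (1ℝ - x * p) * z + x * N * z′)
      ≈⟨ solve 5 (λ x N p z z′ →
          con 1ℚ :- ((con 1ℚ :- x :* N) :* (con 1ℚ :- x :* p) :* z :+ x :* N :* z′) :=
           (con 1ℚ :- x :* N) :* (con 1ℚ :- z :+ x :* p :* z) :+ x :* N :* (con 1ℚ :- z′))
               ≈-refl x N p z z′ ⟩
    (1ℝ - x * N) * (1ℝ - z + x * p * z) + x * N * (1ℝ - z′)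
      -- Replacing `z` by 1 in `x * p * z` discards the quadratic term `x * p * (1 - z)` and leaves
      -- the linear recursion solved by `deficit`.
      ≤⟨ +-mono-≤ (*-monoʳ-≤ (0≤1-x^ (suc n))
          (+-mono-≤ (1-massₘ-deficit n k) (x*y≤x (^-nonneg 0≤x (suc k)) (massₘ≤1 n (k ℕ.+ n)))))
           (*-monoʳ-≤ (^-nonneg 0≤x (suc n)) (previous k)) ⟩
    (1ℝ - x * N) * (x * p * deficit (suc k) n + x * p) + x * N * (p * deficit k (suc n))
      ≈⟨ solve 5 (λ x N p d d′ → (con 1ℚ :- x :* N) :* (x :* p :* d :+ x :* p) :+ x :* N :*
          (p :* d′) :=
           x :* p :* ((con 1ℚ :- x :* N) :* (d :+ con 1ℚ) :+ N :* d′)) ≈-refl x N p _ _ ⟩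
    x * p * ((1ℝ - x * N) * (deficit (suc k) n + 1ℝ) + N * deficit k (suc n))
      ≈⟨ *-congˡ (deficit-suc k n) ⟨
    x * p * deficit (suc k) (suc n) ∎)
    where
    open ≤-Reasoning
    N = x ^ n
    p = x ^ k
    z  = massₘ n (k ℕ.+ n)
    z′ = massₘ (suc n) (k ℕ.+ n)

    1≤deficit : 1ℝ ≤ deficit 0 (suc n)
    1≤deficit = begin
      1ℝ                                           ≤⟨ x≤x+y
          (∑-nonneg (upTo n) (λ i → ^-nonneg 0≤x (suc i))) ⟩
      1ℝ + ∑ (upTo n) (λ i → x ^ suc i)            ≡⟨ ∑-upTo-suc n (x ^_) ⟨
      geometricSum (suc n)                         ≤⟨ y≤x+y
          (0≤x*y (0≤1-x^ (suc n)) (0≤fromℕ (suc n))) ⟩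
      deficit 0 (suc n)                            ∎

    previous : ∀ k → 1ℝ - massₘ (suc n) (k ℕ.+ n) ≤ x ^ k * deficit k (suc n)
    previous zero    = ≤-trans (1-mass-empty (αₘ x) n)
        (≤-trans 1≤deficit (≈⇒≤ (≈-sym (*-identityˡ _))))
    previous (suc k) = subst (λ m → 1ℝ - massₘ (suc n) m ≤ x ^ suc k * deficit (suc k) (suc n))
        (ℕₚ.+-suc k n) (1-massₘ-deficit (suc n) k)

  -- The 3 collects `m + 1 ≤ 2 m`, where `m ≥ 1` enters, and `geometricSum n ≤ n ≤ m`.
  1-massₘ-bound : ∀ {n m} → 1 ℕ.≤ n → n ℕ.≤ m →
      1ℝ - massₘ n m ≤ fromℕ 3 * (fromℕ m * x ^ levels m n)
  1-massₘ-bound {n} {m} 1≤n n≤m = begin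
    1ℝ - massₘ n m
      ≡⟨ cong (λ m → 1ℝ - massₘ n m) (ℕₚ.m∸n+n≡m n≤m) ⟨
    1ℝ - massₘ n (m ℕ.∸ n ℕ.+ n)
      ≤⟨ 1-massₘ-deficit n (m ℕ.∸ n) ⟩
    p * ((1ℝ - x ^ n) * fromℕ (suc (m ℕ.∸ n ℕ.+ n)) + geometricSum n)
      ≤⟨ *-monoʳ-≤ 0≤p (+-mono-≤
          (≤-trans (*-monoˡ-≤ (0≤fromℕ (suc (m ℕ.∸ n ℕ.+ n))) (x-y≤x (^-nonneg 0≤x n)))
          (≈⇒≤ (*-identityˡ _))) (geometricSum≤n n)) ⟩
    p * (fromℕ (suc (m ℕ.∸ n ℕ.+ n)) + fromℕ n)
      ≡⟨ cong (λ i → p * (fromℕ (suc i) + fromℕ n)) (ℕₚ.m∸n+n≡m n≤m) ⟩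
    p * (fromℕ (suc m) + fromℕ n)
      ≤⟨ *-monoʳ-≤ 0≤p (+-mono-≤
          (≤-trans (≈⇒≤ (fromℕ-suc m)) (+-monoˡ-≤ _ (fromℕ-mono-≤ (ℕₚ.≤-trans 1≤n n≤m))))
          (fromℕ-mono-≤ n≤m)) ⟩
    p * (fromℕ m + fromℕ m + fromℕ m)
      ≈⟨ solve 2 (λ p c → p :* (c :+ c :+ c) := con (ℤ.+ 3 ℚ./ 1) :* (c :* p)) ≈-refl p (fromℕ m) ⟩
    fromℕ 3 * (fromℕ m * p) ∎
    where
    open ≤-Reasoning
    p = x ^ levels m n
    0≤p = ^-nonneg 0≤x (levels m n)

-- The unbounded stationary distribution as a weighted sum.

∏-shift : ∀ x {n} (xs : Vec ℕ n) →
          ∏ (Vec.toList (Vec.map suc xs)) (x ^_) ≈ x ^ n * ∏ (Vec.toList xs) (x ^_)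
∏-shift x []               = ≈-sym (*-identityˡ 1ℝ)
∏-shift x {suc n} (b ∷ bs) = ≈-trans (*-congˡ (∏-shift x bs))
  (solve 4 (λ x p a s → x :* p :* (a :* s) := x :* a :* (p :* s))
      ≈-refl x (x ^ b) (x ^ n) (∏ (Vec.toList bs) (x ^_)))

∏-∷ʳ : ∀ {A : Set} (xs : List A) a f → ∏ (xs List.∷ʳ a) f ≈ ∏ xs f * f a
∏-∷ʳ []       a f = *-comm (f a) 1ℝ
∏-∷ʳ (x ∷ xs) a f = ≈-trans (*-congˡ (∏-∷ʳ xs a f)) (≈-sym (*-assoc (f x) (∏ xs f) (f a)))

inv-* : ∀ a b c (0<b : 0ℝ < b) (0<c : 0ℝ < c) → c ≈ a * b → inv c 0<c * a ≈ inv b 0<b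
inv-* a b c 0<b 0<c c≈ab = x*z≈y*z⇒x≈y 0<b (begin-equality
  inv c 0<c * a * b     ≈⟨ *-assoc _ a b ⟩
  inv c 0<c * (a * b)   ≈⟨ *-congˡ c≈ab ⟨
  inv c 0<c * c         ≈⟨ ≈-trans (*-comm _ c) (inv-inverse c 0<c) ⟩
  1ℝ                    ≈⟨ ≈-trans (*-comm _ b) (inv-inverse b 0<b) ⟨
  inv b 0<b * b         ∎)
  where open ≤-Reasoning

module _ (q : OpenUnitInterval) where

  private
    x = value q

  π∞-+1 : ∀ n (A : ℕ⁽ n ⁾) → π∞ n q (A +1) ≈ x ^ n * π∞ n q A
  π∞-+1 n A = ≈-trans (*-congˡ (∏-shift x (elements A)))
    (solve 3 (λ c p s → c :* (p :* s) := p :* (c :* s)) ≈-refl _ (x ^ n) _)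

  -- Shifting the `n` elements of `A` contributes `x ^ n`, which the growth of the exponent from
  -- `n C 2` to `suc n C 2` in the denominator cancels; only the new factor of the q-Pochhammer
  -- symbol survives.
  π∞-0∪ : ∀ n (A : ℕ⁽ n ⁾) → π∞ (suc n) q 0∪ A +1 ≈ (1ℝ - x ^ suc n) * π∞ n q A
  π∞-0∪ n A = begin-equality
    ∏ (List.map suc (upTo (suc n))) (λ i → 1ℝ - x ^ i) * inv (x ^ (suc n Comb.C 2))
        (0<x^j (0< q) (suc n Comb.C 2)) *
      (1ℝ * ∏ (Vec.toList (Vec.map suc (elements A))) (x ^_))
      ≈⟨ *-cong (*-congʳ (≈-trans (≈-reflexive (cong (λ is → ∏ is (λ i → 1ℝ - x ^ i)) map-suc-upTo))
           (∏-∷ʳ (List.map suc (upTo n)) (suc n) _))) (*-congˡ (∏-shift x (elements A))) ⟩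
    h * (1ℝ - x ^ suc n) * inv (x ^ (suc n Comb.C 2)) (0<x^j (0< q) (suc n Comb.C 2)) *
        (1ℝ * (x ^ n * s))
      ≈⟨ solve 5 (λ h y i p s → h :* y :* i :* (con 1ℚ :* (p :* s)) := y :* (h :* (i :* p) :* s))
          ≈-refl h (1ℝ - x ^ suc n) _ (x ^ n) s ⟩
    (1ℝ - x ^ suc n) * (h *
        (inv (x ^ (suc n Comb.C 2)) (0<x^j (0< q) (suc n Comb.C 2)) * x ^ n) * s)
      ≈⟨ *-congˡ (*-congʳ (*-congˡ (inv-* (x ^ n) (x ^ (n Comb.C 2)) _ (0<x^j (0< q) (n Comb.C 2)) _
           (≈-trans (≈-reflexive (cong (x ^_) [1+n]C2)) (^-+ x n (n Comb.C 2)))))) ⟩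
    (1ℝ - x ^ suc n) * π∞ n q A ∎
    where
    open ≤-Reasoning
    h = ∏ (List.map suc (upTo n)) (λ i → 1ℝ - x ^ i)
    s = ∏ (Vec.toList (elements A)) (x ^_)

    map-suc-upTo : List.map suc (upTo (suc n)) ≡ List.map suc (upTo n) List.∷ʳ suc n
    map-suc-upTo = trans (cong (List.map suc) (sym (Listₚ.upTo-∷ʳ n)))
        (Listₚ.map-++ suc (upTo n) (n ∷ []))

    [1+n]C2 : suc n Comb.C 2 ≡ n ℕ.+ n Comb.C 2
    [1+n]C2 = trans (sym (Comb.nCk+nC[k+1]≡[n+1]C[k+1] n 1)) (cong (ℕ._+ n Comb.C 2) (Comb.nC1≡n n))

  ∑-π∞ : ∀ n m f → ∑ (subsets n m) (λ A → π∞ n q A * f A) ≈ weightedSum x (α∞ x) n m f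
  ∑-π∞ zero    m       f = ≈-trans (+-identityʳ _) (≈-trans (*-congʳ (≈-trans (*-identityʳ _)
    (≈-trans (*-identityˡ _) (≈-trans (≈-sym (*-identityˡ _)) (inv-inverse _ _))))) (*-identityˡ _))
  ∑-π∞ (suc n) zero    f = ≈-refl
  ∑-π∞ (suc n) (suc m) f = ≈-trans (∑-subsets-suc n m _)
    (+-cong
      (≈-trans (∑-cong (subsets n m) λ A → ≈-trans (*-congʳ (π∞-0∪ n A)) (*-assoc _ _ _))
        (≈-trans (∑-*ˡ (subsets n m) _ _) (*-congˡ (∑-π∞ n m _))))
      (≈-trans (∑-cong (subsets (suc n) m) λ A →
          ≈-trans (*-congʳ (π∞-+1 (suc n) A)) (*-assoc _ _ _))
        (≈-trans (∑-*ˡ (subsets (suc n) m) _ _) (*-congˡ (∑-π∞ (suc n) m _)))))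

-- The invariant measure of the bounded process.

module _ (q : OpenUnitInterval) where

  private
    x = value q
    0≤x = <⇒≤ (0< q)
    x≤1 = <⇒≤ (<1 q)

  -- By linearity the functional is determined by its values at indicators, so these values may
  -- serve as the density of a measure.
  weightedSum-χ : ∀ α n m f →
      ∑ (subsets n m) (λ B → weightedSum x α n m (χ B) * f B) ≈ weightedSum x α n m f
  weightedSum-χ α n m f = begin-equality
    ∑ (subsets n m) (λ B → weightedSum x α n m (χ B) * f B)
      ≈⟨ ∑-cong (subsets n m)
          (λ B → ≈-trans (*-comm _ (f B)) (≈-sym (weightedSum-*ˡ x α n m (f B) (χ B)))) ⟩
    ∑ (subsets n m) (λ B → weightedSum x α n m (λ A → f B * χ B A))
      ≈⟨ weightedSum-∑ x α n m (subsets n m) (λ B A → f B * χ B A) ⟨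
    weightedSum x α n m (λ A → ∑ (subsets n m) (λ B → f B * χ B A))
      ≈⟨ weightedSum-cong x α n m
          (λ A A⊂ → ≈-trans (∑-cong (subsets n m) λ B → *-comm (f B) (χ B A)) (∑-χ n m A f A⊂)) ⟩
    weightedSum x α n m f ∎
    where open ≤-Reasoning

  π∞-as-weightedSum : ∀ n m B → B ⊂[ m ] → π∞ n q B ≈ weightedSum x (α∞ x) n m (χ B)
  π∞-as-weightedSum n m B B⊂ = ≈-trans (≈-sym (∑-χ′ n m B (π∞ n q) B⊂))
    (≈-trans (∑-cong (subsets n m) λ A → *-comm (χ B A) (π∞ n q A)) (∑-π∞ q n m (χ B)))

  module _ (m n : ℕ) (n≤m : n ℕ.≤ m) where

    private
      -- By computation this is also `levels (suc m) (suc n)`, the number of throw heights of the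
      -- process with `suc n` particles.
      ℓ = levels m n
      ξ = truncatedGeometric (suc m) (suc n) q
      0<1-x^ℓ = 0<y-x (x^[1+j]<1 (0< q) (<1 q) (m ℕ.∸ n))
      Ω = subsets (suc n) (suc m)

    expected : (ℕ⁽ suc n ⁾ → ℝ) → ℕ⁽ suc n ⁾ → ℝ
    expected f A = ∑ (upTo ℓ) λ i → ξ i * f (next A i)

    0≤ξ : ∀ i → 0ℝ ≤ ξ i
    0≤ξ i = 0≤x*y (0≤x*y (0≤y-x x≤1) (0≤inv _ 0<1-x^ℓ)) (^-nonneg 0≤x i)

    0<ξ₀ : 0ℝ < ξ 0
    0<ξ₀ = 0<x*y (0<x*y (0<y-x (<1 q)) (0<inv _ 0<1-x^ℓ)) 0<1

    ∑-ξ : ∑ (upTo ℓ) ξ ≈ 1ℝ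
    ∑-ξ = begin-equality
      ∑ (upTo ℓ) ξ
        ≈⟨ ∑-*ˡ (upTo ℓ) _ (x ^_) ⟩
      (1ℝ - x) * inv (1ℝ - x ^ ℓ) 0<1-x^ℓ * geometricSum x 0≤x x≤1 ℓ
        ≈⟨ solve 3 (λ a i g → a :* i :* g := a :* g :* i) ≈-refl (1ℝ - x) _ _ ⟩
      (1ℝ - x) * geometricSum x 0≤x x≤1 ℓ * inv (1ℝ - x ^ ℓ) 0<1-x^ℓ
        ≈⟨ *-congʳ ([1-x]*geometricSum x 0≤x x≤1 ℓ) ⟩
      (1ℝ - x ^ ℓ) * inv (1ℝ - x ^ ℓ) 0<1-x^ℓ
        ≈⟨ inv-inverse _ 0<1-x^ℓ ⟩
      1ℝ ∎
      where open ≤-Reasoning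

    ∑-ξ-const : ∀ c → ∑ (upTo ℓ) (λ i → ξ i * c) ≈ c
    ∑-ξ-const c = ≈-trans (∑-*ʳ (upTo ℓ) c ξ) (≈-trans (*-congʳ ∑-ξ) (*-identityˡ c))

    expected-+1 : ∀ f A → expected f (A +1) ≈ f A
    expected-+1 f A = ≈-trans (∑-cong (upTo ℓ) λ i → *-congˡ (≈-reflexive (cong f (next-+1 A i))))
        (∑-ξ-const (f A))

    -- Multiplying through by `1 - x ^ ℓ` clears the normalisation of the throw; the same factor is
    -- the one by which `αₘ n m` differs from `α∞ n m`.
    expected-0∪ : ∀ f C → (1ℝ - x ^ ℓ) * expected f 0∪ C +1 ≈ (1ℝ - x) * throwSum x ℓ f C
    expected-0∪ f C = ≈-trans (≈-sym (∑-*ˡ (upTo ℓ) _ _))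
        (≈-trans (∑-cong (upTo ℓ) λ i → begin-equality
      (1ℝ - x ^ ℓ) * ((1ℝ - x) * inv (1ℝ - x ^ ℓ) 0<1-x^ℓ * x ^ i * f (throw C i))
        ≈⟨ solve 5 (λ b a i p s → b :* (a :* i :* p :* s) := b :* i :* (a :* (p :* s)))
            ≈-refl (1ℝ - x ^ ℓ) (1ℝ - x) _ (x ^ i) (f (throw C i)) ⟩
      (1ℝ - x ^ ℓ) * inv (1ℝ - x ^ ℓ) 0<1-x^ℓ * ((1ℝ - x) * (x ^ i * f (throw C i)))
        ≈⟨ ≈-trans (*-congʳ (inv-inverse _ 0<1-x^ℓ)) (*-identityˡ _) ⟩
      (1ℝ - x) * (x ^ i * f (throw C i)) ∎) (∑-*ˡ (upTo ℓ) _ _))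
      where open ≤-Reasoning

    -- After a step is taken in each half of the sum, this is `stationarySum-suc` read from right to
    -- left.
    stationarySum-expected : ∀ f →
        stationarySum x (suc n) (suc m) (expected f) ≈ stationarySum x (suc n) (suc m) f
    stationarySum-expected f = begin-equality
      (1ℝ - X) * (1ℝ - x ^ ℓ) * stationarySum x n m (expected f ∘ 0∪_+1) + X * stationarySum x
          (suc n) m (expected f ∘ _+1)
        ≈⟨ +-cong
             (≈-trans (*-assoc _ _ _) (*-congˡ (≈-trans (≈-sym (weightedSum-*ˡ x (αₘ x) n m _ _))
               (≈-trans (weightedSum-cong x (αₘ x) n m λ C _ → expected-0∪ f C)
                   (weightedSum-*ˡ x (αₘ x) n m _ _)))))
             (*-congˡ (weightedSum-cong x (αₘ x) (suc n) m λ A _ → expected-+1 f A)) ⟩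
      (1ℝ - X) * ((1ℝ - x) * stationarySum x n m (throwSum x ℓ f)) + X * stationarySum x (suc n) m f
        ≈⟨ solve 4 (λ x X s t → (con 1ℚ :- X) :* ((con 1ℚ :- x) :* s) :+ X :* t :=
            X :* t :+ (con 1ℚ :- x) :* (con 1ℚ :- X) :* s) ≈-refl x X _ _ ⟩
      X * stationarySum x (suc n) m f + (1ℝ - x) * (1ℝ - X) * stationarySum x n m (throwSum x ℓ f)
        ≈⟨ stationarySum-suc x n m f ⟨
      stationarySum x (suc n) (suc m) f ∎
      where
      open ≤-Reasoning
      X = x ^ suc n

    next-⊂-levels : ∀ {A i} → A ⊂[ suc m ] → i ℕ.< ℓ → next A i ⊂[ suc m ]
    next-⊂-levels {A} {i} A⊂ (s≤s i≤m∸n) = next-⊂ A i A⊂ (ℕₚ.n≤1+n m)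
      (s≤s (subst (i ℕ.+ n ℕ.≤_) (ℕₚ.m∸n+n≡m n≤m) (ℕₚ.+-monoˡ-≤ n i≤m∸n)))

    expected-cong : ∀ {f g A} → (∀ B → B ⊂[ suc m ] → f B ≈ g B) → A ⊂[ suc m ] →
        expected f A ≈ expected g A
    expected-cong {A = A} h A⊂ = ∑-cong-All
        (AllL.map (λ {i} i<ℓ → *-congˡ (h (next A i) (next-⊂-levels A⊂ i<ℓ))) (AllLₚ.all-upTo ℓ))

    expected-∑ : ∀ {I : Set} (is : List I) (f : I → ℕ⁽ suc n ⁾ → ℝ) A →
                 expected (λ B → ∑ is (λ i → f i B)) A ≈ ∑ is (λ i → expected (f i) A)
    expected-∑ is f A = ≈-trans (∑-cong (upTo ℓ) λ i → ≈-sym (∑-*ˡ is (ξ i) _))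
        (∑-swap (upTo ℓ) is _)

    expected-*ʳ : ∀ f c A → expected (λ B → f B * c) A ≈ expected f A * c
    expected-*ʳ f c A = ≈-trans (∑-cong (upTo ℓ) λ i → ≈-sym (*-assoc (ξ i) _ c))
        (∑-*ʳ (upTo ℓ) c _)

    transition-as-expected : ∀ A B → transition (suc m) (suc n) q A B ≈ expected (χ B) A
    transition-as-expected A B = ∑-cong (upTo ℓ) λ i →
        if-* (does (≡-dec ℕₚ._≟_ (elements (next A i)) (elements B))) (ξ i)
      where
      if-* : ∀ b t → (if b then t else 0ℝ) ≈ t * (if b then 1ℝ else 0ℝ)
      if-* true  t = ≈-sym (*-identityʳ t)
      if-* false t = ≈-sym (zeroʳ t)

    -- Several steps, and uniqueness of the invariant measure.

    expectedAfter : ℕ → (ℕ⁽ suc n ⁾ → ℝ) → ℕ⁽ suc n ⁾ → ℝ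
    expectedAfter zero    f = f
    expectedAfter (suc t) f = expected (expectedAfter t f)

    expectedAfter-nonneg : ∀ t {f} → (∀ A → 0ℝ ≤ f A) → ∀ A → 0ℝ ≤ expectedAfter t f A
    expectedAfter-nonneg zero    h A = h A
    expectedAfter-nonneg (suc t) h A = ∑-nonneg (upTo ℓ) λ i →
        0≤x*y (0≤ξ i) (expectedAfter-nonneg t h (next A i))

    ∑-expectedAfter-χ : ∀ t A → A ⊂[ suc m ] → ∑ Ω (λ B → expectedAfter t (χ B) A) ≈ 1ℝ
    ∑-expectedAfter-χ zero    A A⊂ = ≈-trans (∑-cong Ω λ B → ≈-sym (*-identityʳ (χ B A)))
        (∑-χ (suc n) (suc m) A (λ _ → 1ℝ) A⊂)
    ∑-expectedAfter-χ (suc t) A A⊂ = ≈-trans (≈-sym (expected-∑ Ω (λ B → expectedAfter t (χ B)) A))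
      (≈-trans (expected-cong (∑-expectedAfter-χ t) A⊂) (∑-ξ-const 1ℝ))

    settle : ℕ → ℕ⁽ suc n ⁾ → ℕ⁽ suc n ⁾
    settle zero    A = A
    settle (suc t) A = settle t (next A 0)

    -- Each throw of height 0 fills the lowest vacancy, so the bound on the elements drops by one
    -- per step until only {0 , ... , n} is possible.
    settle-⊂ : ∀ k A → A ⊂[ k ℕ.+ suc n ] → settle k A ⊂[ suc n ]
    settle-⊂ zero    A A⊂ = A⊂
    settle-⊂ (suc k) A A⊂ = settle-⊂ k (next A 0) (next-⊂ A 0 A⊂ ℕₚ.≤-refl (ℕₚ.m≤n+m (suc n) k))

    settles : ∀ A → A ⊂[ suc m ] → settle (m ℕ.∸ n) A ≡ initial (suc n)
    settles A A⊂ = ⊂⇒initial _ (settle-⊂ (m ℕ.∸ n) A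
      (subst (A ⊂[_]) (sym (trans (ℕₚ.+-suc (m ℕ.∸ n) n) (cong suc (ℕₚ.m∸n+n≡m n≤m)))) A⊂))

    -- Only the path on which every throw has height 0 is kept.
    expectedAfter-≥ : ∀ t {f} → (∀ A → 0ℝ ≤ f A) → ∀ A →
        ξ 0 ^ t * f (settle t A) ≤ expectedAfter t f A
    expectedAfter-≥ zero    h A = ≈⇒≤ (*-identityˡ _)
    expectedAfter-≥ (suc t) {f} h A = begin
      ξ 0 * ξ 0 ^ t * f (settle t (next A 0))     ≈⟨ *-assoc _ _ _ ⟩
      ξ 0 * (ξ 0 ^ t * f (settle t (next A 0)))   ≤⟨ *-monoʳ-≤ (0≤ξ 0)
          (expectedAfter-≥ t h (next A 0)) ⟩
      ξ 0 * expectedAfter t f (next A 0)          ≤⟨ x≤x+y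
          (∑-nonneg (List.applyUpTo suc (m ℕ.∸ n)) λ i →
          0≤x*y (0≤ξ i) (expectedAfter-nonneg t h (next A i))) ⟩
      expectedAfter (suc t) f A                   ∎
      where open ≤-Reasoning

    -- Doeblin's argument: m - n steps with ξ = 0 lead from every state to
    -- {0 , … , n}, so m - n steps contract signed measures of total mass 0.
    module _ (δ : ℕ⁽ suc n ⁾ → ℝ)
      (invariant : ∀ B → B ⊂[ suc m ] → δ B ≈ ∑ Ω (λ A → δ A * expected (χ B) A))
      (balanced : ∑ Ω δ ≈ 0ℝ) where

      private
        T = m ℕ.∸ n
        c = ξ 0 ^ T
        G = initial (suc n)
        D = ∑ Ω (λ A → ∣ δ A ∣)
        0<c = 0<x^j 0<ξ₀ T

        -- The kernel of `T` steps after removal of the part common to all starting points, namely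
        -- mass `c` at `G`. It is nonnegative and has total mass `1 - c`.
        excess : ℕ⁽ suc n ⁾ → ℕ⁽ suc n ⁾ → ℝ
        excess B A = expectedAfter T (χ B) A - c * χ B G

      -- `invariant` is the case of an indicator. The general case follows by linearity, since a
      -- step from a set in `Ω` stays in `Ω` and `f` is a combination of indicators there.
      ∑-δ-expected : ∀ f → ∑ Ω (λ A → δ A * expected f A) ≈ ∑ Ω (λ A → δ A * f A)
      ∑-δ-expected f = ≈-sym (begin-equality
        ∑ Ω (λ B → δ B * f B)
          ≈⟨ ∑-subsets-cong (suc n) (suc m)
              (λ B B⊂ → ≈-trans (*-congʳ (invariant B B⊂)) (≈-sym (∑-*ʳ Ω (f B) _))) ⟩
        ∑ Ω (λ B → ∑ Ω (λ A → δ A * expected (χ B) A * f B))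
          ≈⟨ ∑-swap Ω Ω (λ B A → δ A * expected (χ B) A * f B) ⟩
        ∑ Ω (λ A → ∑ Ω (λ B → δ A * expected (χ B) A * f B))
          ≈⟨ ∑-subsets-cong (suc n) (suc m) (λ A A⊂ → ≈-trans (∑-cong Ω λ B → *-assoc (δ A) _ (f B))
               (≈-trans (∑-*ˡ Ω (δ A) _)
                   (*-congˡ (≈-trans (∑-cong Ω λ B → ≈-sym (expected-*ʳ (χ B) (f B) A))
                 (≈-trans (≈-sym (expected-∑ Ω (λ B C → χ B C * f B) A))
                     (expected-cong (λ C → ∑-χ (suc n) (suc m) C f) A⊂)))))) ⟩
        ∑ Ω (λ A → δ A * expected f A) ∎)
        where open ≤-Reasoning

      ∑-δ-expectedAfter : ∀ t f → ∑ Ω (λ A → δ A * expectedAfter t f A) ≈ ∑ Ω (λ A → δ A * f A)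
      ∑-δ-expectedAfter zero    f = ≈-refl
      ∑-δ-expectedAfter (suc t) f = ≈-trans (∑-δ-expected (expectedAfter t f))
          (∑-δ-expectedAfter t f)

      excess-nonneg : ∀ B A → A ⊂[ suc m ] → 0ℝ ≤ excess B A
      excess-nonneg B A A⊂ = 0≤y-x
          (≤-trans (≈⇒≤ (*-congˡ (≈-reflexive (cong (χ B) (sym (settles A A⊂))))))
        (expectedAfter-≥ T (λ A → χ-nonneg B A) A))

      ∑-excess : ∀ A → A ⊂[ suc m ] → ∑ Ω (λ B → excess B A) ≈ 1ℝ - c
      ∑-excess A A⊂ = ≈-trans (∑-sub Ω _ _) (+-cong (∑-expectedAfter-χ T A A⊂)
        (-‿cong (≈-trans (∑-*ˡ Ω c (λ B → χ B G)) (≈-trans (*-congˡ (∑-expectedAfter-χ 0 G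
          (⊂-mono G (s≤s n≤m) (initial-⊂ (suc n))))) (*-identityʳ c)))))

      ∣δ∣≤ : ∀ B → B ⊂[ suc m ] → ∣ δ B ∣ ≤ ∑ Ω (λ A → ∣ δ A ∣ * excess B A)
      ∣δ∣≤ B B⊂ = begin
        ∣ δ B ∣
          ≈⟨ ∣∣-cong (≈-trans (≈-sym (∑-χ′ (suc n) (suc m) B δ B⊂))
              (∑-cong Ω λ A → *-comm (χ B A) (δ A))) ⟩
        ∣ ∑ Ω (λ A → δ A * χ B A) ∣
          ≈⟨ ∣∣-cong (≈-trans (≈-sym (∑-δ-expectedAfter T (χ B)))
              (solve 2 (λ s g → s := s :- con 0ℚ :* g) ≈-refl _ (c * χ B G))) ⟩
        -- The inserted 0 is the total mass of `δ`; this is where the kernel gets replaced by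
        -- `excess` at no cost.
        ∣ ∑ Ω (λ A → δ A * expectedAfter T (χ B) A) - 0ℝ * (c * χ B G) ∣
          ≈⟨ ∣∣-cong (≈-trans (+-congˡ
              (-‿cong (≈-trans (*-congʳ (≈-sym balanced)) (≈-sym (∑-*ʳ Ω _ δ)))))
              (≈-sym (∑-sub Ω _ _))) ⟩
        ∣ ∑ Ω (λ A → δ A * expectedAfter T (χ B) A - δ A * (c * χ B G)) ∣
          ≤⟨ ∣∑∣≤∑∣∣ Ω _ ⟩
        ∑ Ω (λ A → ∣ δ A * expectedAfter T (χ B) A - δ A * (c * χ B G) ∣)
          ≈⟨ ∑-subsets-cong (suc n) (suc m) (λ A A⊂ → ≈-trans
               (∣∣-cong (solve 3 (λ d e g → d :* e :- d :* g := d :* (e :- g)) ≈-refl (δ A) _ _))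
               (≈-trans (∣x*y∣≈∣x∣*∣y∣ (δ A) (excess B A))
                   (*-congˡ (0≤x⇒∣x∣≈x (excess-nonneg B A A⊂))))) ⟩
        ∑ Ω (λ A → ∣ δ A ∣ * excess B A) ∎
        where open ≤-Reasoning

      contraction : D ≤ D * (1ℝ - c)
      contraction = begin
        D                                                  ≤⟨ ∑-subsets-mono-≤ (suc n)
            (suc m) ∣δ∣≤ ⟩
        ∑ Ω (λ B → ∑ Ω (λ A → ∣ δ A ∣ * excess B A))       ≈⟨ ∑-swap Ω Ω
            (λ B A → ∣ δ A ∣ * excess B A) ⟩
        ∑ Ω (λ A → ∑ Ω (λ B → ∣ δ A ∣ * excess B A))       ≈⟨ ∑-subsets-cong (suc n) (suc m)
            (λ A A⊂ →
                                                                ≈-trans (∑-*ˡ Ω ∣ δ A ∣ _)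
                                                                    (*-congˡ (∑-excess A A⊂))) ⟩
        ∑ Ω (λ A → ∣ δ A ∣ * (1ℝ - c))                     ≈⟨ ∑-*ʳ Ω (1ℝ - c) _ ⟩
        D * (1ℝ - c)                                       ∎
        where open ≤-Reasoning

      D≤0 : D ≤ 0ℝ
      D≤0 = x*z≤y*z⇒x≤y 0<c (begin
        D * c                    ≈⟨ solve 2 (λ d c → d :* c := d :- d :* (con 1ℚ :- c)) ≈-refl D c ⟩
        D - D * (1ℝ - c)         ≤⟨ +-monoˡ-≤ (- (D * (1ℝ - c))) contraction ⟩
        D * (1ℝ - c) - D * (1ℝ - c) ≈⟨ -‿inverseʳ _ ⟩
        0ℝ                       ≈⟨ zeroˡ c ⟨
        0ℝ * c                   ∎)
        where open ≤-Reasoning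

      invariant-balanced⇒0 : ∀ B → B ⊂[ suc m ] → δ B ≈ 0ℝ
      invariant-balanced⇒0 B B⊂ = ∣x∣≤0⇒x≈0 (begin
        ∣ δ B ∣                          ≈⟨ ∑-χ′ (suc n) (suc m) B (λ A → ∣ δ A ∣) B⊂ ⟨
        ∑ Ω (λ A → χ B A * ∣ δ A ∣)      ≤⟨ ∑-mono-≤ Ω
            (λ A → ≤-trans (*-monoˡ-≤ (0≤∣x∣ (δ A)) (χ≤1 B A)) (≈⇒≤ (*-identityˡ _))) ⟩
        D                                ≤⟨ D≤0 ⟩
        0ℝ                               ∎)
        where open ≤-Reasoning

    ν : ℕ⁽ suc n ⁾ → ℝ
    ν B = stationarySum x (suc n) (suc m) (χ B)

    ∑-ν : ∀ f → ∑ Ω (λ B → ν B * f B) ≈ stationarySum x (suc n) (suc m) f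
    ∑-ν = weightedSum-χ (αₘ x) (suc n) (suc m)

    total-ν : ∑ Ω ν ≈ massₘ x 0≤x x≤1 (suc n) (suc m)
    total-ν = ≈-trans (∑-cong Ω λ B → ≈-sym (*-identityʳ (ν B))) (∑-ν (λ _ → 1ℝ))

    ν≤π∞ : ∀ B → B ⊂[ suc m ] → ν B ≤ π∞ (suc n) q B
    ν≤π∞ B B⊂ = ≤-trans
      (weightedSum-mono-≤ x (αₘ x) 0≤x (0≤αₘ x 0≤x x≤1) (αₘ≤α∞ x 0≤x x≤1) (suc n) (suc m)
          (χ-nonneg B))
      (≈⇒≤ (≈-sym (π∞-as-weightedSum (suc n) (suc m) B B⊂)))

    module _ (π : ℕ⁽ suc n ⁾ → ℝ) (stationary : IsStationary (suc m) (suc n) q π) where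

      open IsStationary stationary

      private
        Z = massₘ x 0≤x x≤1 (suc n) (suc m)

      -- The signed measure `Z * π - ν` is invariant and has total mass `Z - Z`. Scaling `π` up
      -- instead of normalising `ν` avoids a division by `Z`.
      Zπ≈ν : ∀ B → B ⊂[ suc m ] → Z * π B ≈ ν B
      Zπ≈ν B B⊂ = ≈-trans (solve 2 (λ a b → a := (a :- b) :+ b) ≈-refl (Z * π B) (ν B))
        (≈-trans (+-congʳ (invariant-balanced⇒0 δ invariant balanced B B⊂)) (+-identityˡ (ν B)))
        where
        δ : ℕ⁽ suc n ⁾ → ℝ
        δ A = Z * π A - ν A

        invariant : ∀ B → B ⊂[ suc m ] → δ B ≈ ∑ Ω (λ A → δ A * expected (χ B) A)
        invariant B B⊂ = ≈-sym (begin-equality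
          ∑ Ω (λ A → (Z * π A - ν A) * expected (χ B) A)
            ≈⟨ ∑-cong Ω (λ A → solve 4 (λ z p v e → (z :* p :- v) :* e := z :* (p :* e) :- v :* e)
                ≈-refl Z (π A) (ν A) _) ⟩
          ∑ Ω (λ A → Z * (π A * expected (χ B) A) - ν A * expected (χ B) A)
            ≈⟨ ∑-sub Ω _ _ ⟩
          ∑ Ω (λ A → Z * (π A * expected (χ B) A)) - ∑ Ω (λ A → ν A * expected (χ B) A)
            ≈⟨ +-cong (≈-trans (∑-*ˡ Ω Z _) (*-congˡ (≈-trans
                   (∑-cong Ω λ A → *-congˡ (≈-sym (transition-as-expected A B)))
                       (≈-sym (balance B B⊂)))))
                 (-‿cong (≈-trans (∑-ν (expected (χ B))) (stationarySum-expected (χ B)))) ⟩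
          Z * π B - ν B ∎)
          where open ≤-Reasoning

        balanced : ∑ Ω δ ≈ 0ℝ
        balanced = ≈-trans (∑-sub Ω _ _) (≈-trans
          (+-cong (≈-trans (∑-*ˡ Ω Z π) (≈-trans (*-congˡ total) (*-identityʳ Z))) (-‿cong total-ν))
              (-‿inverseʳ Z))

-- The total variation distance.

∏-nonneg : ∀ {A : Set} (xs : List A) {f} → (∀ a → 0ℝ ≤ f a) → 0ℝ ≤ ∏ xs f
∏-nonneg []       h = 0≤1
∏-nonneg (x ∷ xs) h = 0≤x*y (h x) (∏-nonneg xs h)

0≤π∞ : ∀ q n A → 0ℝ ≤ π∞ n q A
0≤π∞ q n A = 0≤x*y
  (0≤x*y (∏-nonneg (List.map suc (upTo n)) (0≤1-x^ (value q) (<⇒≤ (0< q)) (<⇒≤ (<1 q))))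
      (0≤inv _ (0<x^j (0< q) (n Comb.C 2))))
  (∏-nonneg (Vec.toList (elements A)) (^-nonneg (<⇒≤ (0< q))))

module _ (q : OpenUnitInterval) (m n : ℕ) (n≤m : n ℕ.≤ m)
  (π : ℕ⁽ suc n ⁾ → ℝ) (stationary : IsStationary (suc m) (suc n) q π) where

  open IsStationary stationary

  private
    x = value q
    0≤x = <⇒≤ (0< q)
    x≤1 = <⇒≤ (<1 q)
    Ω = subsets (suc n) (suc m)
    Z = massₘ x 0≤x x≤1 (suc n) (suc m)
    Y = ν q m n n≤m
    Π = π∞ (suc n) q

  π∞-mass : ∀ N → ∑ (subsets (suc n) N) Π ≈ mass∞ x 0≤x x≤1 (suc n) N
  π∞-mass N = ≈-trans (∑-cong (subsets (suc n) N) λ A → ≈-sym (*-identityʳ (Π A)))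
      (∑-π∞ q (suc n) N (λ _ → 1ℝ))

  -- Outside `Ω` the distribution `π` vanishes and `∣ π A - Π A ∣ - Π A` is 0. So subtracting `Π`
  -- makes the infinite sum finite, and the 1 restores the total mass of `Π`.
  distance : ℝ
  distance = ½ℝ * (∑ Ω (λ A → ∣ π A - Π A ∣ - Π A) + 1ℝ)

  0≤distance : 0ℝ ≤ distance
  0≤distance = 0≤x*y 0≤½ (begin
    0ℝ                                           ≤⟨ 0≤y-x (mass∞≤1 x 0≤x x≤1 (suc n) (suc m)) ⟩
    1ℝ - mass∞ x 0≤x x≤1 (suc n) (suc m)         ≈⟨ +-congˡ (-‿cong (π∞-mass (suc m))) ⟨
    1ℝ - ∑ Ω Π                                   ≤⟨ +-mono-≤
        (x≤x+y (∑-nonneg Ω λ A → 0≤∣x∣ (π A - Π A))) ≤-refl ⟩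
    1ℝ + ∑ Ω (λ A → ∣ π A - Π A ∣) - ∑ Ω Π       ≈⟨ solve 3 (λ o s p → o :+ s :- p := s :- p :+ o)
        ≈-refl 1ℝ _ _ ⟩
    ∑ Ω (λ A → ∣ π A - Π A ∣) - ∑ Ω Π + 1ℝ       ≈⟨ +-congʳ (∑-sub Ω _ Π) ⟨
    ∑ Ω (λ A → ∣ π A - Π A ∣ - Π A) + 1ℝ         ∎)
    where open ≤-Reasoning

  ∣π-π∞∣≤ : ∀ A → A ⊂[ suc m ] → ∣ π A - Π A ∣ ≤ (1ℝ - Z) * π A + (Π A - Y A)
  ∣π-π∞∣≤ A A⊂ = begin
    ∣ π A - Π A ∣
      ≈⟨ ∣∣-cong (solve 4 (λ z p v s → p :- s := (con 1ℚ :- z) :* p :+ (z :* p :- s))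
          ≈-refl Z (π A) (Y A) (Π A)) ⟩
    ∣ (1ℝ - Z) * π A + (Z * π A - Π A) ∣
      ≈⟨ ∣∣-cong (+-congˡ (+-congʳ (Zπ≈ν q m n n≤m π stationary A A⊂))) ⟩
    ∣ (1ℝ - Z) * π A + (Y A - Π A) ∣
      ≤⟨ ∣x+y∣≤∣x∣+∣y∣ _ _ ⟩
    ∣ (1ℝ - Z) * π A ∣ + ∣ Y A - Π A ∣
      ≈⟨ +-cong (0≤x⇒∣x∣≈x (0≤x*y (0≤y-x (massₘ≤1 x 0≤x x≤1 (suc n) (suc m))) (nonnegative A)))
           (≈-trans (∣x-y∣≈∣y-x∣ (Y A) (Π A)) (0≤x⇒∣x∣≈x (0≤y-x (ν≤π∞ q m n n≤m A A⊂)))) ⟩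
    (1ℝ - Z) * π A + (Π A - Y A) ∎
    where open ≤-Reasoning

  -- When the pointwise bound is summed, `Π` cancels against the term subtracted in `distance`; what
  -- remains is half of `(1 - Z) - Z + 1`.
  distance≤ : distance ≤ 1ℝ - Z
  distance≤ = begin
    ½ℝ * (∑ Ω (λ A → ∣ π A - Π A ∣ - Π A) + 1ℝ)
      ≤⟨ *-monoʳ-≤ 0≤½ (+-monoˡ-≤ 1ℝ (∑-subsets-mono-≤ (suc n) (suc m) λ A A⊂ →
           ≤-trans (+-monoˡ-≤ (- Π A) (∣π-π∞∣≤ A A⊂))
             (≈⇒≤ (solve 3 (λ p s v → p :+ (s :- v) :- s := p :- v) ≈-refl _ (Π A) (Y A))))) ⟩
    ½ℝ * (∑ Ω (λ A → (1ℝ - Z) * π A - Y A) + 1ℝ)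
      ≈⟨ *-congˡ (+-congʳ (≈-trans (∑-sub Ω _ Y) (+-cong
           (≈-trans (∑-*ˡ Ω (1ℝ - Z) π) (≈-trans (*-congˡ total) (*-identityʳ _)))
               (-‿cong (total-ν q m n n≤m))))) ⟩
    ½ℝ * (1ℝ - Z - Z + 1ℝ)
      ≈⟨ solve 1 (λ z → con ½ :* (con 1ℚ :- z :- z :+ con 1ℚ) := con 1ℚ :- z) ≈-refl Z ⟩
    1ℝ - Z ∎
    where open ≤-Reasoning

  -- The difference is exactly minus one half of the mass of `π∞` not yet exhausted at `N`.
  partial-distance : ∀ N → suc m ℕ.≤ N →
    ∣ ½ℝ * ∑ (subsets (suc n) N) (λ A → ∣ π A - Π A ∣) - distance ∣ ≤ 1ℝ - mass∞ x 0≤x x≤1 (suc n) N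
  partial-distance N m<N = begin
    ∣ ½ℝ * S - distance ∣
      ≈⟨ ∣∣-cong (+-congˡ (-‿cong (*-congˡ (+-congʳ (≈-trans
           (≈-sym (∑-subsets-restrict (suc n) m<N _ outside))
               (≈-trans (∑-sub (subsets (suc n) N) _ Π) (+-congˡ (-‿cong (π∞-mass N))))))))) ⟩
    ∣ ½ℝ * S - ½ℝ * (S - M + 1ℝ) ∣
      ≈⟨ ∣∣-cong (solve 2 (λ s m → con ½ :* s :- con ½ :* (s :- m :+ con 1ℚ) :=
          con 0ℚ :- con ½ :* (con 1ℚ :- m)) ≈-refl S M) ⟩
    ∣ 0ℝ - ½ℝ * (1ℝ - M) ∣
      ≈⟨ ≈-trans (∣x-y∣≈∣y-x∣ _ _)
          (≈-trans (∣∣-cong (solve 1 (λ s → s :- con 0ℚ := s) ≈-refl _))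
          (0≤x⇒∣x∣≈x (0≤x*y 0≤½ 0≤1-M))) ⟩
    ½ℝ * (1ℝ - M)
      ≤⟨ y≤x+y (0≤x*y 0≤½ 0≤1-M) ⟩
    ½ℝ * (1ℝ - M) + ½ℝ * (1ℝ - M)
      ≈⟨ ½x+½x≈x (1ℝ - M) ⟩
    1ℝ - M ∎
    where
    open ≤-Reasoning
    S = ∑ (subsets (suc n) N) (λ A → ∣ π A - Π A ∣)
    M = mass∞ x 0≤x x≤1 (suc n) N
    0≤1-M = 0≤y-x (mass∞≤1 x 0≤x x≤1 (suc n) N)

    outside : ∀ A → ¬ A ⊂[ suc m ] → ∣ π A - Π A ∣ - Π A ≈ 0ℝ
    outside A A⊄ = begin-equality
      ∣ π A - Π A ∣ - Π A   ≈⟨ +-congʳ (∣∣-cong (+-congʳ (concentrated A A⊄))) ⟩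
      ∣ 0ℝ - Π A ∣ - Π A    ≈⟨ +-congʳ
          (≈-trans (∣x-y∣≈∣y-x∣ _ _) (∣∣-cong (solve 1 (λ s → s :- con 0ℚ := s) ≈-refl (Π A)))) ⟩
      ∣ Π A ∣ - Π A         ≈⟨ +-congʳ (0≤x⇒∣x∣≈x (0≤π∞ q (suc n) A)) ⟩
      Π A - Π A             ≈⟨ -‿inverseʳ (Π A) ⟩
      0ℝ                    ∎

  distance-isTotalVariation : IsTotalVariation π Π distance
  distance-isTotalVariation = ⇝⇒⟶ λ ε 0<ε →
    let N₀ , decay = geometric-decay 0≤x (0<y-x (<1 q))
          (≈⇒≤ (solve 1 (λ x → x :+ (con 1ℚ :- x) := con 1ℚ) ≈-refl x)) (fromℕ (suc n)) ε 0<ε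
    -- From `suc m` on the support of `π` is exhausted; the other bound gives `N ∸ suc n ≥ N₀`, so
    -- that the decay applies to the tail of `π∞`.
    in suc m ℕ.⊔ (N₀ ℕ.+ suc n) , λ N N≥ →
      let N₀+n≤N = ℕₚ.m⊔n≤o⇒n≤o (suc m) (N₀ ℕ.+ suc n) N≥
          k+n≡N  = ℕₚ.m∸n+n≡m (ℕₚ.≤-trans (ℕₚ.m≤n+m (suc n) N₀) N₀+n≤N)
      in begin
        ∣ ½ℝ * ∑ (subsets (suc n) N) (λ A → ∣ π A - Π A ∣) - distance ∣
          ≤⟨ partial-distance N (ℕₚ.m⊔n≤o⇒m≤o (suc m) (N₀ ℕ.+ suc n) N≥) ⟩
        1ℝ - mass∞ x 0≤x x≤1 (suc n) N
          ≡⟨ cong (λ N → 1ℝ - mass∞ x 0≤x x≤1 (suc n) N) k+n≡N ⟨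
        1ℝ - mass∞ x 0≤x x≤1 (suc n) (N ℕ.∸ suc n ℕ.+ suc n)
          ≤⟨ 1-mass∞-bound x 0≤x x≤1 (suc n) (N ℕ.∸ suc n) ⟩
        fromℕ (suc n) * x ^ suc (N ℕ.∸ suc n)
          ≤⟨ decay (suc (N ℕ.∸ suc n)) (ℕₚ.m≤n⇒m≤1+n (ℕₚ.m+n≤o⇒m≤o∸n N₀ N₀+n≤N)) ⟩
        ε ∎
    where open ≤-Reasoning

∃-totalVariation : ∀ q m n → 1 ℕ.≤ n → n ℕ.≤ m → (π : ℕ⁽ n ⁾ → ℝ) → IsStationary m n q π →
  ∃[ d ] IsTotalVariation π (π∞ n q) d × 0ℝ ≤ d × d ≤ fromℕ 3 * (fromℕ m * value q ^ levels m n)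
∃-totalVariation q (suc m) (suc n) 1≤n (s≤s n≤m) π stationary =
  distance q m n n≤m π stationary ,
  distance-isTotalVariation q m n n≤m π stationary ,
  0≤distance q m n n≤m π stationary ,
  ≤-trans (distance≤ q m n n≤m π stationary)
      (1-massₘ-bound (value q) (<⇒≤ (0< q)) (<⇒≤ (<1 q)) 1≤n (s≤s n≤m))

-- From exp (ℓ log q⁻¹ - log m) ≥ 1 + M and m = exp (log m).
m*q^ℓ-bound : ∀ q m ℓ {a b M} → 1 ℕ.≤ m → IsLog (inv (value q) (0< q)) a → IsLog (fromℕ m) b →
  0ℝ ≤ M → M ≤ fromℕ ℓ * a - b → (1ℝ + M) * (fromℕ m * value q ^ ℓ) ≤ 1ℝ
m*q^ℓ-bound q m ℓ {a} {b} {M} 1≤m ha hb 0≤M M≤ = begin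
  (1ℝ + M) * (fromℕ m * x ^ ℓ)
    ≤⟨ *-monoˡ-≤ (0≤x*y (0≤fromℕ m) 0≤x^ℓ) (+-monoʳ-≤ 1ℝ M≤) ⟩
  (1ℝ + z) * (fromℕ m * x ^ ℓ)
    ≈⟨ *-assoc _ _ _ ⟨
  (1ℝ + z) * fromℕ m * x ^ ℓ
    ≤⟨ *-monoˡ-≤ 0≤x^ℓ (exp-growth ℓ (⟶⇒⇝ ha) (⟶⇒⇝ hb) (fromℕ-mono-≤ 1≤m) (≤-trans 0≤M M≤)
         (solve 2 (λ c b → c :- b :+ b := c) ≈-refl (fromℕ ℓ * a) b)) ⟩
  inv x (0< q) ^ ℓ * x ^ ℓ
    ≈⟨ ^-*-distrib _ x ℓ ⟨
  (inv x (0< q) * x) ^ ℓ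
    ≈⟨ ^-cong ℓ (≈-trans (*-comm _ x) (inv-inverse x (0< q))) ⟩
  1ℝ ^ ℓ
    ≈⟨ 1^n≈1 ℓ ⟩
  1ℝ ∎
  where
  open ≤-Reasoning
  x = value q
  z = fromℕ ℓ * a - b
  0≤x^ℓ = ^-nonneg (<⇒≤ (0< q)) ℓ

theorem3p1 : (n m : ℕ → ℕ) (q : ℕ → OpenUnitInterval) →
    (∀ k → 1 ℕ.≤ n k) →
    (∀ k → n k ℕ.≤ m k) →
    (log-q⁻¹ log-m : ℕ → ℝ) →
    (∀ k → IsLog (inv (value (q k)) (0< (q k))) (log-q⁻¹ k)) →
    (∀ k → IsLog (fromℕ (m k)) (log-m k)) →
    (λ k → fromℕ (levels (m k) (n k)) * log-q⁻¹ k - log-m k) ⟶∞ →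
    (π : ∀ k → ℕ⁽ n k ⁾ → ℝ) →
    (∀ k → IsStationary (m k) (n k) (q k) (π k)) →
    ∃[ d ] ((∀ k → IsTotalVariation (π k) (π∞ (n k) (q k)) (d k)) × d ⟶ 0ℝ)
theorem3p1 n m q 1≤n n≤m log-q⁻¹ log-m is-log-q⁻¹ is-log-m diverges π stationary =
  proj₁ ∘ tv , proj₁ ∘ proj₂ ∘ tv , ⇝⇒⟶ λ ε 0<ε →
    -- With `u = m q^ℓ` the distance is at most `3 u`, which equals `ε * (M * u)` for this `M`,
    -- while divergence past `M` yields `(1 + M) * u ≤ 1`.
    let M = fromℕ 3 * inv ε 0<ε
        0≤M = 0≤x*y (0≤fromℕ 3) (0≤inv ε 0<ε)
    in mapₑ (λ {k} M< →
      let _ , _ , 0≤d , d≤ = tv k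
          bound = m*q^ℓ-bound (q k) (m k) (levels (m k) (n k)) (ℕₚ.≤-trans (1≤n k) (n≤m k))
                    (is-log-q⁻¹ k) (is-log-m k) 0≤M (<⇒≤ M<)
          u = fromℕ (m k) * value (q k) ^ levels (m k) (n k)
          0≤u = 0≤x*y (0≤fromℕ (m k)) (^-nonneg (<⇒≤ (0< (q k))) (levels (m k) (n k)))
      in begin
        ∣ proj₁ (tv k) - 0ℝ ∣          ≈⟨ ∣∣-cong (solve 1 (λ d → d :- con 0ℚ := d) ≈-refl _) ⟩
        ∣ proj₁ (tv k) ∣               ≈⟨ 0≤x⇒∣x∣≈x 0≤d ⟩
        proj₁ (tv k)                   ≤⟨ d≤ ⟩
        fromℕ 3 * u                    ≈⟨ ≈-trans (*-congʳ (inv-inverse ε 0<ε)) (*-identityˡ _) ⟨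
        ε * inv ε 0<ε * (fromℕ 3 * u)  ≈⟨ solve 4
            (λ e i t u → e :* i :* (t :* u) := e :* (t :* i :* u)) ≈-refl ε _ (fromℕ 3) u ⟩
        ε * (M * u)                    ≤⟨ x*y≤x (<⇒≤ 0<ε)
            (≤-trans (*-monoˡ-≤ 0≤u (y≤x+y 0≤1)) bound) ⟩
        ε                              ∎)
      (diverges M)
  where
  open ≤-Reasoning
  tv : ∀ k → _
  tv k = ∃-totalVariation (q k) (m k) (n k) (1≤n k) (n≤m k) (π k) (stationary k)
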